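{- Let $D_n$ denote the age of a uniformly random Catalan--Stanley tree of size $n$. As $n\to\infty$, for $r\in\mathbb{Z}_{\ge1}$, \begin{multline*} \mathbb{P}(D_n=r) = \Big(\frac{4(4^{r}(3r-1)+1)}{(4^{r}+2)^{2}} - \frac{4(4^{r+1}(3r+2)+1)}{(4^{r+1}+2)^{2}}\Big)\\ - \Big(\frac{6\cdot 64^{r}(2r^{3}-5r^{2}+4r-1) - 6\cdot 16^{r}(16r^{3}-24r^{2}+10r-1) + 24\cdot 4^{r}(2r^{3}-r^{2})}{(4^{r}+2)^{4}}\\ - \frac{6\cdot 64^{r+1}(2r^{3}+r^{2}) - 6\cdot 16^{r+1}(16r^{3}+24r^{2}+10r+1) + 24\cdot 4^{r+1}(2r^{3}+5r^{2}+4r+1)}{(4^{r+1}+2)^{4}}\Big)n^{ -1}\\ + O\Big(\frac{r^{5}}{3^{r}}n^{ -2}\Big), \end{multline*} where the $O$-term holds uniformly in $r$. Moreover, with \begin{align*} c_0 &= \sum_{r\ge1}\frac{4^{r+1}(3r-1)+4}{(4^{r}+2)^{2}} = 2.71825364286795285266\ldots,\\ c_1 &= -\sum_{r\ge1}\frac{6\cdot64^{r}(2r^{3}-5r^{2}+4r-1) - 6\cdot16^{r}(16r^{3}-24r^{2}+10r-1) + 24\cdot4^{r}(2r-1)r^{2}}{(4^{r}+2)^{4}} = -4.22209715101588408238\ldots,\\ c_2 &= \sum_{r\ge1}(2r-1)\frac{4^{r+1}(3r-1)+4}{(4^{r}+2)^{2}} - c_0^{2} = 0.91845604214374797357\ldots,\\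 c_3 &= -\sum_{r\ge1}\frac{2r-1}{(4^{r}+2)^{4}}\big(6\cdot64^{r}(2r^{3}-5r^{2}+4r-1) - 6\cdot16^{r}(16r^{3}-24r^{2}+10r-1) + 24\cdot4^{r}(2r-1)r^{2}\big) - 2c_0c_1\\ &= -9.16217532008362749969\ldots, \end{align*} one has \[ \mathbb{E}D_n = c_0 + c_1n^{ -1} + O(n^{ -2}),\qquad \mathbb{V}D_n = c_2 + c_3 n^{ -1} + O(n^{ -2}). \]
   Context: A rooted plane tree has ordered children at every node; its size is its number of nodes. For each child $c$ of the root, the rightmost leaf of the branch at $c$ is the leaf reached from $c$ by repeatedly moving to the rightmost child. A Catalan--Stanley tree is a rooted plane tree in which every such rightmost leaf has odd distance to the root (the one-node tree is included); there are $C_{n-2}$ of them of size $n\ge2$. The reduction $\rho$: for each rightmost leaf $\ell$ of a branch attached to the root, if $\ell$ is a child of the root it is deleted; otherwise all descendants of the grandparent of $\ell$ are deleted (the grandparent becomes a leaf); the one-node tree is mapped to itself. The age of a Catalan--Stanley tree $\tau$ is the least $r\ge0$ such that $\rho^{r}(\tau)$ is the one-node tree. $D_n$ is the age of a Catalan--Stanley tree chosen uniformly at random among those of size $n$. -}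

module Defs where

open import Data.Bool using (Bool; true; false; if_then_else_; _∧_; not)
open import Data.Nat as ℕ using (ℕ; zero; suc; _≡ᵇ_)
open import Data.Nat.Properties using ()
open import Data.List using (List; []; _∷_; concatMap; filterᵇ; length; map; upTo; foldr)
open import Data.Integer as Z using (ℤ; +_)
open import Data.Rational as Q using (ℚ; 0ℚ; 1ℚ)
open import Data.Product using (Σ; ∃; _×_; _,_)
open import Relation.Nullary.Decidable using (does)

allB : {A : Set} → (A → Bool) → List A → Bool
allB p [] = true
allB p (x ∷ xs) = p x ∧ allB p xs

data Tree : Set where
  node : List Tree → Tree

mutual
  size : Tree → ℕ
  size (node cs) = suc (sizeL cs)

  sizeL : List Tree → ℕ
  sizeL [] = 0
  sizeL (t ∷ ts) = size t ℕ.+ sizeL ts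

leaf : Tree
leaf = node []

isLeaf : Tree → Bool
isLeaf (node []) = true
isLeaf (node (_ ∷ _)) = false

mutual
  rdepth : Tree → ℕ
  rdepth (node cs) = rdepthL cs

  rdepthL : List Tree → ℕ
  rdepthL [] = 0
  rdepthL (t ∷ []) = suc (rdepth t)
  rdepthL (t ∷ u ∷ ts) = rdepthL (u ∷ ts)

even : ℕ → Bool
even zero = true
even (suc zero) = false
even (suc (suc n)) = even n

-- Catalan--Stanley: for every child c of the root, the rightmost leaf of
-- the branch at c has distance 1 + rdepth c to the root, required odd.
isCS : Tree → Bool
isCS (node cs) = allB (λ c → even (rdepth c)) cs

-- Enumeration of all plane trees of a given size (fuel-based; a forest
-- of size k is produced correctly with fuel ≥ k).

forestsF : ℕ → ℕ → List (List Tree)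
forestsF _ zero = [] ∷ []
forestsF zero (suc k) = []
forestsF (suc f) (suc k) =
  concatMap (λ j → concatMap (λ a → map (λ b → node a ∷ b) (forestsF f (k ℕ.∸ j)))
                             (forestsF f j))
            (upTo (suc k))

forests : ℕ → List (List Tree)
forests k = forestsF k k

treesOfSize : ℕ → List Tree
treesOfSize zero = []
treesOfSize (suc k) = map node (forests k)

csTrees : ℕ → List Tree
csTrees n = filterᵇ (λ t → isCS t) (treesOfSize n)

-- On a branch whose rightmost leaf ℓ has depth ≥ 2 below the branch root:
-- the node of the rightmost path that is the grandparent of ℓ (the one
-- with rdepth 2) loses all its descendants.
mutual
  cutT : Tree → Tree
  cutT (node cs) = if rdepthL cs ≡ᵇ 2 then node [] else node (cutL cs)

  cutL : List Tree → List Tree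
  cutL [] = []
  cutL (t ∷ []) = cutT t ∷ []
  cutL (t ∷ u ∷ ts) = t ∷ cutL (u ∷ ts)

ρstep : Tree → List Tree
ρstep c = if isLeaf c then [] else (cutT c ∷ [])

ρ : Tree → Tree
ρ (node cs) = node (concatMap ρstep cs)

iter : ℕ → Tree → Tree
iter zero t = t
iter (suc r) t = iter r (ρ t)

ageF : ℕ → Tree → ℕ
ageF _ (node []) = 0
ageF zero (node (_ ∷ _)) = 0
ageF (suc f) t@(node (_ ∷ _)) = suc (ageF f (ρ t))

-- the age; the fuel size t suffices since ρ strictly decreases the size
-- of any tree other than the one-node tree
age : Tree → ℕ
age t = ageF (size t) t

hasAge : ℕ → Tree → Bool
hasAge r t = isLeaf (iter r t) ∧ allB (λ s → not (isLeaf (iter s t))) (upTo r)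

-- q / d  (with the convention q / 0 = 0, never used on the relevant range)
_÷ℕ_ : ℚ → ℕ → ℚ
q ÷ℕ zero = 0ℚ
q ÷ℕ suc d = q Q.* (+ 1 Q./ suc d)

infixl 7 _÷ℕ_

frac : ℤ → ℕ → ℚ
frac z d = (z Q./ 1) ÷ℕ d

ℕtoℚ : ℕ → ℚ
ℕtoℚ n = + n Q./ 1

ℤtoℚ : ℤ → ℚ
ℤtoℚ z = z Q./ 1

sumℚ : List ℚ → ℚ
sumℚ = foldr Q._+_ 0ℚ

numCS : ℕ → ℕ
numCS n = length (csTrees n)

probD : ℕ → ℕ → ℚ
probD n r = ℕtoℚ (length (filterᵇ (λ t → hasAge r t) (csTrees n))) ÷ℕ numCS n

expD : ℕ → ℚ
expD n = sumℚ (map (λ t → ℕtoℚ (age t)) (csTrees n)) ÷ℕ numCS n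

exp2D : ℕ → ℚ
exp2D n = sumℚ (map (λ t → ℕtoℚ (age t ℕ.* age t)) (csTrees n)) ÷ℕ numCS n

varD : ℕ → ℚ
varD n = exp2D n Q.- expD n Q.* expD n

pow : ℤ → ℕ → ℤ
pow z zero = + 1
pow z (suc k) = z Z.* pow z k

i : ℕ → ℤ
i r = + r

q4 : ℕ → ℕ
q4 r = 4 ℕ.^ r ℕ.+ 2

mainTerm0 : ℕ → ℚ
mainTerm0 r =
  frac (+ 4 Z.* (pow (+ 4) r Z.* (+ 3 Z.* i r Z.- + 1) Z.+ + 1)) (q4 r ℕ.^ 2)
  Q.- frac (+ 4 Z.* (pow (+ 4) (suc r) Z.* (+ 3 Z.* i r Z.+ + 2) Z.+ + 1)) (q4 (suc r) ℕ.^ 2)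

numA : ℕ → ℤ
numA r =
  + 6 Z.* pow (+ 64) r Z.* (+ 2 Z.* pow (i r) 3 Z.- + 5 Z.* pow (i r) 2 Z.+ + 4 Z.* i r Z.- + 1)
  Z.- + 6 Z.* pow (+ 16) r Z.* (+ 16 Z.* pow (i r) 3 Z.- + 24 Z.* pow (i r) 2 Z.+ + 10 Z.* i r Z.- + 1)
  Z.+ + 24 Z.* pow (+ 4) r Z.* (+ 2 Z.* pow (i r) 3 Z.- pow (i r) 2)

numB : ℕ → ℤ
numB r =
  + 6 Z.* pow (+ 64) (suc r) Z.* (+ 2 Z.* pow (i r) 3 Z.+ pow (i r) 2)
  Z.- + 6 Z.* pow (+ 16) (suc r) Z.* (+ 16 Z.* pow (i r) 3 Z.+ + 24 Z.* pow (i r) 2 Z.+ + 10 Z.* i r Z.+ + 1)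
  Z.+ + 24 Z.* pow (+ 4) (suc r) Z.* (+ 2 Z.* pow (i r) 3 Z.+ + 5 Z.* pow (i r) 2 Z.+ + 4 Z.* i r Z.+ + 1)

-- the coefficient of n^{-1} (inside the subtracted bracket)
mainTerm1 : ℕ → ℚ
mainTerm1 r = frac (numA r) (q4 r ℕ.^ 4) Q.- frac (numB r) (q4 (suc r) ℕ.^ 4)

a0 : ℕ → ℚ
a0 r = frac (pow (+ 4) (suc r) Z.* (+ 3 Z.* i r Z.- + 1) Z.+ + 4) (q4 r ℕ.^ 2)

b1 : ℕ → ℚ
b1 r = frac
  (+ 6 Z.* pow (+ 64) r Z.* (+ 2 Z.* pow (i r) 3 Z.- + 5 Z.* pow (i r) 2 Z.+ + 4 Z.* i r Z.- + 1)
   Z.- + 6 Z.* pow (+ 16) r Z.* (+ 16 Z.* pow (i r) 3 Z.- + 24 Z.* pow (i r) 2 Z.+ + 10 Z.* i r Z.- + 1)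
   Z.+ + 24 Z.* pow (+ 4) r Z.* (+ 2 Z.* i r Z.- + 1) Z.* pow (i r) 2)
  (q4 r ℕ.^ 4)

sumTo : ℕ → (ℕ → ℚ) → ℚ
sumTo zero f = 0ℚ
sumTo (suc K) f = sumTo K f Q.+ f (suc K)

twoRm1 : ℕ → ℚ
twoRm1 r = ℤtoℚ (+ 2 Z.* i r Z.- + 1)

-- K-th partial approximations of c0, c1, c2, c3 (ci = lim_{K→∞} sK)
s0 : ℕ → ℚ
s0 K = sumTo K a0

s1 : ℕ → ℚ
s1 K = Q.- sumTo K b1

s2 : ℕ → ℚ
s2 K = sumTo K (λ r → twoRm1 r Q.* a0 r) Q.- s0 K Q.* s0 K

s3 : ℕ → ℚ
s3 K = Q.- sumTo K (λ r → twoRm1 r Q.* b1 r) Q.- ℕtoℚ 2 Q.* s0 K Q.* s1 K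

-- limsup_{K→∞} |s K| ≤ δ.  With s K = x - t K and t K → t (a real),
-- this says exactly |x - t| ≤ δ.

LimAbsLe : (ℕ → ℚ) → ℚ → Set
LimAbsLe s δ = (ε : ℚ) → 0ℚ Q.< ε →
  ∃ λ K₀ → (K : ℕ) → K₀ ℕ.≤ K → Q.∣ s K ∣ Q.≤ δ Q.+ ε

invN : ℕ → ℚ
invN n = 1ℚ ÷ℕ n

tenM20 : ℚ
tenM20 = 1ℚ ÷ℕ (10 ℕ.^ 20)

dec20 : ℤ → ℚ
dec20 z = frac z (10 ℕ.^ 20)

{-# OPTIONS --safe #-}
-- ρ shortens the rightmost path of every branch by two, so the age of a Catalan–Stanley tree is
-- one more than half the largest rightmost depth of a branch.  If T = z + T² is the generating
-- function of plane trees, then forests whose rightmost path has length d are counted by Tᵈ, all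
-- Catalan–Stanley trees by z (1 + T), and those of age at least r by z G, where d = 2r - 1 and
-- G (1 + Tᵈ) = (1 + T) Tᵈ, that is, G = Σ_{j ≥ 1} (-1)^(j-1) (T^(jd) + T^(jd+1)).
--
-- The coefficients [zᵐ] Tᵏ satisfy a two-term recurrence in k; dividing by the number [zᵐ] T of
-- trees of size n = m + 1 it gives k 2^(1-k) (1 - (k-1)(k-2)/(4n)) up to O(k⁵ 2⁻ᵏ n⁻²), uniformly in
-- k.  The alternating sum of these main terms over k = jd and k = jd + 1 is summed in closed form,
-- and the error propagates through the recursion G = Tᵈ + Tᵈ⁺¹ - Tᵈ G, whose iteration contracts.
-- The moments are Σ_r P(D ≥ r) and Σ_r (2r-1) P(D ≥ r), and the digits come from 128 terms in
-- fixed-point arithmetic together with a geometric bound for the tails.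
module Submission where

open import Defs
open import Data.Nat as ℕ using (ℕ; zero; suc; _≤_; _<_; z≤n; s≤s; _^_; _≡ᵇ_)
import Data.Nat.Properties as ℕP
open import Data.Nat.ListAction using (sum)
import Data.Nat.Tactic.RingSolver as ℕSolver
open import Data.Integer as ℤ using (ℤ; +_; -[1+_])
import Data.Integer.Properties as ℤP
open import Data.Integer.DivMod using (_/ℕ_; _%ℕ_; a≡a%ℕn+[a/ℕn]*n; n%ℕd<d)
import Data.Integer.Tactic.RingSolver as ℤSolver
open import Data.Rational as ℚ using (ℚ; _+_; _-_; _*_; -_; ∣_∣; 0ℚ; 1ℚ; ½)
open import Data.Rational using () renaming (_≤_ to _≤ℚ_)
import Data.Rational.Properties as ℚP
import Data.Rational.Unnormalised as ℚᵘ
import Data.Rational.Unnormalised.Properties as ℚᵘP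
open import Data.Bool using (Bool; true; false; _∧_; not)
open import Data.List using (List; []; _∷_; _++_; concat; concatMap; filterᵇ; length; map; upTo; applyUpTo)
open import Data.Product using (_×_; _,_; ∃; proj₁; proj₂)
open import Data.Sum using (_⊎_; inj₁; inj₂)
open import Function using (_∘_; id)
open import Level using (0ℓ)
open import Algebra using (CommutativeSemiring)
open import Relation.Binary.PropositionalEquality using (_≡_; refl; sym; trans; cong; cong₂; subst; subst₂; module ≡-Reasoning)
open import Relation.Nullary.Decidable using (dec⇒maybe; from-yes)
open import Tactic.RingSolver.Core.AlmostCommutativeRing using (AlmostCommutativeRing; fromCommutativeRing)
open import Tactic.RingSolver using (solve-∀)

-- Power series

-- Coefficients are natural numbers, so series are neither subtracted nor inverted. Identities that
-- would need a division are proved by showing that both sides solve one equation `f = y + h f` with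
-- `h` of zero constant term. Likewise the alternating sum for G is never formed: the coefficients
-- of `T^(jd) G` take its place. Sums of neighbours among them are known, and they vanish once `jd`
-- exceeds the degree.
--
-- The obstacle is uniformity. The expansion of `[zᵐ] Tᵏ` is informative only while `k²` is small
-- against `n`, yet `k` runs past `n`. Errors are therefore bounded by a polynomial in `k` times
-- `n⁻²`, a bound that survives for large `k`: there the coefficient is zero and the model is
-- dominated because `k/n` is at least 1. The polynomial is absorbed by a slight loss in the rate ½.
--
-- Infinite sums enter only through partial sums. For `K` above all ages of a given size the moments
-- are themselves finite sums, and their distance to the approximations with `K` terms is a finite
-- sum of errors, up to quadratic corrections for the variance.

Series : Set
Series = ℕ → ℕ

infix 4 _≈_
_≈_ : Series → Series → Set
f ≈ g = ∀ n → f n ≡ g n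

tail : Series → Series
tail f n = f (suc n)

infixl 6 _⊕_
_⊕_ : Series → Series → Series
(f ⊕ g) n = f n ℕ.+ g n

infixl 7 _⊛_
_⊛_ : Series → Series → Series
(f ⊛ g) zero = f 0 ℕ.* g 0
(f ⊛ g) (suc n) = f 0 ℕ.* g (suc n) ℕ.+ (tail f ⊛ g) n

𝟘 𝟙 z : Series
𝟘 _ = 0
𝟙 zero = 1
𝟙 (suc _) = 0
z zero = 0
z (suc n) = 𝟙 n

infixr 7 _·_
_·_ : ℕ → Series → Series
(c · f) n = c ℕ.* f n

⊛-cong : ∀ {f f′ g g′} → f ≈ f′ → g ≈ g′ → f ⊛ g ≈ f′ ⊛ g′
⊛-cong p q zero = cong₂ ℕ._*_ (p 0) (q 0)
⊛-cong p q (suc n) = cong₂ ℕ._+_ (cong₂ ℕ._*_ (p 0) (q (suc n))) (⊛-cong (p ∘ suc) q n)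

⊛-zeroˡ : ∀ f → 𝟘 ⊛ f ≈ 𝟘
⊛-zeroˡ f zero = refl
⊛-zeroˡ f (suc n) = ⊛-zeroˡ f n

⊛-identityˡ : ∀ f → 𝟙 ⊛ f ≈ f
⊛-identityˡ f zero = ℕP.+-identityʳ (f 0)
⊛-identityˡ f (suc n) = trans (cong₂ ℕ._+_ (ℕP.+-identityʳ (f (suc n))) (⊛-zeroˡ f n)) (ℕP.+-identityʳ _)

⊛-distribʳ : ∀ f g h → (g ⊕ h) ⊛ f ≈ (g ⊛ f) ⊕ (h ⊛ f)
⊛-distribʳ f g h zero = ℕP.*-distribʳ-+ (f 0) (g 0) (h 0)
⊛-distribʳ f g h (suc n) =
  trans (cong ((g 0 ℕ.+ h 0) ℕ.* f (suc n) ℕ.+_) (⊛-distribʳ f (tail g) (tail h) n))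
        (lemma (g 0) (h 0) (f (suc n)) _ _)
  where
  lemma : ∀ a b c p q → (a ℕ.+ b) ℕ.* c ℕ.+ (p ℕ.+ q) ≡ (a ℕ.* c ℕ.+ p) ℕ.+ (b ℕ.* c ℕ.+ q)
  lemma = ℕSolver.solve-∀

⊛-scaleˡ : ∀ c f g → (c · f) ⊛ g ≈ c · (f ⊛ g)
⊛-scaleˡ c f g zero = ℕP.*-assoc c (f 0) (g 0)
⊛-scaleˡ c f g (suc n) =
  trans (cong (c ℕ.* f 0 ℕ.* g (suc n) ℕ.+_) (⊛-scaleˡ c (tail f) g n)) (lemma c (f 0) (g (suc n)) _)
  where
  lemma : ∀ c a b p → c ℕ.* a ℕ.* b ℕ.+ c ℕ.* p ≡ c ℕ.* (a ℕ.* b ℕ.+ p)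
  lemma = ℕSolver.solve-∀

⊛-sucʳ : ∀ f g n → (f ⊛ g) (suc n) ≡ g 0 ℕ.* f (suc n) ℕ.+ (f ⊛ tail g) n
⊛-sucʳ f g zero = lemma (f 0) (g 1) (f 1) (g 0)
  where
  lemma : ∀ a b c d → a ℕ.* b ℕ.+ c ℕ.* d ≡ d ℕ.* c ℕ.+ a ℕ.* b
  lemma = ℕSolver.solve-∀
⊛-sucʳ f g (suc n) =
  trans (cong (f 0 ℕ.* g (2 ℕ.+ n) ℕ.+_) (⊛-sucʳ (tail f) g n)) (lemma (f 0 ℕ.* g (2 ℕ.+ n)) (g 0 ℕ.* f (2 ℕ.+ n)) _)
  where
  lemma : ∀ a b c → a ℕ.+ (b ℕ.+ c) ≡ b ℕ.+ (a ℕ.+ c)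
  lemma = ℕSolver.solve-∀

⊛-comm : ∀ f g → f ⊛ g ≈ g ⊛ f
⊛-comm f g zero = ℕP.*-comm (f 0) (g 0)
⊛-comm f g (suc n) = trans (cong (f 0 ℕ.* g (suc n) ℕ.+_) (⊛-comm (tail f) g n)) (sym (⊛-sucʳ g f n))

⊛-assoc : ∀ f g h → (f ⊛ g) ⊛ h ≈ f ⊛ (g ⊛ h)
⊛-assoc f g h zero = ℕP.*-assoc (f 0) (g 0) (h 0)
⊛-assoc f g h (suc n) = begin
  f 0 ℕ.* g 0 ℕ.* h (suc n) ℕ.+ (((f 0 · tail g) ⊕ (tail f ⊛ g)) ⊛ h) n
    ≡⟨ cong (f 0 ℕ.* g 0 ℕ.* h (suc n) ℕ.+_) (⊛-distribʳ h (f 0 · tail g) (tail f ⊛ g) n) ⟩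
  f 0 ℕ.* g 0 ℕ.* h (suc n) ℕ.+ (((f 0 · tail g) ⊛ h) n ℕ.+ ((tail f ⊛ g) ⊛ h) n)
    ≡⟨ cong (f 0 ℕ.* g 0 ℕ.* h (suc n) ℕ.+_) (cong₂ ℕ._+_ (⊛-scaleˡ (f 0) (tail g) h n) (⊛-assoc (tail f) g h n)) ⟩
  f 0 ℕ.* g 0 ℕ.* h (suc n) ℕ.+ (f 0 ℕ.* (tail g ⊛ h) n ℕ.+ (tail f ⊛ (g ⊛ h)) n)
    ≡⟨ lemma (f 0) (g 0) (h (suc n)) _ _ ⟩
  f 0 ℕ.* (g 0 ℕ.* h (suc n) ℕ.+ (tail g ⊛ h) n) ℕ.+ (tail f ⊛ (g ⊛ h)) n ∎
  where
  open ≡-Reasoning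
  lemma : ∀ a b c p q → a ℕ.* b ℕ.* c ℕ.+ (a ℕ.* p ℕ.+ q) ≡ a ℕ.* (b ℕ.* c ℕ.+ p) ℕ.+ q
  lemma = ℕSolver.solve-∀

series : CommutativeSemiring 0ℓ 0ℓ
series = record
  { Carrier = Series ; _≈_ = _≈_ ; _+_ = _⊕_ ; _*_ = _⊛_ ; 0# = 𝟘 ; 1# = 𝟙
  ; isCommutativeSemiring = record
    { isSemiring = record
      { isSemiringWithoutAnnihilatingZero = record
        { +-isCommutativeMonoid = record
          { isMonoid = record
            { isSemigroup = record
              { isMagma = record
                { isEquivalence = record
                  { refl = λ n → refl ; sym = λ p n → sym (p n) ; trans = λ p q n → trans (p n) (q n) }
                ; ∙-cong = λ p q n → cong₂ ℕ._+_ (p n) (q n) }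
              ; assoc = λ f g h n → ℕP.+-assoc (f n) (g n) (h n) }
            ; identity = (λ f n → refl) , (λ f n → ℕP.+-identityʳ (f n)) }
          ; comm = λ f g n → ℕP.+-comm (f n) (g n) }
        ; *-cong = ⊛-cong
        ; *-assoc = ⊛-assoc
        ; *-identity = ⊛-identityˡ , (λ f n → trans (⊛-comm f 𝟙 n) (⊛-identityˡ f n))
        ; distrib = (λ f g h n → trans (⊛-comm f (g ⊕ h) n) (trans (⊛-distribʳ f g h n)
                       (cong₂ ℕ._+_ (⊛-comm g f n) (⊛-comm h f n))))
                  , ⊛-distribʳ }
      ; zero = ⊛-zeroˡ , (λ f n → trans (⊛-comm f 𝟘 n) (⊛-zeroˡ f n)) }
    ; *-comm = ⊛-comm } }

open CommutativeSemiring series using () renaming (refl to ≈-refl; sym to ≈-sym; trans to ≈-trans; +-cong to ⊕-cong)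
import Algebra.Solver.Ring.NaturalCoefficients.Default series as Sv
open Sv using (_:+_; _:*_; _:=_; con)
import Relation.Binary.Reasoning.Setoid (CommutativeSemiring.setoid series) as ≈R

z⊛-suc : ∀ f n → (z ⊛ f) (suc n) ≡ f n
z⊛-suc f n = ⊛-identityˡ f n

-- As `h` has zero constant term, coefficient `n` of `h ⊛ f` involves `f` only below `n`.
⊛-local : ∀ h f g N → h 0 ≡ 0 → (∀ n → n < N → f n ≡ g n) → ∀ n → n ≤ N → (h ⊛ f) n ≡ (h ⊛ g) n
⊛-local h f g N h0 p zero _ = trans (cong (ℕ._* f 0) h0) (sym (cong (ℕ._* g 0) h0))
⊛-local h f g N h0 p (suc n) n<N = cong₂ ℕ._+_
    (trans (cong (ℕ._* f (suc n)) h0) (sym (cong (ℕ._* g (suc n)) h0)))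
    (go (tail h) n n<N)
  where
  go : ∀ h n → n < N → (h ⊛ f) n ≡ (h ⊛ g) n
  go h zero lt = cong (h 0 ℕ.*_) (p 0 lt)
  go h (suc n) lt = cong₂ ℕ._+_ (cong (h 0 ℕ.*_) (p (suc n) lt)) (go (tail h) n (ℕP.<-trans (ℕP.n<1+n n) lt))

-- Each coefficient of a solution is determined by the earlier ones. This replaces the division by
-- `1 - h`, which coefficients in ℕ do not allow.
fixpoint-unique : ∀ h y f g → h 0 ≡ 0 → f ≈ y ⊕ (h ⊛ f) → g ≈ y ⊕ (h ⊛ g) → f ≈ g
fixpoint-unique h y f g h0 pf pg n = below (suc n) n (ℕP.n<1+n n)
  where
  below : ∀ N n → n < N → f n ≡ g n
  below (suc N) n (s≤s n≤N) =
    trans (pf n) (trans (cong (y n ℕ.+_) (⊛-local h f g N h0 (below N) n n≤N)) (sym (pg n)))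

infixr 8 _^^_
_^^_ : Series → ℕ → Series
f ^^ zero = 𝟙
f ^^ suc k = f ⊛ f ^^ k

^^-+ : ∀ f k l → f ^^ (k ℕ.+ l) ≈ f ^^ k ⊛ f ^^ l
^^-+ f zero l = ≈-sym (⊛-identityˡ (f ^^ l))
^^-+ f (suc k) l = ≈-trans (⊛-cong {f} ≈-refl (^^-+ f k l)) (≈-sym (⊛-assoc f (f ^^ k) (f ^^ l)))

-- Multiplication by `f` raises the order by at least one. This ends the alternating recursion and
-- makes high powers of `T` vanish in a fixed degree.
^^-low : ∀ f → f 0 ≡ 0 → ∀ k g n → n < k → (f ^^ k ⊛ g) n ≡ 0
^^-low f f0 (suc k) g n (s≤s n≤k) = begin
  ((f ⊛ f ^^ k) ⊛ g) n ≡⟨ ⊛-assoc f (f ^^ k) g n ⟩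
  (f ⊛ (f ^^ k ⊛ g)) n ≡⟨ ⊛-local f (f ^^ k ⊛ g) 𝟘 k f0 (^^-low f f0 k g) n n≤k ⟩
  (f ⊛ 𝟘) n            ≡⟨ CommutativeSemiring.zeroʳ series f n ⟩
  0 ∎
  where open ≡-Reasoning

-- Weighted sums over forests

∑ : {A : Set} → List A → (A → ℕ) → ℕ
∑ xs w = sum (map w xs)

Σ< : ℕ → (ℕ → ℕ) → ℕ
Σ< zero h = 0
Σ< (suc n) h = h 0 ℕ.+ Σ< n (h ∘ suc)

∑-cong : {A : Set} (xs : List A) {v w : A → ℕ} → (∀ x → v x ≡ w x) → ∑ xs v ≡ ∑ xs w
∑-cong [] p = refl
∑-cong (x ∷ xs) p = cong₂ ℕ._+_ (p x) (∑-cong xs p)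

∑-zero : {A : Set} (xs : List A) → ∑ xs (λ _ → 0) ≡ 0
∑-zero [] = refl
∑-zero (x ∷ xs) = ∑-zero xs

∑-+ : {A : Set} (xs : List A) (v w : A → ℕ) → ∑ xs (λ x → v x ℕ.+ w x) ≡ ∑ xs v ℕ.+ ∑ xs w
∑-+ [] v w = refl
∑-+ (x ∷ xs) v w = trans (cong (v x ℕ.+ w x ℕ.+_) (∑-+ xs v w)) (lemma (v x) (w x) _ _)
  where
  lemma : ∀ a b c d → a ℕ.+ b ℕ.+ (c ℕ.+ d) ≡ a ℕ.+ c ℕ.+ (b ℕ.+ d)
  lemma = ℕSolver.solve-∀

∑-*ˡ : {A : Set} (xs : List A) (c : ℕ) (v : A → ℕ) → ∑ xs (λ x → c ℕ.* v x) ≡ c ℕ.* ∑ xs v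
∑-*ˡ [] c v = sym (ℕP.*-zeroʳ c)
∑-*ˡ (x ∷ xs) c v = trans (cong (c ℕ.* v x ℕ.+_) (∑-*ˡ xs c v)) (sym (ℕP.*-distribˡ-+ c (v x) _))

∑-++ : {A : Set} (xs ys : List A) (w : A → ℕ) → ∑ (xs ++ ys) w ≡ ∑ xs w ℕ.+ ∑ ys w
∑-++ [] ys w = refl
∑-++ (x ∷ xs) ys w = trans (cong (w x ℕ.+_) (∑-++ xs ys w)) (sym (ℕP.+-assoc (w x) _ _))

∑-map : {A B : Set} (f : A → B) (xs : List A) (w : B → ℕ) → ∑ (map f xs) w ≡ ∑ xs (w ∘ f)
∑-map f [] w = refl
∑-map f (x ∷ xs) w = cong (w (f x) ℕ.+_) (∑-map f xs w)

∑-concatMap : {A B : Set} (f : A → List B) (xs : List A) (w : B → ℕ) → ∑ (concatMap f xs) w ≡ ∑ xs (λ x → ∑ (f x) w)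
∑-concatMap f [] w = refl
∑-concatMap f (x ∷ xs) w = trans (∑-++ (f x) (concatMap f xs) w) (cong (∑ (f x) w ℕ.+_) (∑-concatMap f xs w))

∑-applyUpTo : (s : ℕ → ℕ) (n : ℕ) (h : ℕ → ℕ) → ∑ (applyUpTo s n) h ≡ Σ< n (h ∘ s)
∑-applyUpTo s zero h = refl
∑-applyUpTo s (suc n) h = cong (h (s 0) ℕ.+_) (∑-applyUpTo (s ∘ suc) n h)

Σ<-cong : ∀ n {g h : ℕ → ℕ} → (∀ j → j < n → g j ≡ h j) → Σ< n g ≡ Σ< n h
Σ<-cong zero p = refl
Σ<-cong (suc n) p = cong₂ ℕ._+_ (p 0 (s≤s z≤n)) (Σ<-cong n (λ j lt → p (suc j) (s≤s lt)))

Σ<-+ : ∀ n (g h : ℕ → ℕ) → Σ< n (λ j → g j ℕ.+ h j) ≡ Σ< n g ℕ.+ Σ< n h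
Σ<-+ zero g h = refl
Σ<-+ (suc n) g h = trans (cong (g 0 ℕ.+ h 0 ℕ.+_) (Σ<-+ n (g ∘ suc) (h ∘ suc))) (lemma (g 0) (h 0) _ _)
  where
  lemma : ∀ a b c d → a ℕ.+ b ℕ.+ (c ℕ.+ d) ≡ a ℕ.+ c ℕ.+ (b ℕ.+ d)
  lemma = ℕSolver.solve-∀

Σ<-conv : ∀ f g k → Σ< (suc k) (λ j → f j ℕ.* g (k ℕ.∸ j)) ≡ (f ⊛ g) k
Σ<-conv f g zero = ℕP.+-identityʳ _
Σ<-conv f g (suc k) = cong (f 0 ℕ.* g (suc k) ℕ.+_) (Σ<-conv (tail f) g k)

map-upTo-cong : {B : Set} (n : ℕ) {g h : ℕ → B} → (∀ j → j < n → g j ≡ h j) → map g (upTo n) ≡ map h (upTo n)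
map-upTo-cong n = go n id (λ j lt → lt)
  where
  go : {B : Set} {N : ℕ} (n : ℕ) (s : ℕ → ℕ) {g h : ℕ → B} → (∀ j → j < n → s j < N) →
       (∀ j → j < N → g j ≡ h j) → map g (applyUpTo s n) ≡ map h (applyUpTo s n)
  go zero s lt p = refl
  go (suc n) s lt p = cong₂ _∷_ (p (s 0) (lt 0 (s≤s z≤n))) (go n (s ∘ suc) (λ j j<n → lt (suc j) (s≤s j<n)) p)

-- The enumeration passes the same fuel to both parts of a split, usually more than their sizes;
-- this lets the parts be read as `forests` of their own size.
forestsF-fuel : ∀ f f′ k → k ≤ f → k ≤ f′ → forestsF f k ≡ forestsF f′ k
forestsF-fuel f f′ zero _ _ = refl
forestsF-fuel (suc f) (suc f′) (suc k) (s≤s k≤f) (s≤s k≤f′) =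
  cong concat (map-upTo-cong (suc k) eq)
  where
  eq : ∀ j → j < suc k →
       concatMap (λ a → map (λ b → node a ∷ b) (forestsF f (k ℕ.∸ j))) (forestsF f j) ≡
       concatMap (λ a → map (λ b → node a ∷ b) (forestsF f′ (k ℕ.∸ j))) (forestsF f′ j)
  eq j (s≤s j≤k) = cong₂ (λ as bs → concatMap (λ a → map (λ b → node a ∷ b) bs) as)
    (forestsF-fuel f f′ j (ℕP.≤-trans j≤k k≤f) (ℕP.≤-trans j≤k k≤f′))
    (forestsF-fuel f f′ (k ℕ.∸ j) (ℕP.≤-trans (ℕP.m∸n≤m k j) k≤f) (ℕP.≤-trans (ℕP.m∸n≤m k j) k≤f′))

-- Coefficient `k` runs over the forests with `k` nodes, that is, over the trees `node cs` of size
-- `k + 1`.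
gf : (List Tree → ℕ) → Series
gf w k = ∑ (forests k) w

gf-cong : ∀ {v w} → (∀ cs → v cs ≡ w cs) → gf v ≈ gf w
gf-cong p k = ∑-cong (forests k) p

gf-+ : ∀ v w → gf (λ cs → v cs ℕ.+ w cs) ≈ gf v ⊕ gf w
gf-+ v w k = ∑-+ (forests k) v w

∑-× : {A B : Set} (xs : List A) (ys : List B) (u : A → ℕ) (v : B → ℕ) →
  ∑ xs (λ a → ∑ ys (λ b → u a ℕ.* v b)) ≡ ∑ xs u ℕ.* ∑ ys v
∑-× xs ys u v = trans (∑-cong xs (λ a → trans (∑-*ˡ ys (u a) v) (ℕP.*-comm (u a) _)))
  (trans (∑-*ˡ xs (∑ ys v) u) (ℕP.*-comm (∑ ys v) _))

gf-suc : ∀ w k → gf w (suc k) ≡ Σ< (suc k) (λ j → ∑ (forests j) (λ a → ∑ (forests (k ℕ.∸ j)) (λ b → w (node a ∷ b))))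
gf-suc w k = trans (∑-concatMap parts (upTo (suc k)) w)
  (trans (∑-applyUpTo id (suc k) (λ j → ∑ (parts j) w)) (Σ<-cong (suc k) eq))
  where
  parts : ℕ → List (List Tree)
  parts j = concatMap (λ a → map (λ b → node a ∷ b) (forestsF k (k ℕ.∸ j))) (forestsF k j)
  eq : ∀ j → j < suc k →
    ∑ (parts j) w ≡
    ∑ (forests j) (λ a → ∑ (forests (k ℕ.∸ j)) (λ b → w (node a ∷ b)))
  eq j (s≤s j≤k) = trans (∑-concatMap _ (forestsF k j) w)
    (trans (∑-cong (forestsF k j) (λ a → ∑-map (λ b → node a ∷ b) (forestsF k (k ℕ.∸ j)) w))
      (cong₂ (λ as bs → ∑ as (λ a → ∑ bs (λ b → w (node a ∷ b))))
        (forestsF-fuel k j j j≤k ℕP.≤-refl)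
        (forestsF-fuel k (k ℕ.∸ j) (k ℕ.∸ j) (ℕP.m∸n≤m k j) ℕP.≤-refl)))

-- Splitting off the first tree gives the product; `tail` accounts for the root of that tree.
gf-product : ∀ w u v → (∀ a b → w (node a ∷ b) ≡ u a ℕ.* v b) → tail (gf w) ≈ gf u ⊛ gf v
gf-product w u v p k = trans (gf-suc w k)
  (trans (Σ<-cong (suc k) (λ j _ → trans (∑-cong (forests j) (λ a → ∑-cong (forests (k ℕ.∸ j)) (p a)))
                                          (∑-× (forests j) (forests (k ℕ.∸ j)) u v)))
         (Σ<-conv (gf u) (gf v) k))

-- Weights on the last tree need two summands: either the first tree is the last one, or the rest of
-- the forest decides.
gf-product₂ : ∀ w u v u′ v′ → (∀ a b → w (node a ∷ b) ≡ u a ℕ.* v b ℕ.+ u′ a ℕ.* v′ b) →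
  tail (gf w) ≈ gf u ⊛ gf v ⊕ gf u′ ⊛ gf v′
gf-product₂ w u v u′ v′ p k = trans (gf-suc w k)
  (trans (Σ<-cong (suc k) eq) (trans (Σ<-+ (suc k) (λ j → gf u j ℕ.* gf v (k ℕ.∸ j)) (λ j → gf u′ j ℕ.* gf v′ (k ℕ.∸ j))) (cong₂ ℕ._+_ (Σ<-conv (gf u) (gf v) k) (Σ<-conv (gf u′) (gf v′) k))))
  where
  eq : ∀ j → j < suc k → _ ≡ gf u j ℕ.* gf v (k ℕ.∸ j) ℕ.+ gf u′ j ℕ.* gf v′ (k ℕ.∸ j)
  eq j _ = trans (∑-cong (forests j) (λ a → trans (∑-cong (forests (k ℕ.∸ j)) (p a)) (∑-+ (forests (k ℕ.∸ j)) _ _)))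
    (trans (∑-+ (forests j) _ _) (cong₂ ℕ._+_ (∑-× (forests j) (forests (k ℕ.∸ j)) u v)
                                             (∑-× (forests j) (forests (k ℕ.∸ j)) u′ v′)))

δ : List Tree → ℕ
δ [] = 1
δ (_ ∷ _) = 0

gf-δ : gf δ ≈ 𝟙
gf-δ zero = refl
gf-δ (suc k) = trans (gf-product δ (λ _ → 0) (λ _ → 0) (λ _ _ → refl) k)
  (trans (⊛-cong {g = gf (λ _ → 0)} (λ n → ∑-zero (forests n)) ≈-refl k) (⊛-zeroˡ _ k))

-- T is the generating function of plane trees.
F T : Series
F = gf (λ _ → 1)
T = z ⊛ F

unfold₀ : ∀ f g → f 0 ≡ 0 → tail f ≈ g → f ≈ z ⊛ g
unfold₀ f g f0 p zero = f0
unfold₀ f g f0 p (suc n) = trans (p n) (sym (z⊛-suc g n))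

unfold₁ : ∀ f g → f 0 ≡ 1 → tail f ≈ g → f ≈ 𝟙 ⊕ z ⊛ g
unfold₁ f g f0 p zero = f0
unfold₁ f g f0 p (suc n) = trans (p n) (sym (z⊛-suc g n))

T-eq : T ≈ z ⊕ T ⊛ T
T-eq = ≈-trans (⊛-cong {z} ≈-refl (unfold₁ F (F ⊛ F) refl (gf-product (λ _ → 1) (λ _ → 1) (λ _ → 1) (λ _ _ → refl))))
  (Sv.solve 2 (λ z F → z :* (con 1 :+ z :* (F :* F)) := z :+ (z :* F) :* (z :* F)) (λ n → refl) z F)

-- w sees only the last tree of a forest.
gf-last : ∀ w u → w [] ≡ 0 → (∀ a b → w (node a ∷ b) ≡ u a ℕ.* δ b ℕ.+ w b) → gf w ≈ T ⊛ gf u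
gf-last w u w0 p = fixpoint-unique T (z ⊛ gf u) (gf w) (T ⊛ gf u) refl fixed₁ fixed₂
  where
  step : tail (gf w) ≈ gf u ⊛ gf δ ⊕ F ⊛ gf w
  step = gf-product₂ w u δ (λ _ → 1) w (λ a b → trans (p a b) (cong (u a ℕ.* δ b ℕ.+_) (sym (ℕP.+-identityʳ (w b)))))
  fixed₁ : gf w ≈ z ⊛ gf u ⊕ T ⊛ gf w
  fixed₁ = ≈-trans (unfold₀ (gf w) (gf u ⊛ 𝟙 ⊕ F ⊛ gf w) (trans (ℕP.+-identityʳ (w [])) w0)
      (≈-trans step (⊕-cong (⊛-cong {gf u} ≈-refl gf-δ) ≈-refl)))
    (Sv.solve 4 (λ z U F W → z :* (U :* con 1 :+ F :* W) := z :* U :+ (z :* F) :* W) (λ n → refl) z (gf u) F (gf w))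
  -- Solving for `gf w` would give the factor `z / (1 - T)`, which is `T` because `T = z + T²`.
  fixed₂ : T ⊛ gf u ≈ z ⊛ gf u ⊕ T ⊛ (T ⊛ gf u)
  fixed₂ = ≈-trans (⊛-cong T-eq (≈-refl {gf u}))
    (Sv.solve 3 (λ z T U → (z :+ T :* T) :* U := z :* U :+ T :* (T :* U)) (λ n → refl) z T (gf u))

gf-allChildren : ∀ w u → w [] ≡ 1 → (∀ a b → w (node a ∷ b) ≡ u a ℕ.* w b) → gf w ≈ 𝟙 ⊕ z ⊛ (gf u ⊛ gf w)
gf-allChildren w u w0 p = unfold₁ (gf w) (gf u ⊛ gf w) (trans (ℕP.+-identityʳ (w [])) w0) (gf-product w u w p)

-- Ages

ind : Bool → ℕ
ind true = 1
ind false = 0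

ind-∧ : ∀ b c → ind (b ∧ c) ≡ ind b ℕ.* ind c
ind-∧ false c = refl
ind-∧ true c = sym (ℕP.+-identityʳ (ind c))

double : ℕ → ℕ
double zero = zero
double (suc r) = suc (suc (double r))

-- evenBelow r k decides whether k is even and k < 2r.
evenBelow : ℕ → ℕ → Bool
evenBelow zero k = false
evenBelow (suc r) zero = true
evenBelow (suc r) (suc zero) = false
evenBelow (suc r) (suc (suc k)) = evenBelow r k

evenBelow-suc : ∀ r k → ind (evenBelow (suc r) k) ≡ ind (evenBelow r k) ℕ.+ ind (k ≡ᵇ double r)
evenBelow-suc zero zero = refl
evenBelow-suc (suc r) zero = refl
evenBelow-suc zero (suc zero) = refl
evenBelow-suc (suc r) (suc zero) = refl
evenBelow-suc zero (suc (suc k)) = refl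
evenBelow-suc (suc r) (suc (suc k)) = evenBelow-suc r k

evenBelow⇒even : ∀ r k → evenBelow r k ≡ true → even k ≡ true
evenBelow⇒even (suc r) zero p = refl
evenBelow⇒even (suc r) (suc (suc k)) p = evenBelow⇒even r k p

even∧<⇒evenBelow : ∀ r k → even k ≡ true → k < r → evenBelow r k ≡ true
even∧<⇒evenBelow (suc r) zero e lt = refl
even∧<⇒evenBelow (suc r) (suc (suc k)) e (s≤s lt) = even∧<⇒evenBelow r k e (ℕP.≤-trans (s≤s (ℕP.n≤1+n k)) lt)

∧-true : ∀ {b c} → b ∧ c ≡ true → b ≡ true × c ≡ true
∧-true {true} {true} p = refl , refl

mutual
  -- The cut turns the node of right depth 2 into a leaf, so every node above it on the rightmost
  -- path loses two from its depth. A path of depth below 2 has no node to cut.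
  rdepth-cutT : ∀ t → 2 ≤ rdepth t → rdepth t ≡ 2 ℕ.+ rdepth (cutT t)
  rdepth-cutT (node cs) le with rdepthL cs in eq
  rdepth-cutT (node cs) (s≤s (s≤s z≤n)) | suc (suc zero) = refl
  rdepth-cutT (node cs) (s≤s (s≤s z≤n)) | suc (suc (suc k)) =
    trans (sym eq) (rdepthL-cutL cs (subst (3 ≤_) (sym eq) (s≤s (s≤s (s≤s z≤n)))))

  rdepthL-cutL : ∀ cs → 3 ≤ rdepthL cs → rdepthL cs ≡ 2 ℕ.+ rdepthL (cutL cs)
  rdepthL-cutL (t ∷ []) (s≤s le) = cong suc (rdepth-cutT t le)
  rdepthL-cutL (t ∷ u ∷ []) le = rdepthL-cutL (u ∷ []) le
  rdepthL-cutL (t ∷ u ∷ v ∷ ts) le = rdepthL-cutL (u ∷ v ∷ ts) le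

-- Parity excludes depth 1, so a branch is either a leaf, which is deleted, or contains the
-- grandparent of its rightmost leaf.
ρstep-view : ∀ c → even (rdepth c) ≡ true →
  (rdepth c ≡ 0 × ρstep c ≡ []) ⊎ (rdepth c ≡ 2 ℕ.+ rdepth (cutT c) × ρstep c ≡ cutT c ∷ [])
ρstep-view (node []) e = inj₁ (refl , refl)
ρstep-view (node (t ∷ ts)) e = inj₂ (rdepth-cutT (node (t ∷ ts)) (two≤ (rdepthL (t ∷ ts)) e (nonzero t ts)) , refl)
  where
  nonzero : ∀ t ts → 1 ≤ rdepthL (t ∷ ts)
  nonzero t [] = s≤s z≤n
  nonzero t (u ∷ ts) = nonzero u ts
  two≤ : ∀ k → even k ≡ true → 1 ≤ k → 2 ≤ k
  two≤ (suc (suc k)) e le = s≤s (s≤s z≤n)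

-- The criterion for age at most `r`: each application of `ρ` removes the branches of depth 0 and
-- lowers the others by two.
ageLe : ℕ → List Tree → Bool
ageLe r cs = allB (λ c → evenBelow r (rdepth c)) cs

ρ-CS : ∀ cs → isCS (node cs) ≡ true → isCS (ρ (node cs)) ≡ true
ρ-CS [] p = refl
ρ-CS (c ∷ cs) p with ∧-true p
... | e , p′ with ρstep-view c e
... | inj₁ (_ , eq) rewrite eq = ρ-CS cs p′
... | inj₂ (d , eq) rewrite eq | d | e = ρ-CS cs p′

ageLe-ρ : ∀ r cs → isCS (node cs) ≡ true → ageLe r (concatMap ρstep cs) ≡ ageLe (suc r) cs
ageLe-ρ r [] p = refl
ageLe-ρ r (c ∷ cs) p with ∧-true p
... | e , p′ with ρstep-view c e
... | inj₁ (d , eq) rewrite eq | d = ageLe-ρ r cs p′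
... | inj₂ (d , eq) rewrite eq | d = cong (evenBelow r (rdepth (cutT c)) ∧_) (ageLe-ρ r cs p′)

isLeaf-iter : ∀ r cs → isCS (node cs) ≡ true → isLeaf (iter r (node cs)) ≡ ageLe r cs
isLeaf-iter zero [] p = refl
isLeaf-iter zero (c ∷ cs) p = refl
isLeaf-iter (suc r) cs p = trans (isLeaf-iter r (concatMap ρstep cs) (ρ-CS cs p)) (ageLe-ρ r cs p)

mutual
  rdepth<size : ∀ t → rdepth t < size t
  rdepth<size (node cs) = s≤s (rdepthL≤sizeL cs)

  rdepthL≤sizeL : ∀ cs → rdepthL cs ≤ sizeL cs
  rdepthL≤sizeL [] = z≤n
  rdepthL≤sizeL (t ∷ []) = ℕP.≤-trans (rdepth<size t) (ℕP.m≤m+n (size t) 0)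
  rdepthL≤sizeL (t ∷ u ∷ ts) = ℕP.≤-trans (rdepthL≤sizeL (u ∷ ts)) (ℕP.m≤n+m (sizeL (u ∷ ts)) (size t))

ageLe-size : ∀ s cs → isCS (node cs) ≡ true → sizeL cs ≤ s → ageLe s cs ≡ true
ageLe-size s [] p le = refl
ageLe-size s (c ∷ cs) p le with ∧-true p
... | e , p′ rewrite even∧<⇒evenBelow s (rdepth c) e
                       (ℕP.≤-trans (rdepth<size c) (ℕP.≤-trans (ℕP.m≤m+n (size c) (sizeL cs)) le)) =
  ageLe-size s cs p′ (ℕP.≤-trans (ℕP.m≤n+m (sizeL cs) (size c)) le)

alive : ℕ → Tree → ℕ
alive r t = ind (not (isLeaf (iter r t)))

iter-leaf : ∀ r → iter r leaf ≡ leaf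
iter-leaf zero = refl
iter-leaf (suc r) = iter-leaf r

alive-leaf : ∀ r → alive r leaf ≡ 0
alive-leaf r rewrite iter-leaf r = refl

allB-applyUpTo : ∀ (p : ℕ → Bool) s n → allB p (applyUpTo s n) ≡ allB (p ∘ s) (upTo n)
allB-applyUpTo p s n = go p s n id
  where
  go : ∀ (p : ℕ → Bool) s n (s′ : ℕ → ℕ) → allB p (applyUpTo (s ∘ s′) n) ≡ allB (p ∘ s) (applyUpTo s′ n)
  go p s zero s′ = refl
  go p s (suc n) s′ = cong (p (s (s′ 0)) ∧_) (go p s n (s′ ∘ suc))

hasAge-suc : ∀ r c cs → hasAge (suc r) (node (c ∷ cs)) ≡ hasAge r (ρ (node (c ∷ cs)))
hasAge-suc r c cs = cong (isLeaf (iter r (ρ (node (c ∷ cs)))) ∧_)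
  (allB-applyUpTo (λ s → not (isLeaf (iter s (node (c ∷ cs))))) suc r)

-- The one-node tree is fixed by `ρ`, so aliveness switches off only once, at the age. This is what
-- makes probabilities differences of tails.
alive-hasAge : ∀ r t → alive r t ≡ alive (suc r) t ℕ.+ ind (hasAge (suc r) t)
alive-hasAge r (node []) rewrite iter-leaf r = refl
alive-hasAge zero (node (c ∷ cs)) with isLeaf (ρ (node (c ∷ cs)))
... | true = refl
... | false = refl
alive-hasAge (suc r) (node (c ∷ cs)) = trans (alive-hasAge r (ρ (node (c ∷ cs))))
  (cong (λ b → alive (suc (suc r)) (node (c ∷ cs)) ℕ.+ ind b) (sym (hasAge-suc (suc r) c cs)))

Σ<-zero : ∀ n h → (∀ j → h j ≡ 0) → Σ< n h ≡ 0
Σ<-zero zero h p = refl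
Σ<-zero (suc n) h p = trans (cong (ℕ._+ Σ< n (h ∘ suc)) (p 0)) (Σ<-zero n (h ∘ suc) (p ∘ suc))

ageF-alive : ∀ f K t → isLeaf (iter f t) ≡ true → f ≤ K → ageF f t ≡ Σ< K (λ r → alive r t)
ageF-alive f K (node []) p le = trans (lemma f) (sym (Σ<-zero K _ alive-leaf))
  where
  lemma : ∀ f → ageF f (node []) ≡ 0
  lemma zero = refl
  lemma (suc f) = refl
ageF-alive (suc f) (suc K) t@(node (_ ∷ _)) p (s≤s le) = cong suc (ageF-alive f K (ρ t) p le)

-- A square is the sum of the first odd numbers, here `2r + 1` over the `r` below the age; after an
-- index shift these are the weights `2r - 1` of the second moment.
ageF²-alive : ∀ f K t → isLeaf (iter f t) ≡ true → f ≤ K →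
  ageF f t ℕ.* ageF f t ≡ Σ< K (λ r → suc (2 ℕ.* r) ℕ.* alive r t)
ageF²-alive f K (node []) p le = trans (lemma f)
  (sym (Σ<-zero K _ (λ r → trans (cong (suc (2 ℕ.* r) ℕ.*_) (alive-leaf r)) (ℕP.*-zeroʳ (suc (2 ℕ.* r))))))
  where
  lemma : ∀ f → ageF f (node []) ℕ.* ageF f (node []) ≡ 0
  lemma zero = refl
  lemma (suc f) = refl
ageF²-alive (suc f) (suc K) t@(node (_ ∷ _)) p (s≤s le) = begin
  suc a ℕ.* suc a                                                            ≡⟨ square a ⟩
  1 ℕ.+ (a ℕ.* a ℕ.+ (a ℕ.+ a))                                              ≡⟨ cong suc (cong₂ ℕ._+_ (ageF²-alive f K (ρ t) p le)
                                                                                (cong₂ ℕ._+_ sumAlive sumAlive)) ⟩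
  1 ℕ.+ (Σ< K (λ r → suc (2 ℕ.* r) ℕ.* b r) ℕ.+ (Σ< K b ℕ.+ Σ< K b))         ≡⟨ cong (λ x → 1 ℕ.+ (Σ< K (λ r → suc (2 ℕ.* r) ℕ.* b r) ℕ.+ x)) (Σ<-+ K b b) ⟨
  1 ℕ.+ (Σ< K (λ r → suc (2 ℕ.* r) ℕ.* b r) ℕ.+ Σ< K (λ r → b r ℕ.+ b r))   ≡⟨ cong suc (Σ<-+ K (λ r → suc (2 ℕ.* r) ℕ.* b r) (λ r → b r ℕ.+ b r)) ⟨
  1 ℕ.+ Σ< K (λ r → suc (2 ℕ.* r) ℕ.* b r ℕ.+ (b r ℕ.+ b r))                 ≡⟨ cong suc (Σ<-cong K (λ r _ → shift r (b r))) ⟩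
  1 ℕ.+ Σ< K (λ r → suc (2 ℕ.* suc r) ℕ.* b r)                               ∎
  where
  open ≡-Reasoning
  a : ℕ
  a = ageF f (ρ t)
  b : ℕ → ℕ
  b r = alive r (ρ t)
  sumAlive : a ≡ Σ< K b
  sumAlive = ageF-alive f K (ρ t) p le
  square : ∀ a → suc a ℕ.* suc a ≡ 1 ℕ.+ (a ℕ.* a ℕ.+ (a ℕ.+ a))
  square = ℕSolver.solve-∀
  shift : ∀ r b → suc (2 ℕ.* r) ℕ.* b ℕ.+ (b ℕ.+ b) ≡ suc (2 ℕ.* suc r) ℕ.* b
  shift = ℕSolver.solve-∀

-- Counting by age

∑-filter : {A : Set} (p : A → Bool) (xs : List A) (w : A → ℕ) → ∑ (filterᵇ p xs) w ≡ ∑ xs (λ x → ind (p x) ℕ.* w x)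
∑-filter p [] w = refl
∑-filter p (x ∷ xs) w with p x
... | true = cong₂ ℕ._+_ (sym (ℕP.+-identityʳ (w x))) (∑-filter p xs w)
... | false = ∑-filter p xs w

length-filter : {A : Set} (p : A → Bool) (xs : List A) → length (filterᵇ p xs) ≡ ∑ xs (ind ∘ p)
length-filter p [] = refl
length-filter p (x ∷ xs) with p x
... | true = cong suc (length-filter p xs)
... | false = length-filter p xs

-- A bound on the sum of all `s x` bounds each of them, so that one truncation point serves all
-- trees of a size.
∑-filter-cong : {A : Set} (p : A → Bool) (xs : List A) (s v w : A → ℕ) (K : ℕ) →
  (∀ x → p x ≡ true → s x ≤ K → v x ≡ w x) → ∑ (filterᵇ p xs) s ≤ K →
  ∑ (filterᵇ p xs) v ≡ ∑ (filterᵇ p xs) w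
∑-filter-cong p [] s v w K eq le = refl
∑-filter-cong p (x ∷ xs) s v w K eq le with p x in px
... | true = cong₂ ℕ._+_ (eq x px (ℕP.≤-trans (ℕP.m≤m+n (s x) _) le))
                         (∑-filter-cong p xs s v w K eq (ℕP.≤-trans (ℕP.m≤n+m _ (s x)) le))
... | false = ∑-filter-cong p xs s v w K eq le

∑-Σ< : {A : Set} (xs : List A) (K : ℕ) (h : ℕ → A → ℕ) → ∑ xs (λ x → Σ< K (λ r → h r x)) ≡ Σ< K (λ r → ∑ xs (h r))
∑-Σ< [] K h = sym (Σ<-zero K _ (λ _ → refl))
∑-Σ< (x ∷ xs) K h = trans (cong (Σ< K (λ r → h r x) ℕ.+_) (∑-Σ< xs K h))
  (sym (Σ<-+ K (λ r → h r x) (λ r → ∑ xs (h r))))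

csInd : List Tree → ℕ
csInd cs = ind (isCS (node cs))

early late : ℕ → List Tree → ℕ
early r cs = ind (ageLe r cs)
late r cs = ind (isCS (node cs)) ℕ.* ind (not (ageLe r cs))

ageLe⇒isCS : ∀ r cs → ageLe r cs ≡ true → isCS (node cs) ≡ true
ageLe⇒isCS r [] p = refl
ageLe⇒isCS r (c ∷ cs) p with ∧-true p
... | e , p′ rewrite evenBelow⇒even r (rdepth c) e = ageLe⇒isCS r cs p′

late+early : ∀ r cs → late r cs ℕ.+ early r cs ≡ csInd cs
late+early r cs with ageLe r cs in eq
... | false = trans (ℕP.+-identityʳ _) (ℕP.*-identityʳ _)
... | true rewrite ageLe⇒isCS r cs eq = refl

-- The number of Catalan–Stanley trees of size m + 1 whose age exceeds r.
older : ℕ → Series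
older r = gf (late r)

∑-csTrees : ∀ m w → ∑ (csTrees (suc m)) w ≡ gf (λ cs → ind (isCS (node cs)) ℕ.* w (node cs)) m
∑-csTrees m w = trans (∑-filter isCS (map node (forests m)) w) (∑-map node (forests m) _)

∑-alive : ∀ r m → ∑ (csTrees (suc m)) (alive r) ≡ older r m
∑-alive r m = trans (∑-csTrees m (alive r)) (gf-cong eq m)
  where
  eq : ∀ cs → ind (isCS (node cs)) ℕ.* alive r (node cs) ≡ late r cs
  eq cs with isCS (node cs) in p
  ... | false = refl
  ... | true = cong (λ b → ind (not b) ℕ.+ 0) (isLeaf-iter r cs p)

numCS-gf : ∀ m → numCS (suc m) ≡ gf csInd m
numCS-gf m = trans (length-filter isCS (map node (forests m))) (∑-map node (forests m) (ind ∘ isCS))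

older-hasAge : ∀ r m → older r m ≡ older (suc r) m ℕ.+ length (filterᵇ (λ t → hasAge (suc r) t) (csTrees (suc m)))
older-hasAge r m = begin
  older r m ≡⟨ ∑-alive r m ⟨
  ∑ ts (alive r) ≡⟨ ∑-cong ts (alive-hasAge r) ⟩
  ∑ ts (λ t → alive (suc r) t ℕ.+ ind (hasAge (suc r) t)) ≡⟨ ∑-+ ts (alive (suc r)) (ind ∘ hasAge (suc r)) ⟩
  ∑ ts (alive (suc r)) ℕ.+ ∑ ts (ind ∘ hasAge (suc r)) ≡⟨ cong₂ ℕ._+_ (∑-alive (suc r) m) (sym (length-filter (hasAge (suc r)) ts)) ⟩
  older (suc r) m ℕ.+ length (filterᵇ (λ t → hasAge (suc r) t) ts) ∎
  where
  open ≡-Reasoning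
  ts : List Tree
  ts = csTrees (suc m)

iter-size : ∀ t → isCS t ≡ true → isLeaf (iter (size t) t) ≡ true
iter-size (node cs) p = trans (isLeaf-iter (suc (sizeL cs)) cs p) (ageLe-size _ cs p (ℕP.n≤1+n _))

-- An age is at most the size of its tree; the sum of all sizes is a crude common bound.
maxAge : ℕ → ℕ
maxAge m = ∑ (csTrees (suc m)) size

∑-age : ∀ m K → maxAge m ≤ K → ∑ (csTrees (suc m)) age ≡ Σ< K (λ r → older r m)
∑-age m K le = begin
  ∑ (csTrees (suc m)) age
    ≡⟨ ∑-filter-cong isCS (treesOfSize (suc m)) size age _ K (λ t p le → ageF-alive (size t) K t (iter-size t p) le) le ⟩
  ∑ (csTrees (suc m)) (λ t → Σ< K (λ r → alive r t)) ≡⟨ ∑-Σ< (csTrees (suc m)) K alive ⟩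
  Σ< K (λ r → ∑ (csTrees (suc m)) (alive r)) ≡⟨ Σ<-cong K (λ r _ → ∑-alive r m) ⟩
  Σ< K (λ r → older r m) ∎
  where open ≡-Reasoning

∑-age² : ∀ m K → maxAge m ≤ K →
  ∑ (csTrees (suc m)) (λ t → age t ℕ.* age t) ≡ Σ< K (λ r → suc (2 ℕ.* r) ℕ.* older r m)
∑-age² m K le = begin
  ∑ (csTrees (suc m)) (λ t → age t ℕ.* age t)
    ≡⟨ ∑-filter-cong isCS (treesOfSize (suc m)) size (λ t → age t ℕ.* age t) _ K
         (λ t p le → ageF²-alive (size t) K t (iter-size t p) le) le ⟩
  ∑ (csTrees (suc m)) (λ t → Σ< K (λ r → suc (2 ℕ.* r) ℕ.* alive r t))
    ≡⟨ ∑-Σ< (csTrees (suc m)) K (λ r t → suc (2 ℕ.* r) ℕ.* alive r t) ⟩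
  Σ< K (λ r → ∑ (csTrees (suc m)) (λ t → suc (2 ℕ.* r) ℕ.* alive r t))
    ≡⟨ Σ<-cong K (λ r _ → trans (∑-*ˡ (csTrees (suc m)) (suc (2 ℕ.* r)) (alive r)) (cong (suc (2 ℕ.* r) ℕ.*_) (∑-alive r m))) ⟩
  Σ< K (λ r → suc (2 ℕ.* r) ℕ.* older r m) ∎
  where open ≡-Reasoning

-- The generating functions

rightmost : ℕ → List Tree → ℕ
rightmost d cs = ind (rdepthL cs ≡ᵇ d)

gf-rightmost : ∀ d → gf (rightmost d) ≈ T ^^ d
gf-rightmost zero = ≈-trans (gf-cong eq) gf-δ
  where
  eq : ∀ cs → rightmost 0 cs ≡ δ cs
  eq [] = refl
  eq (t ∷ []) = refl
  eq (t ∷ u ∷ ts) = eq (u ∷ ts)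
gf-rightmost (suc d) = ≈-trans (gf-last (rightmost (suc d)) (rightmost d) refl eq) (⊛-cong {T} ≈-refl (gf-rightmost d))
  where
  eq : ∀ a b → rightmost (suc d) (node a ∷ b) ≡ rightmost d a ℕ.* δ b ℕ.+ rightmost (suc d) b
  eq a [] = sym (trans (ℕP.+-identityʳ _) (ℕP.*-identityʳ _))
  eq a (u ∷ ts) = sym (cong (ℕ._+ rightmost (suc d) (u ∷ ts)) (ℕP.*-zeroʳ (rightmost d a)))

-- `evenRight⁺` gives the empty forest weight zero, as `gf-last` requires.
evenRight evenRight⁺ oddRight : List Tree → ℕ
evenRight cs = ind (even (rdepthL cs))
evenRight⁺ [] = 0
evenRight⁺ (c ∷ cs) = evenRight (c ∷ cs)
oddRight cs = ind (even (suc (rdepthL cs)))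

gf-evenRight⁺ : gf evenRight⁺ ≈ T ⊛ gf oddRight
gf-evenRight⁺ = gf-last evenRight⁺ oddRight refl eq
  where
  eq : ∀ a b → evenRight⁺ (node a ∷ b) ≡ oddRight a ℕ.* δ b ℕ.+ evenRight⁺ b
  eq a [] = sym (trans (ℕP.+-identityʳ _) (ℕP.*-identityʳ _))
  eq a (u ∷ ts) = sym (cong (ℕ._+ evenRight (u ∷ ts)) (ℕP.*-zeroʳ (oddRight a)))

gf-oddRight : gf oddRight ≈ T ⊛ gf evenRight
gf-oddRight = gf-last oddRight evenRight refl eq
  where
  eq : ∀ a b → oddRight (node a ∷ b) ≡ evenRight a ℕ.* δ b ℕ.+ oddRight b
  eq a [] = sym (trans (ℕP.+-identityʳ _) (ℕP.*-identityʳ _))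
  eq a (u ∷ ts) = sym (cong (ℕ._+ oddRight (u ∷ ts)) (ℕP.*-zeroʳ (evenRight a)))

gf-evenRight : gf evenRight ≈ 𝟙 ⊕ T ⊛ (T ⊛ gf evenRight)
gf-evenRight = ≈-trans (gf-cong eq) (≈-trans (gf-+ δ evenRight⁺)
  (⊕-cong gf-δ (≈-trans gf-evenRight⁺ (⊛-cong {T} ≈-refl gf-oddRight))))
  where
  eq : ∀ cs → evenRight cs ≡ δ cs ℕ.+ evenRight⁺ cs
  eq [] = refl
  eq (c ∷ cs) = refl

-- Both sides solve `f = z (1 + T) + T² f`; for `T` this is `T = z + T²` with one factor `T` of the
-- square expanded again.
T-even : z ⊛ gf evenRight ⊛ (𝟙 ⊕ T) ≈ T
T-even = fixpoint-unique (T ⊛ T) (z ⊛ (𝟙 ⊕ T)) _ T refl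
  (≈-trans (⊛-cong (⊛-cong {z} ≈-refl gf-evenRight) (≈-refl {𝟙 ⊕ T}))
    (Sv.solve 3 (λ z E T → (z :* (con 1 :+ T :* (T :* E))) :* (con 1 :+ T)
                  := z :* (con 1 :+ T) :+ T :* T :* (z :* E :* (con 1 :+ T))) (λ n → refl) z (gf evenRight) T))
  T-cube
  where
  T-cube : T ≈ z ⊛ (𝟙 ⊕ T) ⊕ T ⊛ T ⊛ T
  T-cube = ≈-trans T-eq (≈-trans (⊕-cong (≈-refl {z}) (⊛-cong T-eq (≈-refl {T})))
    (Sv.solve 2 (λ z T → z :+ (z :+ T :* T) :* T := z :* (con 1 :+ T) :+ T :* T :* T) (λ n → refl) z T))

-- By `T-even`, `1 + T` satisfies the equation for sequences of branches of even right depth.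
gf-csInd : gf csInd ≈ 𝟙 ⊕ T
gf-csInd = fixpoint-unique (z ⊛ gf evenRight) 𝟙 _ (𝟙 ⊕ T) refl
  (≈-trans (gf-allChildren csInd evenRight refl (λ a b → ind-∧ (even (rdepthL a)) _))
    (⊕-cong (≈-refl {𝟙}) (≈-sym (⊛-assoc z (gf evenRight) (gf csInd)))))
  (⊕-cong (≈-refl {𝟙}) (≈-sym T-even))

earlyChild : ℕ → List Tree → ℕ
earlyChild r cs = ind (evenBelow r (rdepthL cs))

-- Branches of depth 0, 2, ..., 2r - 2 form a geometric sum in `T²`; times `z (1 + T) = T - T³` it
-- telescopes to `T` minus a power of `T`. That power stands on the left to avoid the subtraction.
T-earlyChild : ∀ r → z ⊛ (𝟙 ⊕ T) ⊛ gf (earlyChild r) ⊕ T ^^ suc (double r) ≈ T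
T-earlyChild zero = ≈-trans (⊕-cong (⊛-cong {z ⊛ (𝟙 ⊕ T)} ≈-refl (λ k → ∑-zero (forests k))) ≈-refl)
  (Sv.solve 2 (λ z T → z :* (con 1 :+ T) :* con 0 :+ T :* con 1 := T) (λ n → refl) z T)
T-earlyChild (suc r) = begin
  z ⊛ (𝟙 ⊕ T) ⊛ gf (earlyChild (suc r)) ⊕ T ⊛ (T ⊛ (T ⊛ P))
    ≈⟨ ⊕-cong (⊛-cong {z ⊛ (𝟙 ⊕ T)} ≈-refl (≈-trans (gf-cong (λ cs → evenBelow-suc r (rdepthL cs)))
         (≈-trans (gf-+ (earlyChild r) (rightmost (double r))) (⊕-cong ≈-refl (gf-rightmost (double r)))))) ≈-refl ⟩
  z ⊛ (𝟙 ⊕ T) ⊛ (gf (earlyChild r) ⊕ P) ⊕ T ⊛ (T ⊛ (T ⊛ P))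
    ≈⟨ Sv.solve 4 (λ z T E P → z :* (con 1 :+ T) :* (E :+ P) :+ T :* (T :* (T :* P))
         := z :* (con 1 :+ T) :* E :+ (z :+ (z :+ T :* T) :* T) :* P) (λ n → refl) z T (gf (earlyChild r)) P ⟩
  z ⊛ (𝟙 ⊕ T) ⊛ gf (earlyChild r) ⊕ (z ⊕ (z ⊕ T ⊛ T) ⊛ T) ⊛ P
    ≈⟨ ⊕-cong ≈-refl (⊛-cong {g = P} (≈-sym (≈-trans T-eq (⊕-cong (≈-refl {z}) (⊛-cong T-eq (≈-refl {T}))))) ≈-refl) ⟩
  z ⊛ (𝟙 ⊕ T) ⊛ gf (earlyChild r) ⊕ T ⊛ P
    ≈⟨ T-earlyChild r ⟩
  T ∎
  where
  open ≈R
  P : Series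
  P = T ^^ double r

-- The equation `A = 1 + z E A` times `1 + T`, with `D A` added, reads
-- `(1 + T) A + D A = (1 + T) + T A`, where `T A` cancels.
gf-early : ∀ r → (𝟙 ⊕ T ^^ suc (double r)) ⊛ gf (early r) ≈ 𝟙 ⊕ T
gf-early r n = ℕP.+-cancelʳ-≡ ((T ⊛ A) n) _ _ (eq n)
  where
  open ≈R
  A E D : Series
  A = gf (early r)
  E = gf (earlyChild r)
  D = T ^^ suc (double r)
  eq : (𝟙 ⊕ D) ⊛ A ⊕ T ⊛ A ≈ 𝟙 ⊕ T ⊕ T ⊛ A
  eq = begin
    (𝟙 ⊕ D) ⊛ A ⊕ T ⊛ A
      ≈⟨ Sv.solve 3 (λ D T A → (con 1 :+ D) :* A :+ T :* A := (con 1 :+ T) :* A :+ D :* A) (λ n → refl) D T A ⟩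
    (𝟙 ⊕ T) ⊛ A ⊕ D ⊛ A
      ≈⟨ ⊕-cong (⊛-cong {𝟙 ⊕ T} ≈-refl (gf-allChildren (early r) (earlyChild r) refl (λ a b → ind-∧ (evenBelow r (rdepthL a)) _))) ≈-refl ⟩
    (𝟙 ⊕ T) ⊛ (𝟙 ⊕ z ⊛ (E ⊛ A)) ⊕ D ⊛ A
      ≈⟨ Sv.solve 5 (λ z E D T A → (con 1 :+ T) :* (con 1 :+ z :* (E :* A)) :+ D :* A
           := con 1 :+ T :+ (z :* (con 1 :+ T) :* E :+ D) :* A) (λ n → refl) z E D T A ⟩
    𝟙 ⊕ T ⊕ (z ⊛ (𝟙 ⊕ T) ⊛ E ⊕ D) ⊛ A
      ≈⟨ ⊕-cong (≈-refl {𝟙 ⊕ T}) (⊛-cong {g = A} (T-earlyChild r) ≈-refl) ⟩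
    𝟙 ⊕ T ⊕ T ⊛ A ∎

-- Age above `r` means age at least `r + 1`, hence the exponent `2 (r + 1) - 1`. The equation is
-- `1 + D` times the difference between all trees and the early ones, written without subtraction.
older-eq : ∀ r → older r ⊕ T ^^ suc (double r) ⊛ older r ≈ T ^^ suc (double r) ⊕ T ^^ suc (suc (double r))
older-eq r n = ℕP.+-cancelʳ-≡ ((𝟙 ⊕ T) n) _ _ (eq n)
  where
  open ≈R
  A D : Series
  A = gf (early r)
  D = T ^^ suc (double r)
  total : older r ⊕ A ≈ 𝟙 ⊕ T
  total = ≈-trans (≈-sym (gf-+ (late r) (early r))) (≈-trans (gf-cong (late+early r)) gf-csInd)
  eq : older r ⊕ D ⊛ older r ⊕ (𝟙 ⊕ T) ≈ D ⊕ T ⊛ D ⊕ (𝟙 ⊕ T)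
  eq = begin
    older r ⊕ D ⊛ older r ⊕ (𝟙 ⊕ T) ≈⟨ ⊕-cong (≈-refl {older r ⊕ D ⊛ older r}) (≈-sym (gf-early r)) ⟩
    older r ⊕ D ⊛ older r ⊕ (𝟙 ⊕ D) ⊛ A
      ≈⟨ Sv.solve 3 (λ G D A → G :+ D :* G :+ (con 1 :+ D) :* A := (con 1 :+ D) :* (G :+ A)) (λ n → refl) (older r) D A ⟩
    (𝟙 ⊕ D) ⊛ (older r ⊕ A) ≈⟨ ⊛-cong {𝟙 ⊕ D} ≈-refl total ⟩
    (𝟙 ⊕ D) ⊛ (𝟙 ⊕ T)
      ≈⟨ Sv.solve 2 (λ D T → (con 1 :+ D) :* (con 1 :+ T) := D :+ T :* D :+ (con 1 :+ T)) (λ n → refl) D T ⟩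
    D ⊕ T ⊛ D ⊕ (𝟙 ⊕ T) ∎

-- The remainders left when the equation of `older r` is iterated `j` times; up to sign they are
-- tails of the alternating sum.
Ψ : ℕ → ℕ → ℕ → ℕ
Ψ r m j = (T ^^ (j ℕ.* suc (double r)) ⊛ older r) m

Ψ-zero : ∀ r m → Ψ r m 0 ≡ older r m
Ψ-zero r m = ⊛-identityˡ (older r) m

Ψ-step : ∀ r m j → let s = suc j ℕ.* suc (double r) in
  Ψ r m j ℕ.+ Ψ r m (suc j) ≡ (T ^^ s) m ℕ.+ (T ^^ suc s) m
Ψ-step r m j = eq m
  where
  open ≈R
  d s : ℕ
  d = suc (double r)
  s = j ℕ.* d
  G P D : Series
  G = older r
  P = T ^^ s
  D = T ^^ d
  eq : P ⊛ G ⊕ T ^^ (d ℕ.+ s) ⊛ G ≈ T ^^ (d ℕ.+ s) ⊕ T ⊛ T ^^ (d ℕ.+ s)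
  eq = begin
    P ⊛ G ⊕ T ^^ (d ℕ.+ s) ⊛ G ≈⟨ ⊕-cong ≈-refl (⊛-cong {g = G} (^^-+ T d s) ≈-refl) ⟩
    P ⊛ G ⊕ D ⊛ P ⊛ G ≈⟨ Sv.solve 3 (λ P G D → P :* G :+ D :* P :* G := P :* (G :+ D :* G)) (λ n → refl) P G D ⟩
    P ⊛ (G ⊕ D ⊛ G) ≈⟨ ⊛-cong {P} ≈-refl (older-eq r) ⟩
    P ⊛ (D ⊕ T ⊛ D) ≈⟨ Sv.solve 3 (λ P D T → P :* (D :+ T :* D) := D :* P :+ T :* (D :* P)) (λ n → refl) P D T ⟩
    D ⊛ P ⊕ T ⊛ (D ⊛ P) ≈⟨ ⊕-cong (≈-sym (^^-+ T d s)) (⊛-cong {T} ≈-refl (≈-sym (^^-+ T d s))) ⟩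
    T ^^ (d ℕ.+ s) ⊕ T ⊛ T ^^ (d ℕ.+ s) ∎

Ψ-vanish : ∀ r m j → m < j → Ψ r m j ≡ 0
Ψ-vanish r m j lt = ^^-low T refl (j ℕ.* suc (double r)) (older r) m
  (ℕP.≤-trans lt (ℕP.m≤m*n j (suc (double r))))

-- Ballot numbers

ballot : ℕ → ℕ → ℕ
ballot m k = (T ^^ k) m

ballot-vanish : ∀ m k → m < k → ballot m k ≡ 0
ballot-vanish m k lt = trans (sym (CommutativeSemiring.*-identityʳ series (T ^^ k) m)) (^^-low T refl k 𝟙 m lt)

ballot-rec : ∀ m k → ballot (suc m) (suc k) ≡ ballot m k ℕ.+ ballot (suc m) (2 ℕ.+ k)
ballot-rec m k = trans (eq (suc m)) (cong (ℕ._+ ballot (suc m) (2 ℕ.+ k)) (z⊛-suc (T ^^ k) m))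
  where
  eq : T ^^ suc k ≈ z ⊛ T ^^ k ⊕ T ^^ (2 ℕ.+ k)
  eq = ≈-trans (⊛-cong {g = T ^^ k} T-eq ≈-refl)
    (Sv.solve 3 (λ z T P → (z :+ T :* T) :* P := z :* P :+ T :* (T :* P)) (λ n → refl) z T (T ^^ k))

-- Of `1 + T` only `T` contributes in positive degree.
numCS-ballot : ∀ m → numCS (2 ℕ.+ m) ≡ ballot (suc m) 1
numCS-ballot m = trans (numCS-gf (suc m)) (trans (gf-csInd (suc m)) (sym (CommutativeSemiring.*-identityʳ series T (suc m))))

ballotℤ : ℕ → ℕ → ℤ
ballotℤ m k = + ballot m k

ballotℤ-rec : ∀ m k → ballotℤ (suc m) (2 ℕ.+ k) ≡ ballotℤ (suc m) (suc k) ℤ.- ballotℤ m k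
ballotℤ-rec m k = trans (lemma (ballotℤ m k) (ballotℤ (suc m) (2 ℕ.+ k)))
  (cong (ℤ._- ballotℤ m k) (sym (cong +_ (ballot-rec m k))))
  where
  lemma : ∀ a b → b ≡ a ℤ.+ b ℤ.- a
  lemma = ℤSolver.solve-∀

-- Quotients of neighbouring coefficients `[zᵐ] Tᵏ = k/(2m - k) binom(2m - k, m)` with denominators
-- cleared. No bound on `k` is imposed, so the factors live in ℤ, where they may be negative.
diagonal-ratio row-ratio : ℕ → ℕ → Set
diagonal-ratio m k =
  (+ 1 ℤ.+ + k) ℤ.* (+ 2 ℤ.* + m ℤ.- + k) ℤ.* ballotℤ m k ≡ + k ℤ.* (+ 1 ℤ.+ + m) ℤ.* ballotℤ (suc m) (suc k)
row-ratio m k =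
  (+ 1 ℤ.+ + k) ℤ.* (+ 2 ℤ.* + m ℤ.- + k) ℤ.* ballotℤ (suc m) (2 ℕ.+ k) ≡
  (+ 2 ℤ.+ + k) ℤ.* (+ m ℤ.- + k) ℤ.* ballotℤ (suc m) (suc k)

diagonal⇒row : ∀ m k → diagonal-ratio m k → row-ratio m k
diagonal⇒row m k eq = begin
  (+ 1 ℤ.+ K) ℤ.* (+ 2 ℤ.* M ℤ.- K) ℤ.* ballotℤ (suc m) (2 ℕ.+ k)
    ≡⟨ cong ((+ 1 ℤ.+ K) ℤ.* (+ 2 ℤ.* M ℤ.- K) ℤ.*_) (ballotℤ-rec m k) ⟩
  (+ 1 ℤ.+ K) ℤ.* (+ 2 ℤ.* M ℤ.- K) ℤ.* (b ℤ.- c)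
    ≡⟨ distrib ((+ 1 ℤ.+ K) ℤ.* (+ 2 ℤ.* M ℤ.- K)) b c ⟩
  (+ 1 ℤ.+ K) ℤ.* (+ 2 ℤ.* M ℤ.- K) ℤ.* b ℤ.- (+ 1 ℤ.+ K) ℤ.* (+ 2 ℤ.* M ℤ.- K) ℤ.* c
    ≡⟨ cong (λ x → (+ 1 ℤ.+ K) ℤ.* (+ 2 ℤ.* M ℤ.- K) ℤ.* b ℤ.- x) eq ⟩
  (+ 1 ℤ.+ K) ℤ.* (+ 2 ℤ.* M ℤ.- K) ℤ.* b ℤ.- K ℤ.* (+ 1 ℤ.+ M) ℤ.* b
    ≡⟨ collect K M b ⟩
  (+ 2 ℤ.+ K) ℤ.* (M ℤ.- K) ℤ.* b ∎
  where
  open ≡-Reasoning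
  K M b c : ℤ
  K = + k
  M = + m
  b = ballotℤ (suc m) (suc k)
  c = ballotℤ m k
  distrib : ∀ x b c → x ℤ.* (b ℤ.- c) ≡ x ℤ.* b ℤ.- x ℤ.* c
  distrib = ℤSolver.solve-∀
  collect : ∀ K M b → (+ 1 ℤ.+ K) ℤ.* (+ 2 ℤ.* M ℤ.- K) ℤ.* b ℤ.- K ℤ.* (+ 1 ℤ.+ M) ℤ.* b
    ≡ (+ 2 ℤ.+ K) ℤ.* (M ℤ.- K) ℤ.* b
  collect = ℤSolver.solve-∀

-- The row ratio trades `c` for its right neighbour `a`, the diagonal ratio at `a` leads to the next
-- row, and the recurrence returns to `b`.
diagonal-step : ∀ m k → diagonal-ratio (suc m) (2 ℕ.+ k) → row-ratio m k → diagonal-ratio (suc m) (suc k)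
diagonal-step m k below row = ℤP.*-cancelˡ-≡ (+ 1 ℤ.+ K) _ _ (begin
  (+ 1 ℤ.+ K) ℤ.* ((+ 1 ℤ.+ K) ℤ.* (+ 2 ℤ.* M ℤ.- K) ℤ.* c)
    ≡⟨ split K M c ⟩
  (+ 2 ℤ.+ K) ℤ.* ((+ 1 ℤ.+ K) ℤ.* (M ℤ.- K) ℤ.* c) ℤ.+ (+ 1 ℤ.+ K) ℤ.* (K ℤ.* (+ 1 ℤ.+ M)) ℤ.* c
    ≡⟨ cong (λ x → (+ 2 ℤ.+ K) ℤ.* x ℤ.+ (+ 1 ℤ.+ K) ℤ.* (K ℤ.* (+ 1 ℤ.+ M)) ℤ.* c) (trans (sym (rearrange₂ k m c)) (trans (sym row) (rearrange₁ k m a))) ⟩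
  (+ 2 ℤ.+ K) ℤ.* (K ℤ.* (+ 2 ℤ.* M ℤ.- (+ 1 ℤ.+ K)) ℤ.* a) ℤ.+ (+ 1 ℤ.+ K) ℤ.* (K ℤ.* (+ 1 ℤ.+ M)) ℤ.* c
    ≡⟨ regroup K M a c ⟩
  K ℤ.* ((+ 1 ℤ.+ (+ 1 ℤ.+ K)) ℤ.* (+ 2 ℤ.* M ℤ.- (+ 1 ℤ.+ K)) ℤ.* a) ℤ.+ (+ 1 ℤ.+ K) ℤ.* (K ℤ.* (+ 1 ℤ.+ M)) ℤ.* c
    ≡⟨ cong (λ x → K ℤ.* x ℤ.+ (+ 1 ℤ.+ K) ℤ.* (K ℤ.* (+ 1 ℤ.+ M)) ℤ.* c) (trans below (cong ((+ 1 ℤ.+ K) ℤ.* (+ 1 ℤ.+ M) ℤ.*_) (ballotℤ-rec (suc m) (suc k)))) ⟩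
  K ℤ.* ((+ 1 ℤ.+ K) ℤ.* (+ 1 ℤ.+ M) ℤ.* (b ℤ.- c)) ℤ.+ (+ 1 ℤ.+ K) ℤ.* (K ℤ.* (+ 1 ℤ.+ M)) ℤ.* c
    ≡⟨ finish K M b c ⟩
  (+ 1 ℤ.+ K) ℤ.* (K ℤ.* (+ 1 ℤ.+ M) ℤ.* b) ∎)
  where
  open ≡-Reasoning
  K M a b c : ℤ
  K = + suc k
  M = + suc m
  a = ballotℤ (suc m) (2 ℕ.+ k)
  b = ballotℤ (2 ℕ.+ m) (2 ℕ.+ k)
  c = ballotℤ (suc m) (suc k)
  rearrange₁ : ∀ k m a → (+ 1 ℤ.+ + k) ℤ.* (+ 2 ℤ.* + m ℤ.- + k) ℤ.* a
    ≡ + suc k ℤ.* (+ 2 ℤ.* + suc m ℤ.- (+ 1 ℤ.+ + suc k)) ℤ.* a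
  rearrange₁ k m a = lemma (+ k) (+ m) a
    where
    lemma : ∀ K M a → (+ 1 ℤ.+ K) ℤ.* (+ 2 ℤ.* M ℤ.- K) ℤ.* a
      ≡ (+ 1 ℤ.+ K) ℤ.* (+ 2 ℤ.* (+ 1 ℤ.+ M) ℤ.- (+ 1 ℤ.+ (+ 1 ℤ.+ K))) ℤ.* a
    lemma = ℤSolver.solve-∀
  rearrange₂ : ∀ k m c → (+ 2 ℤ.+ + k) ℤ.* (+ m ℤ.- + k) ℤ.* c ≡ (+ 1 ℤ.+ + suc k) ℤ.* (+ suc m ℤ.- + suc k) ℤ.* c
  rearrange₂ k m c = lemma (+ k) (+ m) c
    where
    lemma : ∀ K M a → (+ 2 ℤ.+ K) ℤ.* (M ℤ.- K) ℤ.* a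
      ≡ (+ 1 ℤ.+ (+ 1 ℤ.+ K)) ℤ.* ((+ 1 ℤ.+ M) ℤ.- (+ 1 ℤ.+ K)) ℤ.* a
    lemma = ℤSolver.solve-∀
  split : ∀ K M c → (+ 1 ℤ.+ K) ℤ.* ((+ 1 ℤ.+ K) ℤ.* (+ 2 ℤ.* M ℤ.- K) ℤ.* c)
    ≡ (+ 2 ℤ.+ K) ℤ.* ((+ 1 ℤ.+ K) ℤ.* (M ℤ.- K) ℤ.* c) ℤ.+ (+ 1 ℤ.+ K) ℤ.* (K ℤ.* (+ 1 ℤ.+ M)) ℤ.* c
  split = ℤSolver.solve-∀
  regroup : ∀ K M a c →
    (+ 2 ℤ.+ K) ℤ.* (K ℤ.* (+ 2 ℤ.* M ℤ.- (+ 1 ℤ.+ K)) ℤ.* a) ℤ.+ (+ 1 ℤ.+ K) ℤ.* (K ℤ.* (+ 1 ℤ.+ M)) ℤ.* c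
    ≡ K ℤ.* ((+ 1 ℤ.+ (+ 1 ℤ.+ K)) ℤ.* (+ 2 ℤ.* M ℤ.- (+ 1 ℤ.+ K)) ℤ.* a) ℤ.+ (+ 1 ℤ.+ K) ℤ.* (K ℤ.* (+ 1 ℤ.+ M)) ℤ.* c
  regroup = ℤSolver.solve-∀
  finish : ∀ K M b c →
    K ℤ.* ((+ 1 ℤ.+ K) ℤ.* (+ 1 ℤ.+ M) ℤ.* (b ℤ.- c)) ℤ.+ (+ 1 ℤ.+ K) ℤ.* (K ℤ.* (+ 1 ℤ.+ M)) ℤ.* c
    ≡ (+ 1 ℤ.+ K) ℤ.* (K ℤ.* (+ 1 ℤ.+ M) ℤ.* b)
  finish = ℤSolver.solve-∀

-- Descends in k from k > m, where both sides vanish; fuel bounds m - k from above.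
diagonal : ∀ m fuel k → m < k ℕ.+ fuel → diagonal-ratio m k
diagonal m zero k lt rewrite ballot-vanish m k (subst (m <_) (ℕP.+-identityʳ k) lt)
                           | ballot-vanish (suc m) (suc k) (s≤s (subst (m <_) (ℕP.+-identityʳ k) lt)) =
  trans (ℤP.*-zeroʳ ((+ 1 ℤ.+ + k) ℤ.* (+ 2 ℤ.* + m ℤ.- + k))) (sym (ℤP.*-zeroʳ (+ k ℤ.* (+ 1 ℤ.+ + m))))
diagonal zero (suc fuel) zero lt = refl
diagonal zero (suc fuel) (suc k) lt =
  trans (ℤP.*-zeroʳ ((+ 1 ℤ.+ + suc k) ℤ.* (+ 0 ℤ.- + suc k)))
    (sym (trans (cong (λ x → + suc k ℤ.* + 1 ℤ.* + x) (ballot-vanish 1 (2 ℕ.+ k) (s≤s (s≤s z≤n))))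
                (ℤP.*-zeroʳ (+ suc k ℤ.* + 1))))
diagonal (suc m) (suc fuel) zero lt = ℤP.*-zeroʳ ((+ 1 ℤ.+ + 0) ℤ.* (+ 2 ℤ.* + suc m ℤ.- + 0))
diagonal (suc m) (suc fuel) (suc k) lt =
  diagonal-step m k
    (diagonal (suc m) fuel (2 ℕ.+ k) (subst (suc m <_) (ℕP.+-suc (suc k) fuel) lt))
    (diagonal⇒row m k (diagonal m (suc m) k (ℕP.m≤n+m (suc m) k)))

row : ∀ m k → row-ratio m k
row m k = diagonal⇒row m k (diagonal m (suc m) k (ℕP.m≤n+m (suc m) k))

F-positive : ∀ m → 0 < F m
F-positive zero = s≤s z≤n
F-positive (suc m) = subst (0 <_) (sym (gf-product (λ _ → 1) (λ _ → 1) (λ _ → 1) (λ _ _ → refl) m)) (first m (F-positive m))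
  where
  first : ∀ m → 0 < F m → 0 < (F ⊛ F) m
  first zero lt = s≤s z≤n
  first (suc m) lt = ℕP.≤-trans lt (ℕP.≤-trans (ℕP.≤-reflexive (sym (ℕP.+-identityʳ (F (suc m))))) (ℕP.m≤m+n (1 ℕ.* F (suc m)) _))

ballot-positive : ∀ m → 0 < ballot (suc m) 1
ballot-positive m = subst (0 <_) (sym (trans (CommutativeSemiring.*-identityʳ series T (suc m)) (z⊛-suc F m))) (F-positive m)

ℚ-ring : AlmostCommutativeRing 0ℓ 0ℓ
ℚ-ring = fromCommutativeRing ℚP.+-*-commutativeRing (λ x → dec⇒maybe (0ℚ ℚP.≟ x))

-- Embedding integers

private
  toℚᵘ-ℤtoℚ : ∀ a → ℚ.toℚᵘ (ℤtoℚ a) ℚᵘ.≃ ℚᵘ.mkℚᵘ a 0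
  toℚᵘ-ℤtoℚ a = ℚP.toℚᵘ-fromℚᵘ (ℚᵘ.mkℚᵘ a 0)

  -- Equalities are checked on unnormalised fractions, where no gcd blocks computation.
  via : ∀ {p q u v} → ℚ.toℚᵘ p ℚᵘ.≃ u → ℚ.toℚᵘ q ℚᵘ.≃ v → u ℚᵘ.≃ v → p ≡ q
  via {p} {q} {u} {v} a b c = ℚP.toℚᵘ-injective (ℚᵘP.≃-trans {ℚ.toℚᵘ p} {u} {ℚ.toℚᵘ q} a (ℚᵘP.≃-trans {u} {v} {ℚ.toℚᵘ q} c (ℚᵘP.≃-sym {ℚ.toℚᵘ q} {v} b)))

ℤtoℚ-+ : ∀ a b → ℤtoℚ (a ℤ.+ b) ≡ ℤtoℚ a + ℤtoℚ b
ℤtoℚ-+ a b = via (toℚᵘ-ℤtoℚ (a ℤ.+ b))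
  (ℚᵘP.≃-trans {ℚ.toℚᵘ (ℤtoℚ a + ℤtoℚ b)} (ℚP.toℚᵘ-homo-+ (ℤtoℚ a) (ℤtoℚ b)) (ℚᵘP.+-cong (toℚᵘ-ℤtoℚ a) (toℚᵘ-ℤtoℚ b)))
  (ℚᵘ.*≡* (cong (ℤ._* + 1) (cong₂ ℤ._+_ (sym (ℤP.*-identityʳ a)) (sym (ℤP.*-identityʳ b)))))

ℤtoℚ-* : ∀ a b → ℤtoℚ (a ℤ.* b) ≡ ℤtoℚ a * ℤtoℚ b
ℤtoℚ-* a b = via (toℚᵘ-ℤtoℚ (a ℤ.* b))
  (ℚᵘP.≃-trans {ℚ.toℚᵘ (ℤtoℚ a * ℤtoℚ b)} (ℚP.toℚᵘ-homo-* (ℤtoℚ a) (ℤtoℚ b)) (ℚᵘP.*-cong {ℚ.toℚᵘ (ℤtoℚ a)} {ℚᵘ.mkℚᵘ a 0} {ℚ.toℚᵘ (ℤtoℚ b)} {ℚᵘ.mkℚᵘ b 0} (toℚᵘ-ℤtoℚ a) (toℚᵘ-ℤtoℚ b)))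
  (ℚᵘ.*≡* refl)

ℤtoℚ-neg : ∀ a → ℤtoℚ (ℤ.- a) ≡ - ℤtoℚ a
ℤtoℚ-neg a = via (toℚᵘ-ℤtoℚ (ℤ.- a))
  (ℚᵘP.≃-trans {ℚ.toℚᵘ (- ℤtoℚ a)} (ℚP.toℚᵘ-homo‿- (ℤtoℚ a)) (ℚᵘP.-‿cong (toℚᵘ-ℤtoℚ a)))
  (ℚᵘ.*≡* refl)

ℤtoℚ-- : ∀ a b → ℤtoℚ (a ℤ.- b) ≡ ℤtoℚ a - ℤtoℚ b
ℤtoℚ-- a b = trans (ℤtoℚ-+ a (ℤ.- b)) (cong (_+_ (ℤtoℚ a)) (ℤtoℚ-neg b))

ℤtoℚ-mono : ∀ {a b} → a ℤ.≤ b → ℤtoℚ a ≤ℚ ℤtoℚ b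
ℤtoℚ-mono {a} {b} le = ℚP.toℚᵘ-cancel-≤ (ℚᵘP.≤-respˡ-≃ (ℚᵘP.≃-sym {ℚ.toℚᵘ (ℤtoℚ a)} {ℚᵘ.mkℚᵘ a 0} (toℚᵘ-ℤtoℚ a))
  (ℚᵘP.≤-respʳ-≃ (ℚᵘP.≃-sym {ℚ.toℚᵘ (ℤtoℚ b)} {ℚᵘ.mkℚᵘ b 0} (toℚᵘ-ℤtoℚ b)) (ℚᵘ.*≤* (ℤP.*-monoʳ-≤-nonNeg (+ 1) le))))

ℕtoℚ-+ : ∀ a b → ℕtoℚ (a ℕ.+ b) ≡ ℕtoℚ a + ℕtoℚ b
ℕtoℚ-+ a b = ℤtoℚ-+ (+ a) (+ b)

ℕtoℚ-* : ∀ a b → ℕtoℚ (a ℕ.* b) ≡ ℕtoℚ a * ℕtoℚ b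
ℕtoℚ-* a b = trans (cong ℤtoℚ (ℤP.pos-* a b)) (ℤtoℚ-* (+ a) (+ b))

ℕtoℚ-mono : ∀ {a b} → a ≤ b → ℕtoℚ a ≤ℚ ℕtoℚ b
ℕtoℚ-mono le = ℤtoℚ-mono (ℤ.+≤+ le)

0≤ℕtoℚ : ∀ a → 0ℚ ≤ℚ ℕtoℚ a
0≤ℕtoℚ a = ℕtoℚ-mono {0} {a} z≤n

ℕtoℚ-suc : ∀ a → ℕtoℚ (suc a) ≡ 1ℚ + ℕtoℚ a
ℕtoℚ-suc a = ℕtoℚ-+ 1 a

-- Order

0≤+ : ∀ {a b} → 0ℚ ≤ℚ a → 0ℚ ≤ℚ b → 0ℚ ≤ℚ a + b
0≤+ p q = ℚP.+-mono-≤ p q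

*-mono : ∀ {a b c d} → 0ℚ ≤ℚ a → a ≤ℚ b → 0ℚ ≤ℚ c → c ≤ℚ d → a * c ≤ℚ b * d
*-mono {a} {b} {c} {d} 0≤a a≤b 0≤c c≤d = ℚP.≤-trans
  (ℚP.*-monoʳ-≤-nonNeg c {{ℚ.nonNegative 0≤c}} a≤b)
  (ℚP.*-monoˡ-≤-nonNeg b {{ℚ.nonNegative (ℚP.≤-trans 0≤a a≤b)}} c≤d)

*-monoˡ : ∀ {a c d} → 0ℚ ≤ℚ a → c ≤ℚ d → a * c ≤ℚ a * d
*-monoˡ {a} 0≤a c≤d = ℚP.*-monoˡ-≤-nonNeg a {{ℚ.nonNegative 0≤a}} c≤d

*-monoʳ : ∀ {a b c} → 0ℚ ≤ℚ c → a ≤ℚ b → a * c ≤ℚ b * c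
*-monoʳ {c = c} 0≤c a≤b = ℚP.*-monoʳ-≤-nonNeg c {{ℚ.nonNegative 0≤c}} a≤b

0≤* : ∀ {a b} → 0ℚ ≤ℚ a → 0ℚ ≤ℚ b → 0ℚ ≤ℚ a * b
0≤* {a} {b} p q = subst (_≤ℚ a * b) (ℚP.*-zeroʳ a) (*-monoˡ p q)

≤-by : ∀ {a b} e → 0ℚ ≤ℚ e → a + e ≡ b → a ≤ℚ b
≤-by {a} {b} e 0≤e eq = subst₂ _≤ℚ_ (ℚP.+-identityʳ a) eq (ℚP.+-monoʳ-≤ a 0≤e)

0≤-diff : ∀ {a b} → a ≤ℚ b → 0ℚ ≤ℚ b - a
0≤-diff {a} {b} le = subst (_≤ℚ b - a) (ℚP.+-inverseʳ a) (ℚP.+-monoˡ-≤ (- a) le)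

≤-resp : ∀ {a a′ b b′} → a ≡ a′ → b ≡ b′ → a ≤ℚ b → a′ ≤ℚ b′
≤-resp refl refl p = p

-- a ≲ A means ∣ a ∣ ≤ A; being a record, it lets a and A be inferred from a proof.
infix 4 _≲_
record _≲_ (a A : ℚ) : Set where
  constructor bound
  field bounded : ∣ a ∣ ≤ℚ A
open _≲_ public

≲-upper : ∀ {a A} → a ≲ A → a ≤ℚ A
≲-upper {a} {A} (bound p) with ℚP.≤-total 0ℚ a
... | inj₁ 0≤a = subst (_≤ℚ A) (ℚP.0≤p⇒∣p∣≡p 0≤a) p
... | inj₂ a≤0 = ℚP.≤-trans a≤0 (ℚP.≤-trans (ℚP.0≤∣p∣ a) p)

≲-+ : ∀ {a b A B} → a ≲ A → b ≲ B → a + b ≲ A + B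
≲-+ {a} {b} (bound p) (bound q) = bound (ℚP.≤-trans (ℚP.∣p+q∣≤∣p∣+∣q∣ a b) (ℚP.+-mono-≤ p q))

≲-- : ∀ {a b A B} → a ≲ A → b ≲ B → a - b ≲ A + B
≲-- {a} {b} (bound p) (bound q) = bound (ℚP.≤-trans (ℚP.∣p-q∣≤∣p∣+∣q∣ a b) (ℚP.+-mono-≤ p q))

≲-* : ∀ {a b A B} → a ≲ A → b ≲ B → a * b ≲ A * B
≲-* {a} {b} (bound p) (bound q) =
  bound (subst (_≤ℚ _) (sym (ℚP.∣p*q∣≡∣p∣*∣q∣ a b)) (*-mono (ℚP.0≤∣p∣ a) p (ℚP.0≤∣p∣ b) q))

≲-neg : ∀ {a A} → a ≲ A → - a ≲ A
≲-neg {a} (bound p) = bound (subst (_≤ℚ _) (sym (ℚP.∣-p∣≡∣p∣ a)) p)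

≲-nonneg : ∀ {a A} → 0ℚ ≤ℚ a → a ≤ℚ A → a ≲ A
≲-nonneg p q = bound (ℚP.≤-trans (ℚP.≤-reflexive (ℚP.0≤p⇒∣p∣≡p p)) q)

≲-self : ∀ {a} → 0ℚ ≤ℚ a → a ≲ a
≲-self p = ≲-nonneg p ℚP.≤-refl

≲-weaken : ∀ {a A B} → a ≲ A → A ≤ℚ B → a ≲ B
≲-weaken (bound p) q = bound (ℚP.≤-trans p q)

≲-resp : ∀ {a b A} → a ≡ b → a ≲ A → b ≲ A
≲-resp refl p = p

-- Division by natural numbers

invN-inverse : ∀ d → ℕtoℚ (suc d) * invN (suc d) ≡ 1ℚ
invN-inverse d = trans (cong (ℕtoℚ (suc d) *_) (ℚP.*-identityˡ (+ 1 ℚ./ suc d)))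
  (via {ℕtoℚ (suc d) * (+ 1 ℚ./ suc d)} {1ℚ}
    (ℚᵘP.≃-trans {ℚ.toℚᵘ (ℕtoℚ (suc d) * (+ 1 ℚ./ suc d))} (ℚP.toℚᵘ-homo-* (ℕtoℚ (suc d)) (+ 1 ℚ./ suc d))
      (ℚᵘP.*-cong {ℚ.toℚᵘ (ℕtoℚ (suc d))} {ℚᵘ.mkℚᵘ (+ suc d) 0} {ℚ.toℚᵘ (+ 1 ℚ./ suc d)} {ℚᵘ.mkℚᵘ (+ 1) d}
        (toℚᵘ-ℤtoℚ (+ suc d)) (ℚP.toℚᵘ-fromℚᵘ (ℚᵘ.mkℚᵘ (+ 1) d))))
    (ℚᵘP.≃-refl {ℚ.toℚᵘ 1ℚ})
    (ℚᵘ.*≡* (cong +_ (lemma d))))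
  where
  lemma : ∀ d → suc d ℕ.* 1 ℕ.* 1 ≡ 1 ℕ.* (1 ℕ.* suc d)
  lemma d = trans (trans (ℕP.*-identityʳ _) (ℕP.*-identityʳ _)) (sym (trans (ℕP.*-identityˡ _) (ℕP.*-identityˡ _)))

-- Reciprocals are identified through the equation they solve, which avoids normalising fractions.
inverse-unique : ∀ a {b c} → a * b ≡ 1ℚ → a * c ≡ 1ℚ → b ≡ c
inverse-unique a {b} {c} p q = begin
  b           ≡⟨ ℚP.*-identityʳ b ⟨
  b * 1ℚ      ≡⟨ cong (b *_) q ⟨
  b * (a * c) ≡⟨ lemma a b c ⟩
  a * b * c   ≡⟨ cong (_* c) p ⟩
  1ℚ * c      ≡⟨ ℚP.*-identityˡ c ⟩
  c ∎
  where
  open ≡-Reasoning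
  lemma : ∀ a b c → b * (a * c) ≡ a * b * c
  lemma = solve-∀ ℚ-ring

÷ℕ-invN : ∀ q d → q ÷ℕ d ≡ q * invN d
÷ℕ-invN q zero = sym (ℚP.*-zeroʳ q)
÷ℕ-invN q (suc d) = cong (q *_) (sym (ℚP.*-identityˡ (+ 1 ℚ./ suc d)))

invN-inverse′ : ∀ {d} → 0 < d → ℕtoℚ d * invN d ≡ 1ℚ
invN-inverse′ {suc d} _ = invN-inverse d

0≤invN : ∀ d → 0ℚ ≤ℚ invN d
0≤invN zero = ℚP.≤-refl
0≤invN (suc d) = subst (0ℚ ≤ℚ_) (sym (ℚP.*-identityˡ (+ 1 ℚ./ suc d)))
  (ℚP.nonNegative⁻¹ (+ 1 ℚ./ suc d) {{ℚP.normalize-nonNeg 1 (suc d)}})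

invN-* : ∀ {a b} → 0 < a → 0 < b → invN (a ℕ.* b) ≡ invN a * invN b
invN-* {suc a} {suc b} _ _ = inverse-unique (ℕtoℚ (suc a ℕ.* suc b)) (invN-inverse (b ℕ.+ a ℕ.* suc b))
  (trans (cong (_* (invN (suc a) * invN (suc b))) (ℕtoℚ-* (suc a) (suc b)))
    (trans (lemma (ℕtoℚ (suc a)) (ℕtoℚ (suc b)) (invN (suc a)) (invN (suc b))) (trans (cong₂ _*_ (invN-inverse a) (invN-inverse b)) refl)))
  where
  lemma : ∀ a b c d → a * b * (c * d) ≡ (a * c) * (b * d)
  lemma = solve-∀ ℚ-ring

invN≤1 : ∀ d → invN d ≤ℚ 1ℚ
invN≤1 zero = from-yes (0ℚ ℚP.≤? 1ℚ)
invN≤1 (suc d) = ≤-by (ℕtoℚ d * invN (suc d)) (0≤* (0≤ℕtoℚ d) (0≤invN (suc d)))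
  (trans (lemma (ℕtoℚ d) (invN (suc d))) (trans (cong (_* invN (suc d)) (sym (ℕtoℚ-suc d))) (invN-inverse d)))
  where
  lemma : ∀ d v → v + d * v ≡ (1ℚ + d) * v
  lemma = solve-∀ ℚ-ring

-- Powers

infixr 8 _**_
_**_ : ℚ → ℕ → ℚ
a ** zero = 1ℚ
a ** suc k = a * a ** k

**-+ : ∀ a k l → a ** (k ℕ.+ l) ≡ a ** k * a ** l
**-+ a zero l = sym (ℚP.*-identityˡ (a ** l))
**-+ a (suc k) l = trans (cong (a *_) (**-+ a k l)) (sym (ℚP.*-assoc a (a ** k) (a ** l)))

**-* : ∀ a b k → (a * b) ** k ≡ a ** k * b ** k
**-* a b zero = refl
**-* a b (suc k) = trans (cong (a * b *_) (**-* a b k)) (lemma a b (a ** k) (b ** k))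
  where
  lemma : ∀ a b c d → a * b * (c * d) ≡ a * c * (b * d)
  lemma = solve-∀ ℚ-ring

0≤** : ∀ {a} → 0ℚ ≤ℚ a → ∀ k → 0ℚ ≤ℚ a ** k
0≤** p zero = from-yes (0ℚ ℚP.≤? 1ℚ)
0≤** p (suc k) = 0≤* p (0≤** p k)

**-mono : ∀ {a b} → 0ℚ ≤ℚ a → a ≤ℚ b → ∀ k → a ** k ≤ℚ b ** k
**-mono 0≤a a≤b zero = ℚP.≤-refl
**-mono 0≤a a≤b (suc k) = *-mono 0≤a a≤b (0≤** 0≤a k) (**-mono 0≤a a≤b k)

**-≤1 : ∀ {a} → 0ℚ ≤ℚ a → a ≤ℚ 1ℚ → ∀ k → a ** k ≤ℚ 1ℚ
**-≤1 0≤a a≤1 zero = ℚP.≤-refl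
**-≤1 0≤a a≤1 (suc k) = *-mono 0≤a a≤1 (0≤** 0≤a k) (**-≤1 0≤a a≤1 k)

1** : ∀ k → 1ℚ ** k ≡ 1ℚ
1** zero = refl
1** (suc k) = trans (ℚP.*-identityˡ (1ℚ ** k)) (1** k)

ℕtoℚ-^ : ∀ a k → ℕtoℚ (a ^ k) ≡ ℕtoℚ a ** k
ℕtoℚ-^ a zero = refl
ℕtoℚ-^ a (suc k) = trans (ℕtoℚ-* a (a ^ k)) (cong (ℕtoℚ a *_) (ℕtoℚ-^ a k))

^-positive : ∀ a k → 0 < suc a ^ k
^-positive a k = ℕP.m^n>0 (suc a) k

invN-^ : ∀ a k → invN (suc a ^ k) ≡ invN (suc a) ** k
invN-^ a k = inverse-unique (ℕtoℚ (suc a ^ k)) (invN-inverse′ (^-positive a k))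
  (trans (cong (_* invN (suc a) ** k) (ℕtoℚ-^ (suc a) k))
    (trans (sym (**-* (ℕtoℚ (suc a)) (invN (suc a)) k)) (trans (cong (_** k) (invN-inverse a)) (1** k))))

-- Polynomial growth against geometric decay


-- Bernoulli's inequality for `(1 + 1/c)^s`, multiplied by `c = k + 1`. A larger `c` gives a rate
-- closer to 1: `c = 40` serves fifth powers, `c = 2` linear weights.
bernoulli : ∀ k s → ℕtoℚ (suc k) + ℕtoℚ s ≤ℚ ℕtoℚ (suc k) * (1ℚ + invN (suc k)) ** s
bernoulli k zero = ℚP.≤-reflexive (trans (ℚP.+-identityʳ (ℕtoℚ (suc k))) (sym (ℚP.*-identityʳ (ℕtoℚ (suc k)))))
bernoulli k (suc s) = ℚP.≤-trans
  (≤-by (ℕtoℚ s * ι) (0≤* (0≤ℕtoℚ s) (0≤invN (suc k)))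
    (trans (cong (λ x → c + x + ℕtoℚ s * ι) (ℕtoℚ-suc s))
      (trans (cong (λ x → c + (x + ℕtoℚ s) + ℕtoℚ s * ι) (sym (invN-inverse k))) (lemma₁ c ι (ℕtoℚ s)))))
  (ℚP.≤-trans (*-monoˡ (0≤+ (from-yes (0ℚ ℚP.≤? 1ℚ)) (0≤invN (suc k))) (bernoulli k s))
    (ℚP.≤-reflexive (lemma₂ c (1ℚ + ι) ((1ℚ + ι) ** s))))
  where
  c ι : ℚ
  c = ℕtoℚ (suc k)
  ι = invN (suc k)
  lemma₁ : ∀ c ι s → c + (c * ι + s) + s * ι ≡ (1ℚ + ι) * (c + s)
  lemma₁ = solve-∀ ℚ-ring
  lemma₂ : ∀ c ι p → ι * (c * p) ≡ c * (ι * p)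
  lemma₂ = solve-∀ ℚ-ring

fifth : ℚ → ℚ
fifth a = a * a * a * a * a

-- A rate above ½ that leaves room for a fifth power. Its square 16/49 is below 1/3, the rate of the
-- theorem, and it lies below 2/3, which makes the backward recursion contract.
4/7 : ℚ
4/7 = + 4 ℚ./ 7

-- (41/40)⁵ / 2 ≤ 4/7
fifth-decay : ∀ s → fifth (ℕtoℚ s) * ½ ** s ≤ℚ ℕtoℚ (40 ^ 5) * 4/7 ** s
fifth-decay s = ℚP.≤-trans
  (*-monoʳ (0≤** (from-yes (0ℚ ℚP.≤? ½)) s)
    (*-mono (0≤* (0≤* (0≤* 0≤s 0≤s) 0≤s) 0≤s) (*-mono (0≤* (0≤* 0≤s 0≤s) 0≤s) (*-mono (0≤* 0≤s 0≤s) (*-mono 0≤s le 0≤s le) 0≤s le) 0≤s le) 0≤s le))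
  (ℚP.≤-trans (ℚP.≤-reflexive (trans (lemma (ℕtoℚ 40) (b ** s) (½ ** s)) (cong (fifth (ℕtoℚ 40) *_) (sym power))))
    (*-monoˡ (0≤ℕtoℚ (40 ^ 5)) (**-mono (from-yes (0ℚ ℚP.≤? b * b * b * b * b * ½)) (from-yes (b * b * b * b * b * ½ ℚP.≤? 4/7)) s)))
  where
  b : ℚ
  b = 1ℚ + invN 40
  0≤s : 0ℚ ≤ℚ ℕtoℚ s
  0≤s = 0≤ℕtoℚ s
  le : ℕtoℚ s ≤ℚ ℕtoℚ 40 * b ** s
  le = ℚP.≤-trans (≤-by (ℕtoℚ 40) (0≤ℕtoℚ 40) (ℚP.+-comm (ℕtoℚ s) (ℕtoℚ 40))) (bernoulli 39 s)
  lemma : ∀ c p h → fifth (c * p) * h ≡ fifth c * (fifth p * h)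
  lemma c p h = go c p h
    where
    go : ∀ c p h → c * p * (c * p) * (c * p) * (c * p) * (c * p) * h ≡ c * c * c * c * c * (p * p * p * p * p * h)
    go = solve-∀ ℚ-ring
  power : (b * b * b * b * b * ½) ** s ≡ fifth (b ** s) * ½ ** s
  power = trans (**-* (b * b * b * b * b) ½ s) (cong (_* ½ ** s)
    (trans (**-* (b * b * b * b) b s) (cong (_* b ** s)
      (trans (**-* (b * b * b) b s) (cong (_* b ** s)
        (trans (**-* (b * b) b s) (cong (_* b ** s) (**-* b b s))))))))

-- Ballot ratios and their quadratic model

0≤1 : 0ℚ ≤ℚ 1ℚ
0≤1 = from-yes (0ℚ ℚP.≤? 1ℚ)

0≤½ : 0ℚ ≤ℚ ½
0≤½ = from-yes (0ℚ ℚP.≤? ½)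

-- `c` bounds `1/L` from above, so a bound on `u L` passes to `u` without a division.
≲-divide : ∀ {u w W} L c → u * L ≡ w → 0ℚ ≤ℚ L → 0ℚ ≤ℚ c → 1ℚ ≤ℚ c * L → w ≲ W → u ≲ c * W
≲-divide {u} {w} {W} L c eq 0≤L 0≤c 1≤cL (bound p) = bound (ℚP.≤-trans
  (subst (_≤ℚ ∣ u ∣ * (c * L)) (ℚP.*-identityʳ ∣ u ∣) (*-monoˡ (ℚP.0≤∣p∣ u) 1≤cL))
  (ℚP.≤-trans (ℚP.≤-reflexive eq′) (*-monoˡ 0≤c p)))
  where
  lemma : ∀ u c L → u * (c * L) ≡ c * (u * L)
  lemma = solve-∀ ℚ-ring
  eq′ : ∣ u ∣ * (c * L) ≡ c * ∣ w ∣
  eq′ = trans (lemma ∣ u ∣ c L) (cong (c *_) (trans (cong (∣ u ∣ *_) (sym (ℚP.0≤p⇒∣p∣≡p 0≤L)))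
    (trans (sym (ℚP.∣p*q∣≡∣p∣*∣q∣ u L)) (cong ∣_∣ eq))))

0≤-divide : ∀ {u w} L c → u * L ≡ w → 0ℚ ≤ℚ c → 1ℚ ≤ℚ c * L → 0ℚ ≤ℚ w → 0ℚ ≤ℚ u
0≤-divide {u} {w} L c eq 0≤c 1≤cL 0≤w with ℚP.≤-total 0ℚ u
... | inj₁ 0≤u = 0≤u
... | inj₂ u≤0 = ℚP.≤-trans (0≤* 0≤c 0≤w) (≤-resp (trans (lemma u c L) (cong (c *_) eq)) (ℚP.*-identityʳ u)
    (ℚP.*-monoˡ-≤-nonPos u {{ℚ.nonPositive u≤0}} 1≤cL))
  where
  lemma : ∀ u c L → u * (c * L) ≡ c * (u * L)
  lemma = solve-∀ ℚ-ring

-- The trees have size n = ν + 4.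
module Row (ν : ℕ) where

  n m : ℕ
  n = 4 ℕ.+ ν
  m = 3 ℕ.+ ν

  y : ℚ
  y = invN n

  0≤y : 0ℚ ≤ℚ y
  0≤y = 0≤invN n

  -- h and v are abstract because their unfoldings involve gcd computations on open terms.
  abstract
    h : ℚ
    h = invN 4 * y

    0≤h : 0ℚ ≤ℚ h
    0≤h = 0≤* (0≤invN 4) 0≤y

    y≡4h : y ≡ ℕtoℚ 4 * h
    y≡4h = trans (sym (ℚP.*-identityˡ y)) (ℚP.*-assoc (ℕtoℚ 4) (invN 4) y)

    h≤1 : h ≤ℚ 1ℚ
    h≤1 = *-mono (0≤invN 4) (invN≤1 4) 0≤y (invN≤1 n)

  c : ℕ
  c = ballot m 1

  β : ℕ → ℚ
  β k = ℕtoℚ (ballot m k) * invN c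

  abstract
    -- The ratio of `[zᵐ] Tᵏ` to the number of trees, `k = p + 1`, divided by its limit `k 2^(1-k)`.
    v : ℕ → ℚ
    v p = ℕtoℚ 2 ** p * β (suc p) * invN (suc p)

    0≤v : ∀ p → 0ℚ ≤ℚ v p
    0≤v p = 0≤* (0≤* (0≤** (0≤ℕtoℚ 2) p) (0≤* (0≤ℕtoℚ (ballot m (suc p))) (0≤invN c))) (0≤invN (suc p))

    v-zero : v 0 ≡ 1ℚ
    v-zero = trans (cong (λ x → 1ℚ * x * invN 1) (invN-inverse′ (ballot-positive (2 ℕ.+ ν)))) refl

    v-vanish : ∀ p → m ≤ p → v p ≡ 0ℚ
    v-vanish p le = trans (cong (λ x → ℕtoℚ 2 ** p * (ℕtoℚ x * invN c) * invN (suc p)) (ballot-vanish m (suc p) (s≤s le)))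
      (lemma (ℕtoℚ 2 ** p) (invN c) (invN (suc p)))
      where
      lemma : ∀ a b d → a * (0ℚ * b) * d ≡ 0ℚ
      lemma = solve-∀ ℚ-ring

    -- With `e = m - 1 - p` the row ratio becomes `v (p + 1) / v p = 2e / (p + 2e)`: the factors
    -- `p + 1` and `p + 2` cancel against the normalisation.
    v-rec : ∀ p e → p ℕ.+ e ≡ 2 ℕ.+ ν → v (suc p) * (ℕtoℚ p + ℕtoℚ 2 * ℕtoℚ e) ≡ v p * (ℕtoℚ 2 * ℕtoℚ e)
    v-rec p e eq = begin
      ℕtoℚ 2 * w * (t₂ * C) * J₂ * L                  ≡⟨ step₁ w t₂ C J₂ L ⟩
      ℕtoℚ 2 * w * C * J₂ * (1ℚ * (t₂ * L))           ≡⟨ cong (λ x → ℕtoℚ 2 * w * C * J₂ * (x * (t₂ * L))) inv₁ ⟨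
      ℕtoℚ 2 * w * C * J₂ * ((1ℚ + P) * J₁ * (t₂ * L)) ≡⟨ step₂ w t₂ C J₁ J₂ L P ⟩
      ℕtoℚ 2 * w * C * J₂ * J₁ * ((1ℚ + P) * L * t₂)  ≡⟨ cong (ℕtoℚ 2 * w * C * J₂ * J₁ *_) rowℚ ⟩
      ℕtoℚ 2 * w * C * J₂ * J₁ * ((ℕtoℚ 2 + P) * E * t₁) ≡⟨ step₃ w t₁ C J₁ J₂ E P ⟩
      ((ℕtoℚ 2 + P) * J₂) * (w * (t₁ * C) * J₁ * (ℕtoℚ 2 * E)) ≡⟨ cong (_* (w * (t₁ * C) * J₁ * (ℕtoℚ 2 * E))) inv₂ ⟩
      1ℚ * (w * (t₁ * C) * J₁ * (ℕtoℚ 2 * E))         ≡⟨ ℚP.*-identityˡ _ ⟩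
      w * (t₁ * C) * J₁ * (ℕtoℚ 2 * E) ∎
      where
      open ≡-Reasoning
      P E L w C J₁ J₂ t₁ t₂ : ℚ
      P = ℕtoℚ p
      E = ℕtoℚ e
      L = P + ℕtoℚ 2 * E
      w = ℕtoℚ 2 ** p
      C = invN c
      J₁ = invN (suc p)
      J₂ = invN (2 ℕ.+ p)
      t₁ = ℕtoℚ (ballot m (suc p))
      t₂ = ℕtoℚ (ballot m (2 ℕ.+ p))
      inv₁ : (1ℚ + P) * J₁ ≡ 1ℚ
      inv₁ = trans (cong (_* J₁) (sym (ℕtoℚ-suc p))) (invN-inverse p)
      inv₂ : (ℕtoℚ 2 + P) * J₂ ≡ 1ℚ
      inv₂ = trans (cong (_* J₂) (sym (ℕtoℚ-+ 2 p))) (invN-inverse (suc p))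
      rowℤ : (+ 1 ℤ.+ + p) ℤ.* (+ p ℤ.+ + 2 ℤ.* + e) ℤ.* + ballot m (2 ℕ.+ p) ≡ (+ 2 ℤ.+ + p) ℤ.* + e ℤ.* + ballot m (suc p)
      rowℤ = trans (cong (λ x → (+ 1 ℤ.+ + p) ℤ.* x ℤ.* + ballot m (2 ℕ.+ p)) (sym (trans (cong (λ x → + 2 ℤ.* + x ℤ.- + p) (sym eq)) (lemma₁ (+ p) (+ e)))))
        (trans (row (2 ℕ.+ ν) p) (cong (λ x → (+ 2 ℤ.+ + p) ℤ.* x ℤ.* + ballot m (suc p)) (trans (cong (λ x → + x ℤ.- + p) (sym eq)) (lemma₂ (+ p) (+ e)))))
        where
        lemma₁ : ∀ p e → + 2 ℤ.* (p ℤ.+ e) ℤ.- p ≡ p ℤ.+ + 2 ℤ.* e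
        lemma₁ = ℤSolver.solve-∀
        lemma₂ : ∀ p e → p ℤ.+ e ℤ.- p ≡ e
        lemma₂ = ℤSolver.solve-∀
      rowℚ : (1ℚ + P) * L * t₂ ≡ (ℕtoℚ 2 + P) * E * t₁
      rowℚ = trans (sym cast₁) (trans (cong ℤtoℚ rowℤ) cast₂)
        where
        cast₁ : ℤtoℚ ((+ 1 ℤ.+ + p) ℤ.* (+ p ℤ.+ + 2 ℤ.* + e) ℤ.* + ballot m (2 ℕ.+ p)) ≡ (1ℚ + P) * L * t₂
        cast₁ = trans (ℤtoℚ-* ((+ 1 ℤ.+ + p) ℤ.* (+ p ℤ.+ + 2 ℤ.* + e)) (+ ballot m (2 ℕ.+ p))) (cong (_* t₂)
          (trans (ℤtoℚ-* (+ 1 ℤ.+ + p) (+ p ℤ.+ + 2 ℤ.* + e)) (cong₂ _*_ (ℤtoℚ-+ (+ 1) (+ p))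
            (trans (ℤtoℚ-+ (+ p) (+ 2 ℤ.* + e)) (cong (λ x → P + x) (ℤtoℚ-* (+ 2) (+ e)))))))
        cast₂ : ℤtoℚ ((+ 2 ℤ.+ + p) ℤ.* + e ℤ.* + ballot m (suc p)) ≡ (ℕtoℚ 2 + P) * E * t₁
        cast₂ = trans (ℤtoℚ-* ((+ 2 ℤ.+ + p) ℤ.* + e) (+ ballot m (suc p))) (cong (_* t₁)
          (trans (ℤtoℚ-* (+ 2 ℤ.+ + p) (+ e)) (cong (_* E) (ℤtoℚ-+ (+ 2) (+ p)))))
      step₁ : ∀ w t C J L → ℕtoℚ 2 * w * (t * C) * J * L ≡ ℕtoℚ 2 * w * C * J * (1ℚ * (t * L))
      step₁ = solve-∀ ℚ-ring
      step₂ : ∀ w t C J₁ J₂ L P → ℕtoℚ 2 * w * C * J₂ * ((1ℚ + P) * J₁ * (t * L)) ≡ ℕtoℚ 2 * w * C * J₂ * J₁ * ((1ℚ + P) * L * t)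
      step₂ = solve-∀ ℚ-ring
      step₃ : ∀ w t C J₁ J₂ E P → ℕtoℚ 2 * w * C * J₂ * J₁ * ((ℕtoℚ 2 + P) * E * t)
        ≡ ((ℕtoℚ 2 + P) * J₂) * (w * (t * C) * J₁ * (ℕtoℚ 2 * E))
      step₃ = solve-∀ ℚ-ring

    β-v : ∀ p → β (suc p) ≡ ½ ** p * (1ℚ + ℕtoℚ p) * v p
    β-v p = begin
      β (suc p) ≡⟨ ones (β (suc p)) ⟩
      1ℚ * 1ℚ * β (suc p) ≡⟨ cong₂ (λ a b → a * b * β (suc p)) (sym half) (sym inv) ⟩
      ½ ** p * ℕtoℚ 2 ** p * ((1ℚ + ℕtoℚ p) * invN (suc p)) * β (suc p)
        ≡⟨ lemma (½ ** p) (ℕtoℚ 2 ** p) (ℕtoℚ p) (invN (suc p)) (β (suc p)) ⟩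
      ½ ** p * (1ℚ + ℕtoℚ p) * v p ∎
      where
      open ≡-Reasoning
      half : ½ ** p * ℕtoℚ 2 ** p ≡ 1ℚ
      half = trans (sym (**-* ½ (ℕtoℚ 2) p)) (1** p)
      inv : (1ℚ + ℕtoℚ p) * invN (suc p) ≡ 1ℚ
      inv = trans (cong (_* invN (suc p)) (sym (ℕtoℚ-suc p))) (invN-inverse p)
      ones : ∀ b → b ≡ 1ℚ * 1ℚ * b
      ones = solve-∀ ℚ-ring
      lemma : ∀ a b P J t → a * b * ((1ℚ + P) * J) * t ≡ a * (1ℚ + P) * (b * t * J)
      lemma = solve-∀ ℚ-ring

  n-inverse : ∀ p e → p ℕ.+ e ≡ 2 ℕ.+ ν → ℕtoℚ 4 * h * (ℕtoℚ 2 + (ℕtoℚ p + ℕtoℚ e)) ≡ 1ℚ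
  n-inverse p e eq = trans (cong₂ _*_ (sym y≡4h) (sym cast)) (trans (ℚP.*-comm y (ℕtoℚ n)) (invN-inverse m))
    where
    cast : ℕtoℚ n ≡ ℕtoℚ 2 + (ℕtoℚ p + ℕtoℚ e)
    cast = trans (cong (λ x → ℕtoℚ (2 ℕ.+ x)) (sym eq)) (trans (ℕtoℚ-+ 2 (p ℕ.+ e)) (cong (λ x → ℕtoℚ 2 + x) (ℕtoℚ-+ p e)))

  module Step (p e : ℕ) (eq : p ℕ.+ e ≡ 2 ℕ.+ ν) where

    P E L : ℚ
    P = ℕtoℚ p
    E = ℕtoℚ e
    L = P + ℕtoℚ 2 * E

    0≤P : 0ℚ ≤ℚ P
    0≤P = 0≤ℕtoℚ p

    0≤L : 0ℚ ≤ℚ L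
    0≤L = 0≤+ 0≤P (0≤* (0≤ℕtoℚ 2) (0≤ℕtoℚ e))

    L-large : 1ℚ ≤ℚ ℕtoℚ 8 * h * L
    -- `2L = n + ν + 2e`, hence `L` is at least `n/2`; this uses that sizes start at 4.
    L-large = ≤-by (ℕtoℚ 4 * h * (ℕtoℚ ν + ℕtoℚ 2 * E)) (0≤* (0≤* (0≤ℕtoℚ 4) 0≤h) (0≤+ (0≤ℕtoℚ ν) (0≤* (0≤ℕtoℚ 2) (0≤ℕtoℚ e))))
      (trans (cong (_+ ℕtoℚ 4 * h * (ℕtoℚ ν + ℕtoℚ 2 * E)) (sym (n-inverse p e eq)))
        (trans (lemma₁ h P E (ℕtoℚ ν)) (trans (cong (λ x → ℕtoℚ 4 * h * (x + (P + ℕtoℚ 3 * E))) νeq) (lemma₂ h P E))))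
      where
      νeq : ℕtoℚ 2 + ℕtoℚ ν ≡ P + E
      νeq = trans (sym (ℕtoℚ-+ 2 ν)) (trans (cong ℕtoℚ (sym eq)) (ℕtoℚ-+ p e))
      lemma₁ : ∀ h P E ν → ℕtoℚ 4 * h * (ℕtoℚ 2 + (P + E)) + ℕtoℚ 4 * h * (ν + ℕtoℚ 2 * E)
        ≡ ℕtoℚ 4 * h * (ℕtoℚ 2 + ν + (P + ℕtoℚ 3 * E))
      lemma₁ = solve-∀ ℚ-ring
      lemma₂ : ∀ h P E → ℕtoℚ 4 * h * (P + E + (P + ℕtoℚ 3 * E)) ≡ ℕtoℚ 8 * h * (P + ℕtoℚ 2 * E)
      lemma₂ = solve-∀ ℚ-ring

    drop : (v p - v (suc p)) * L ≡ v p * P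
    drop = trans (lemma₁ (v p) (v (suc p)) L) (trans (cong (λ x → v p * L - x) (v-rec p e eq)) (lemma₂ (v p) P E))
      where
      lemma₁ : ∀ a b L → (a - b) * L ≡ a * L - b * L
      lemma₁ = solve-∀ ℚ-ring
      lemma₂ : ∀ a P E → a * (P + ℕtoℚ 2 * E) - a * (ℕtoℚ 2 * E) ≡ a * P
      lemma₂ = solve-∀ ℚ-ring

    0≤8h : 0ℚ ≤ℚ ℕtoℚ 8 * h
    0≤8h = 0≤* (0≤ℕtoℚ 8) 0≤h

    drop-bound : v p ≤ℚ 1ℚ → v p - v (suc p) ≲ ℕtoℚ 8 * h * (1ℚ * P)
    drop-bound le = ≲-divide L (ℕtoℚ 8 * h) drop 0≤L 0≤8h L-large (≲-* (≲-nonneg (0≤v p) le) (≲-self 0≤P))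

  -- A first-order estimate, `1 - v p` at most `p²/n`, from summing drops of at most `2p/n`. It
  -- feeds the second-order estimate.
  deficit : ∀ p → p ≤ 2 ℕ.+ ν → (v p ≤ℚ 1ℚ) × (1ℚ - v p ≤ℚ ℕtoℚ 4 * h * (ℕtoℚ p * ℕtoℚ p))
  deficit zero le = ℚP.≤-reflexive v-zero ,
    ℚP.≤-reflexive (trans (cong (λ x → 1ℚ - x) v-zero) (lemma (ℕtoℚ 4 * h)))
    where
    lemma : ∀ a → 0ℚ ≡ a * 0ℚ
    lemma = solve-∀ ℚ-ring
  deficit (suc p) le with deficit p (ℕP.≤-trans (ℕP.n≤1+n p) le)
  ... | v≤1 , small = ℚP.≤-trans down v≤1 ,
      ≤-resp (lemma₁ (v p) (v (suc p))) eq (ℚP.+-mono-≤ small (ℚP.≤-trans (≲-upper (drop-bound v≤1)) (≤-by {b = ℕtoℚ 8 * h * (1ℚ * P) + ℕtoℚ 4 * h} (ℕtoℚ 4 * h) (0≤* (0≤ℕtoℚ 4) 0≤h) refl)))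
    where
    open Step p (2 ℕ.+ ν ℕ.∸ p) (ℕP.m+[n∸m]≡n (ℕP.≤-trans (ℕP.n≤1+n p) le))
    lemma₁ : ∀ a b → (1ℚ - a) + (a - b) ≡ 1ℚ - b
    lemma₁ = solve-∀ ℚ-ring
    lemma₂ : ∀ h P → ℕtoℚ 4 * h * (P * P) + (ℕtoℚ 8 * h * (1ℚ * P) + ℕtoℚ 4 * h) ≡ ℕtoℚ 4 * h * ((1ℚ + P) * (1ℚ + P))
    lemma₂ = solve-∀ ℚ-ring
    eq : ℕtoℚ 4 * h * (P * P) + (ℕtoℚ 8 * h * (1ℚ * P) + ℕtoℚ 4 * h) ≡ ℕtoℚ 4 * h * (ℕtoℚ (suc p) * ℕtoℚ (suc p))
    eq = trans (lemma₂ h P) (cong (λ x → ℕtoℚ 4 * h * (x * x)) (sym (ℕtoℚ-suc p)))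
    down : v (suc p) ≤ℚ v p
    down = ≤-by (v p - v (suc p)) (0≤-divide L (ℕtoℚ 8 * h) drop 0≤8h L-large (0≤* (0≤v p) 0≤P)) (lemma₃ (v p) (v (suc p)))
      where
      lemma₃ : ∀ a b → b + (a - b) ≡ a
      lemma₃ = solve-∀ ℚ-ring

  -- `h` is `1/(4n)`; the model subtracts from 1 the sum of the leading drops `2ih` over `i < p`.
  model D : ℕ → ℚ
  model p = 1ℚ - ℕtoℚ p * (ℕtoℚ p - 1ℚ) * h
  D p = v p - model p

  fourth : ℚ → ℚ
  fourth a = a * a * a * a

  -- With u = v p - v (p + 1): D (p + 1) - D p = 2ph - u and (2ph - u) L = p ((1 - v p) - 2ph - 8h).
  D-bound-low : ∀ p → p ≤ 3 ℕ.+ ν → D p ≲ fourth (1ℚ + ℕtoℚ p) * (ℕtoℚ 16 * h * h)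
  D-bound-low zero le = ≲-resp (sym (trans (cong (_- model 0) v-zero) (lemma h)))
      (≲-nonneg ℚP.≤-refl (0≤* (from-yes (0ℚ ℚP.≤? fourth (1ℚ + ℕtoℚ 0))) (0≤* (0≤* (0≤ℕtoℚ 16) 0≤h) 0≤h)))
    where
    lemma : ∀ h → 1ℚ - (1ℚ - 0ℚ * (0ℚ - 1ℚ) * h) ≡ 0ℚ
    lemma = solve-∀ ℚ-ring
  D-bound-low (suc p) (s≤s le) =
    ≲-weaken (≲-resp step-eq (≲-+ (D-bound-low p (ℕP.≤-trans le (ℕP.n≤1+n _))) increment)) final
    where
    open Step p (2 ℕ.+ ν ℕ.∸ p) (ℕP.m+[n∸m]≡n le)
    v≤1 : v p ≤ℚ 1ℚ
    v≤1 = proj₁ (deficit p le)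
    small : 1ℚ - v p ≤ℚ ℕtoℚ 4 * h * (P * P)
    small = proj₂ (deficit p le)
    increment : ℕtoℚ 2 * P * h - (v p - v (suc p)) ≲ ℕtoℚ 8 * h * (P * (ℕtoℚ 4 * h * (P * P) + (ℕtoℚ 2 * h * P + ℕtoℚ 8 * h)))
    increment = ≲-divide L (ℕtoℚ 8 * h) eq 0≤L 0≤8h L-large
      (≲-* (≲-self 0≤P) (≲-- (≲-nonneg (0≤-diff v≤1) small)
        (≲-+ (≲-self (0≤* (0≤* (0≤ℕtoℚ 2) 0≤h) 0≤P)) (≲-self (0≤* (0≤ℕtoℚ 8) 0≤h)))))
      where
      eq : (ℕtoℚ 2 * P * h - (v p - v (suc p))) * L ≡ P * ((1ℚ - v p) - (ℕtoℚ 2 * h * P + ℕtoℚ 8 * h))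
      eq = trans (lemma₁ P h (v p - v (suc p)) L) (trans (cong (λ x → ℕtoℚ 2 * P * h * L - x) drop)
        (trans (lemma₂ P E h (v p)) (trans (cong (λ x → P * (x - v p - (ℕtoℚ 2 * h * P + ℕtoℚ 8 * h))) (n-inverse p (2 ℕ.+ ν ℕ.∸ p) (ℕP.m+[n∸m]≡n le))) refl)))
        where
        lemma₁ : ∀ P h u L → (ℕtoℚ 2 * P * h - u) * L ≡ ℕtoℚ 2 * P * h * L - u * L
        lemma₁ = solve-∀ ℚ-ring
        lemma₂ : ∀ P E h v → ℕtoℚ 2 * P * h * (P + ℕtoℚ 2 * E) - v * P
          ≡ P * (ℕtoℚ 4 * h * (ℕtoℚ 2 + (P + E)) - v - (ℕtoℚ 2 * h * P + ℕtoℚ 8 * h))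
        lemma₂ = solve-∀ ℚ-ring
    step-eq : D p + (ℕtoℚ 2 * P * h - (v p - v (suc p))) ≡ D (suc p)
    step-eq = trans (lemma (v p) (v (suc p)) P h) (cong (λ x → v (suc p) - (1ℚ - x * (x - 1ℚ) * h)) (sym (ℕtoℚ-suc p)))
      where
      lemma : ∀ a b P h → (a - (1ℚ - P * (P - 1ℚ) * h)) + (ℕtoℚ 2 * P * h - (a - b)) ≡ b - (1ℚ - (1ℚ + P) * (1ℚ + P - 1ℚ) * h)
      lemma = solve-∀ ℚ-ring
    final : fourth (1ℚ + P) * (ℕtoℚ 16 * h * h) + ℕtoℚ 8 * h * (P * (ℕtoℚ 4 * h * (P * P) + (ℕtoℚ 2 * h * P + ℕtoℚ 8 * h)))
      ≤ℚ fourth (1ℚ + ℕtoℚ (suc p)) * (ℕtoℚ 16 * h * h)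
    -- In units of `16h²` the increment is `2P³ + P² + 4P`; this polynomial is what it leaves of
    -- `(2 + P)⁴ - (1 + P)⁴`.
    final = ≤-by ((ℕtoℚ 2 * P * P * P + ℕtoℚ 17 * P * P + ℕtoℚ 24 * P + ℕtoℚ 15) * (ℕtoℚ 16 * h * h))
      (0≤* (0≤+ (0≤+ (0≤+ (0≤* (0≤* (0≤* (0≤ℕtoℚ 2) 0≤P) 0≤P) 0≤P) (0≤* (0≤* (0≤ℕtoℚ 17) 0≤P) 0≤P)) (0≤* (0≤ℕtoℚ 24) 0≤P)) (0≤ℕtoℚ 15))
           (0≤* (0≤* (0≤ℕtoℚ 16) 0≤h) 0≤h))
      (trans (lemma P h) (cong (λ x → fourth (1ℚ + x) * (ℕtoℚ 16 * h * h)) (sym (ℕtoℚ-suc p))))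
      where
      lemma : ∀ P h → (1ℚ + P) * (1ℚ + P) * (1ℚ + P) * (1ℚ + P) * (ℕtoℚ 16 * h * h)
          + ℕtoℚ 8 * h * (P * (ℕtoℚ 4 * h * (P * P) + (ℕtoℚ 2 * h * P + ℕtoℚ 8 * h)))
          + (ℕtoℚ 2 * P * P * P + ℕtoℚ 17 * P * P + ℕtoℚ 24 * P + ℕtoℚ 15) * (ℕtoℚ 16 * h * h)
        ≡ (1ℚ + (1ℚ + P)) * (1ℚ + (1ℚ + P)) * (1ℚ + (1ℚ + P)) * (1ℚ + (1ℚ + P)) * (ℕtoℚ 16 * h * h)
      lemma = solve-∀ ℚ-ring

  1≤sy : ∀ s → n ≤ s → 1ℚ ≤ℚ ℕtoℚ s * y
  1≤sy s le = ≤-resp (invN-inverse m) refl (*-monoʳ 0≤y (ℕtoℚ-mono le))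

  square-large : ∀ s → n ≤ s → 1ℚ ≤ℚ ℕtoℚ s * ℕtoℚ s * (ℕtoℚ 16 * h * h)
  square-large s le = ≤-resp refl (trans (cong (λ x → ℕtoℚ s * x * (ℕtoℚ s * x)) y≡4h) (lemma (ℕtoℚ s) h))
      (*-mono 0≤1 (1≤sy s le) 0≤1 (1≤sy s le))
    where
    lemma : ∀ s h → s * (ℕtoℚ 4 * h) * (s * (ℕtoℚ 4 * h)) ≡ s * s * (ℕtoℚ 16 * h * h)
    lemma = solve-∀ ℚ-ring

  -- From `p = m` on the coefficient is zero, and the model, quadratic in `p`, is at most
  -- `(1 + p)²`, which is at most `(1 + p)⁴/n²`.
  D-bound-high : ∀ p → 3 ℕ.+ ν ≤ p → D p ≲ fourth (1ℚ + ℕtoℚ p) * (ℕtoℚ 16 * h * h)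
  D-bound-high p le = ≲-resp (cong (_- model p) (sym (v-vanish p le)))
      (≲-weaken (≲-- (≲-self ℚP.≤-refl) (≲-- (≲-self 0≤1)
          (≲-* (≲-* (≲-self 0≤P) (≲-- (≲-self 0≤P) (≲-self 0≤1))) (≲-nonneg 0≤h h≤1))))
        (ℚP.≤-trans (≤-by P 0≤P (lemma₁ P)) (≤-resp (ℚP.*-identityʳ _) (lemma₂ (1ℚ + P) h) (*-monoˡ (0≤* 0≤1+P 0≤1+P) large))))
    where
    P : ℚ
    P = ℕtoℚ p
    0≤P : 0ℚ ≤ℚ P
    0≤P = 0≤ℕtoℚ p
    0≤1+P : 0ℚ ≤ℚ 1ℚ + P
    0≤1+P = 0≤+ 0≤1 0≤P
    large : 1ℚ ≤ℚ (1ℚ + P) * (1ℚ + P) * (ℕtoℚ 16 * h * h)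
    large = ≤-resp refl (cong (λ x → x * x * (ℕtoℚ 16 * h * h)) (ℕtoℚ-suc p)) (square-large (suc p) (s≤s le))
    lemma₁ : ∀ P → 0ℚ + (1ℚ + P * (P + 1ℚ) * 1ℚ) + P ≡ (1ℚ + P) * (1ℚ + P)
    lemma₁ = solve-∀ ℚ-ring
    lemma₂ : ∀ a h → a * a * (a * a * (ℕtoℚ 16 * h * h)) ≡ a * a * a * a * (ℕtoℚ 16 * h * h)
    lemma₂ = solve-∀ ℚ-ring

  D-bound : ∀ p → D p ≲ fourth (1ℚ + ℕtoℚ p) * (ℕtoℚ 16 * h * h)
  D-bound p with ℕP.≤-total p (3 ℕ.+ ν)
  ... | inj₁ le = D-bound-low p le
  ... | inj₂ le = D-bound-high p le

  β-D : ∀ p → β (suc p) ≡ ½ ** p * (1ℚ + ℕtoℚ p) * (model p + D p)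
  β-D p = trans (β-v p) (cong (½ ** p * (1ℚ + ℕtoℚ p) *_) (lemma (v p) (model p)))
    where
    lemma : ∀ v M → v ≡ M + (v - M)
    lemma = solve-∀ ℚ-ring

  -- The model for [zᵐ](Tˢ + Tˢ⁺¹), divided by the number of trees.
  modelPair : ℕ → ℚ
  modelPair s = ½ ** s * (ℕtoℚ 3 * ℕtoℚ s + 1ℚ - ℕtoℚ 3 * h * (ℕtoℚ s * (ℕtoℚ s - 1ℚ) * (ℕtoℚ s - 1ℚ)))

  pair-error : ∀ s → β (suc s) + β (2 ℕ.+ s) - modelPair (suc s) ≲ ℕtoℚ 34 * (fifth (ℕtoℚ (suc s)) * ½ ** suc s) * (y * y)
  pair-error s = ≲-weaken (≲-resp eq (≲-* (≲-self (0≤** 0≤½ (suc s)))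
      (≲-+ (≲-* (≲-self (0≤* (0≤ℕtoℚ 2) 0≤S)) (D-bound s))
           (≲-* (≲-self (0≤+ 0≤1 0≤S)) (D-bound (suc s))))))
    (≤-resp refl (lemma₄ (½ ** suc s)) (*-monoˡ (0≤** 0≤½ (suc s)) final))
    where
    S : ℚ
    S = ℕtoℚ (suc s)
    0≤S : 0ℚ ≤ℚ S
    0≤S = 0≤ℕtoℚ (suc s)
    S-eq : ℕtoℚ s ≡ S - 1ℚ
    S-eq = trans (lemma (ℕtoℚ s)) (cong (_- 1ℚ) (sym (ℕtoℚ-suc s)))
      where
      lemma : ∀ s → s ≡ 1ℚ + s - 1ℚ
      lemma = solve-∀ ℚ-ring
    eq : ½ ** suc s * (ℕtoℚ 2 * S * D s + (1ℚ + S) * D (suc s)) ≡ β (suc s) + β (2 ℕ.+ s) - modelPair (suc s)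
    eq = sym (trans (cong (_- modelPair (suc s)) (cong₂ _+_ (trans (β-D s) (cong (λ x → ½ ** s * (1ℚ + x) * (1ℚ - x * (x - 1ℚ) * h + D s)) S-eq)) (β-D (suc s))))
      (lemma (½ ** s) S h (D s) (D (suc s))))
      where
      lemma : ∀ a S h d₁ d₂ → a * (1ℚ + (S - 1ℚ)) * (1ℚ - (S - 1ℚ) * (S - 1ℚ - 1ℚ) * h + d₁) + ½ * a * (1ℚ + S) * (1ℚ - S * (S - 1ℚ) * h + d₂)
          - ½ * a * (ℕtoℚ 3 * S + 1ℚ - ℕtoℚ 3 * h * (S * (S - 1ℚ) * (S - 1ℚ)))
        ≡ ½ * a * (ℕtoℚ 2 * S * d₁ + (1ℚ + S) * d₂)
      lemma = solve-∀ ℚ-ring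
    le : 1ℚ + S ≤ℚ ℕtoℚ 2 * S
    le = ≤-resp refl (lemma S) (ℚP.+-monoˡ-≤ S (ℕtoℚ-mono {1} {suc s} (s≤s z≤n)))
      where
      lemma : ∀ S → S + S ≡ ℕtoℚ 2 * S
      lemma = solve-∀ ℚ-ring
    0≤1+S : 0ℚ ≤ℚ 1ℚ + S
    0≤1+S = 0≤+ 0≤1 0≤S
    fourth-le : fourth (1ℚ + S) ≤ℚ fourth (ℕtoℚ 2 * S)
    fourth-le = *-mono (0≤* (0≤* 0≤1+S 0≤1+S) 0≤1+S) (*-mono (0≤* 0≤1+S 0≤1+S) (*-mono 0≤1+S le 0≤1+S le) 0≤1+S le) 0≤1+S le
    H : ℚ
    H = ℕtoℚ 16 * h * h
    0≤H : 0ℚ ≤ℚ H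
    0≤H = 0≤* (0≤* (0≤ℕtoℚ 16) 0≤h) 0≤h
    -- 34 is `2 + 2 · 2⁴`, from `1 + S` being at most `2S`.
    final : ℕtoℚ 2 * S * (fourth (1ℚ + ℕtoℚ s) * H) + (1ℚ + S) * (fourth (1ℚ + S) * H) ≤ℚ ℕtoℚ 34 * fifth S * H
    final = ≤-resp (cong (λ x → ℕtoℚ 2 * S * (fourth x * H) + (1ℚ + S) * (fourth (1ℚ + S) * H)) (ℕtoℚ-suc s)) (lemma S H)
      (ℚP.+-monoʳ-≤ (ℕtoℚ 2 * S * (fourth S * H)) (*-mono 0≤1+S le (0≤* (0≤* (0≤* (0≤* 0≤1+S 0≤1+S) 0≤1+S) 0≤1+S) 0≤H) (*-monoʳ 0≤H fourth-le)))
      where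
      lemma : ∀ S H → ℕtoℚ 2 * S * (S * S * S * S * H) + ℕtoℚ 2 * S * (ℕtoℚ 2 * S * (ℕtoℚ 2 * S) * (ℕtoℚ 2 * S) * (ℕtoℚ 2 * S) * H)
        ≡ ℕtoℚ 34 * (S * S * S * S * S) * H
      lemma = solve-∀ ℚ-ring
    lemma₄ : ∀ a → a * (ℕtoℚ 34 * fifth S * H) ≡ ℕtoℚ 34 * (fifth S * a) * (y * y)
    lemma₄ a = trans (go a (fifth S) h) (cong (λ x → ℕtoℚ 34 * (fifth S * a) * (x * x)) (sym y≡4h))
      where
      go : ∀ a f h → a * (ℕtoℚ 34 * f * (ℕtoℚ 16 * h * h)) ≡ ℕtoℚ 34 * (f * a) * (ℕtoℚ 4 * h * (ℕtoℚ 4 * h))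
      go = solve-∀ ℚ-ring

-- Closed forms of the terms `a0` and `b1`

ℤtoℚ-pow : ∀ a k → ℤtoℚ (pow a k) ≡ ℤtoℚ a ** k
ℤtoℚ-pow a zero = refl
ℤtoℚ-pow a (suc k) = trans (ℤtoℚ-* a (pow a k)) (cong (ℤtoℚ a *_) (ℤtoℚ-pow a k))

-- The terms `a0` and `b1` with each factor `4ᵏ` paired with one factor `Z`, so that only the
-- polynomials in `R` can be large.
A₀ B₁ : ℚ → ℚ → ℚ → ℚ
A₀ Z X R = ℕtoℚ 4 * X * (ℕtoℚ 3 * R - 1ℚ) * Z + ℕtoℚ 4 * (Z * Z)
B₁ Z X R = ℕtoℚ 6 * (X * X * X * Z) * (ℕtoℚ 2 * (R * R * R) - ℕtoℚ 5 * (R * R) + ℕtoℚ 4 * R - 1ℚ)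
  - ℕtoℚ 6 * (X * X * (Z * Z)) * (ℕtoℚ 16 * (R * R * R) - ℕtoℚ 24 * (R * R) + ℕtoℚ 10 * R - 1ℚ)
  + ℕtoℚ 24 * (X * (Z * Z * Z)) * (ℕtoℚ 2 * R - 1ℚ) * (R * R)

-- Everything is a polynomial in k and Z = 1 / (4ᵏ + 2), since X = 4ᵏ Z = 1 - 2Z.
module Closed (k : ℕ) where

  abstract
    Z X : ℚ
    Z = invN (q4 k)
    X = ℕtoℚ 4 ** k * Z

    X-def : X ≡ ℕtoℚ 4 ** k * Z
    X-def = refl

    q4-inverse : ℕtoℚ (q4 k) * Z ≡ 1ℚ
    q4-inverse = invN-inverse′ (ℕP.≤-trans (s≤s z≤n) (ℕP.m≤n+m 2 (4 ^ k)))

    0≤Z : 0ℚ ≤ℚ Z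
    0≤Z = 0≤invN (q4 k)

    invN-square : invN (q4 k ^ 2) ≡ Z * Z
    invN-square = trans (cong invN (cong (q4 k ℕ.*_) (ℕP.*-identityʳ (q4 k)))) (invN-* pos pos)
      where
      pos : 0 < q4 k
      pos = ℕP.≤-trans (s≤s z≤n) (ℕP.m≤n+m 2 (4 ^ k))

    invN-fourth : invN (q4 k ^ 4) ≡ Z * (Z * (Z * Z))
    invN-fourth = trans (cong invN (cong (λ x → q4 k ℕ.* (q4 k ℕ.* (q4 k ℕ.* x))) (ℕP.*-identityʳ (q4 k))))
      (trans (invN-* pos (pos* pos (pos* pos pos))) (cong (Z *_)
        (trans (invN-* pos (pos* pos pos)) (cong (Z *_) (invN-* pos pos)))))
      where
      pos : 0 < q4 k
      pos = ℕP.≤-trans (s≤s z≤n) (ℕP.m≤n+m 2 (4 ^ k))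
      pos* : ∀ {a b} → 0 < a → 0 < b → 0 < a ℕ.* b
      pos* {suc a} {suc b} _ _ = s≤s z≤n

  X≡1-2Z : X ≡ 1ℚ - ℕtoℚ 2 * Z
  X≡1-2Z = trans X-def (trans (lemma (ℕtoℚ 4 ** k) Z) (cong (_- ℕtoℚ 2 * Z)
    (trans (cong (λ x → x * Z) (sym (trans (ℕtoℚ-+ (4 ^ k) 2) (cong (_+ ℕtoℚ 2) (ℕtoℚ-^ 4 k))))) q4-inverse)))
    where
    lemma : ∀ a Z → a * Z ≡ (a + ℕtoℚ 2) * Z - ℕtoℚ 2 * Z
    lemma = solve-∀ ℚ-ring

  0≤X : 0ℚ ≤ℚ X
  0≤X = ≤-resp refl (sym X-def) (0≤* (0≤** (0≤ℕtoℚ 4) k) 0≤Z)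

  X≤1 : X ≤ℚ 1ℚ
  X≤1 = ≤-by (ℕtoℚ 2 * Z) (0≤* (0≤ℕtoℚ 2) 0≤Z) (trans (cong (_+ ℕtoℚ 2 * Z) X≡1-2Z) (lemma Z))
    where
    lemma : ∀ Z → 1ℚ - ℕtoℚ 2 * Z + ℕtoℚ 2 * Z ≡ 1ℚ
    lemma = solve-∀ ℚ-ring

  R : ℚ
  R = ℕtoℚ k

  a0-closed : a0 k ≡ A₀ Z X R
  a0-closed = begin
    ℤtoℚ (pow (+ 4) (suc k) ℤ.* (+ 3 ℤ.* + k ℤ.- + 1) ℤ.+ + 4) ÷ℕ (q4 k ^ 2)
      ≡⟨ ÷ℕ-invN _ (q4 k ^ 2) ⟩
    ℤtoℚ (pow (+ 4) (suc k) ℤ.* (+ 3 ℤ.* + k ℤ.- + 1) ℤ.+ + 4) * invN (q4 k ^ 2)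
      ≡⟨ cong₂ _*_ cast invN-square ⟩
    (ℕtoℚ 4 * ℕtoℚ 4 ** k * (ℕtoℚ 3 * R - 1ℚ) + ℕtoℚ 4) * (Z * Z)
      ≡⟨ lemma (ℕtoℚ 4 ** k) R Z ⟩
    A₀ Z (ℕtoℚ 4 ** k * Z) R
      ≡⟨ cong (λ x → A₀ Z x R) X-def ⟨
    A₀ Z X R ∎
    where
    open ≡-Reasoning
    cast : ℤtoℚ (pow (+ 4) (suc k) ℤ.* (+ 3 ℤ.* + k ℤ.- + 1) ℤ.+ + 4) ≡ ℕtoℚ 4 * ℕtoℚ 4 ** k * (ℕtoℚ 3 * R - 1ℚ) + ℕtoℚ 4
    cast = trans (ℤtoℚ-+ (pow (+ 4) (suc k) ℤ.* (+ 3 ℤ.* + k ℤ.- + 1)) (+ 4)) (cong (_+ ℕtoℚ 4)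
      (trans (ℤtoℚ-* (pow (+ 4) (suc k)) (+ 3 ℤ.* + k ℤ.- + 1)) (cong₂ _*_ (ℤtoℚ-pow (+ 4) (suc k))
        (trans (ℤtoℚ-- (+ 3 ℤ.* + k) (+ 1)) (cong (_- 1ℚ) (ℤtoℚ-* (+ 3) (+ k)))))))
    lemma : ∀ p R Z → (ℕtoℚ 4 * p * (ℕtoℚ 3 * R - 1ℚ) + ℕtoℚ 4) * (Z * Z)
      ≡ ℕtoℚ 4 * (p * Z) * (ℕtoℚ 3 * R - 1ℚ) * Z + ℕtoℚ 4 * (Z * Z)
    lemma = solve-∀ ℚ-ring

  cube : ∀ p → ℕtoℚ 64 ** p ≡ ℕtoℚ 4 ** p * ℕtoℚ 4 ** p * ℕtoℚ 4 ** p
  cube p = trans (**-* (ℕtoℚ 4 * ℕtoℚ 4) (ℕtoℚ 4) p) (cong (_* ℕtoℚ 4 ** p) (**-* (ℕtoℚ 4) (ℕtoℚ 4) p))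

  pow2 : ∀ a → ℤtoℚ (pow a 2) ≡ ℤtoℚ a * ℤtoℚ a
  pow2 a = trans (ℤtoℚ-pow a 2) (cong (ℤtoℚ a *_) (ℚP.*-identityʳ (ℤtoℚ a)))

  pow3 : ∀ a → ℤtoℚ (pow a 3) ≡ ℤtoℚ a * ℤtoℚ a * ℤtoℚ a
  pow3 a = trans (ℤtoℚ-pow a 3) (lemma (ℤtoℚ a))
    where
    lemma : ∀ a → a * (a * (a * 1ℚ)) ≡ a * a * a
    lemma = solve-∀ ℚ-ring

  b1-closed : b1 k ≡ B₁ Z X R
  b1-closed = begin
    ℤtoℚ num ÷ℕ (q4 k ^ 4)
      ≡⟨ ÷ℕ-invN (ℤtoℚ num) (q4 k ^ 4) ⟩
    ℤtoℚ num * invN (q4 k ^ 4)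
      ≡⟨ cong₂ _*_ cast invN-fourth ⟩
    (ℕtoℚ 6 * (p * p * p) * c₁ R - ℕtoℚ 6 * (p * p) * c₂ R + ℕtoℚ 24 * p * (ℕtoℚ 2 * R - 1ℚ) * (R * R)) * (Z * (Z * (Z * Z)))
      ≡⟨ lemma p (c₁ R) (c₂ R) (ℕtoℚ 2 * R - 1ℚ) (R * R) Z ⟩
    B₁ Z (p * Z) R
      ≡⟨ cong (λ x → B₁ Z x R) X-def ⟨
    B₁ Z X R ∎
    where
    open ≡-Reasoning
    p : ℚ
    p = ℕtoℚ 4 ** k
    c₁ c₂ : ℚ → ℚ
    c₁ R = ℕtoℚ 2 * (R * R * R) - ℕtoℚ 5 * (R * R) + ℕtoℚ 4 * R - 1ℚ
    c₂ R = ℕtoℚ 16 * (R * R * R) - ℕtoℚ 24 * (R * R) + ℕtoℚ 10 * R - 1ℚ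
    n₁ n₂ n₃ num : ℤ
    n₁ = + 2 ℤ.* pow (+ k) 3 ℤ.- + 5 ℤ.* pow (+ k) 2 ℤ.+ + 4 ℤ.* + k ℤ.- + 1
    n₂ = + 16 ℤ.* pow (+ k) 3 ℤ.- + 24 ℤ.* pow (+ k) 2 ℤ.+ + 10 ℤ.* + k ℤ.- + 1
    n₃ = + 2 ℤ.* + k ℤ.- + 1
    num = + 6 ℤ.* pow (+ 64) k ℤ.* n₁ ℤ.- + 6 ℤ.* pow (+ 16) k ℤ.* n₂ ℤ.+ + 24 ℤ.* pow (+ 4) k ℤ.* n₃ ℤ.* pow (+ k) 2
    cubic : ∀ a b c → ℤtoℚ (+ a ℤ.* pow (+ k) 3 ℤ.- + b ℤ.* pow (+ k) 2 ℤ.+ + c ℤ.* + k ℤ.- + 1)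
      ≡ ℕtoℚ a * (R * R * R) - ℕtoℚ b * (R * R) + ℕtoℚ c * R - 1ℚ
    cubic a b c = trans (ℤtoℚ-- (+ a ℤ.* pow (+ k) 3 ℤ.- + b ℤ.* pow (+ k) 2 ℤ.+ + c ℤ.* + k) (+ 1)) (cong (_- 1ℚ)
      (trans (ℤtoℚ-+ (+ a ℤ.* pow (+ k) 3 ℤ.- + b ℤ.* pow (+ k) 2) (+ c ℤ.* + k)) (cong₂ _+_
        (trans (ℤtoℚ-- (+ a ℤ.* pow (+ k) 3) (+ b ℤ.* pow (+ k) 2)) (cong₂ _-_
          (trans (ℤtoℚ-* (+ a) (pow (+ k) 3)) (cong (ℕtoℚ a *_) (pow3 (+ k))))
          (trans (ℤtoℚ-* (+ b) (pow (+ k) 2)) (cong (ℕtoℚ b *_) (pow2 (+ k))))))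
        (ℤtoℚ-* (+ c) (+ k)))))
    term : ∀ a b c q → ℤtoℚ b ≡ q → ℤtoℚ (+ a ℤ.* b ℤ.* c) ≡ ℕtoℚ a * q * ℤtoℚ c
    term a b c q e = trans (ℤtoℚ-* (+ a ℤ.* b) c) (cong (_* ℤtoℚ c) (trans (ℤtoℚ-* (+ a) b) (cong (ℕtoℚ a *_) e)))
    cast : ℤtoℚ num ≡ ℕtoℚ 6 * (p * p * p) * c₁ R - ℕtoℚ 6 * (p * p) * c₂ R + ℕtoℚ 24 * p * (ℕtoℚ 2 * R - 1ℚ) * (R * R)
    cast = trans (ℤtoℚ-+ (+ 6 ℤ.* pow (+ 64) k ℤ.* n₁ ℤ.- + 6 ℤ.* pow (+ 16) k ℤ.* n₂) (+ 24 ℤ.* pow (+ 4) k ℤ.* n₃ ℤ.* pow (+ k) 2)) (cong₂ _+_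
      (trans (ℤtoℚ-- (+ 6 ℤ.* pow (+ 64) k ℤ.* n₁) (+ 6 ℤ.* pow (+ 16) k ℤ.* n₂)) (cong₂ _-_
        (trans (term 6 (pow (+ 64) k) n₁ (p * p * p) (trans (ℤtoℚ-pow (+ 64) k) (cube k))) (cong (ℕtoℚ 6 * (p * p * p) *_) (cubic 2 5 4)))
        (trans (term 6 (pow (+ 16) k) n₂ (p * p) (trans (ℤtoℚ-pow (+ 16) k) (**-* (ℕtoℚ 4) (ℕtoℚ 4) k))) (cong (ℕtoℚ 6 * (p * p) *_) (cubic 16 24 10)))))
      (trans (ℤtoℚ-* (+ 24 ℤ.* pow (+ 4) k ℤ.* n₃) (pow (+ k) 2)) (cong₂ _*_
        (trans (term 24 (pow (+ 4) k) n₃ p (ℤtoℚ-pow (+ 4) k)) (cong (ℕtoℚ 24 * p *_)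
          (trans (ℤtoℚ-- (+ 2 ℤ.* + k) (+ 1)) (cong (_- 1ℚ) (ℤtoℚ-* (+ 2) (+ k))))))
        (pow2 (+ k)))))
    lemma : ∀ p c₁ c₂ c₃ c₄ Z → (ℕtoℚ 6 * (p * p * p) * c₁ - ℕtoℚ 6 * (p * p) * c₂ + ℕtoℚ 24 * p * c₃ * c₄) * (Z * (Z * (Z * Z)))
      ≡ ℕtoℚ 6 * (p * Z * (p * Z) * (p * Z) * Z) * c₁ - ℕtoℚ 6 * (p * Z * (p * Z) * (Z * Z)) * c₂ + ℕtoℚ 24 * (p * Z * (Z * Z * Z)) * c₃ * c₄
    lemma = solve-∀ ℚ-ring

-- The alternating sum of the models

0≤4/7 : 0ℚ ≤ℚ 4/7
0≤4/7 = from-yes (0ℚ ℚP.≤? 4/7)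

0≤horner : ∀ {a c₀ c₁ c₂ c₃} → 0ℚ ≤ℚ a → 0ℚ ≤ℚ c₀ → 0ℚ ≤ℚ c₁ → 0ℚ ≤ℚ c₂ → 0ℚ ≤ℚ c₃ → 0ℚ ≤ℚ c₀ + a * (c₁ + a * (c₂ + a * c₃))
0≤horner p q₀ q₁ q₂ q₃ = 0≤+ q₀ (0≤* p (0≤+ q₁ (0≤* p (0≤+ q₂ (0≤* p q₃)))))

ℕtoℚ-double : ∀ r → ℕtoℚ (double r) ≡ ℕtoℚ r + ℕtoℚ r
ℕtoℚ-double zero = refl
ℕtoℚ-double (suc r) = trans (ℕtoℚ-+ 2 (double r)) (trans (cong (λ x → ℕtoℚ 2 + x) (ℕtoℚ-double r))
  (trans (lemma (ℕtoℚ r)) (cong (λ x → x + x) (sym (ℕtoℚ-suc r)))))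
  where
  lemma : ∀ r → ℕtoℚ 2 + (r + r) ≡ (1ℚ + r) + (1ℚ + r)
  lemma = solve-∀ ℚ-ring

-- With `x = 2⁻ᵈ` and `k = r + 1` this is `x · 4ᵏ = 2`. It turns the ratio `x / (1 + x)` of the
-- alternating sum into `2 / (4ᵏ + 2)`, the origin of the denominators in the theorem.
½-4 : ∀ r → ½ ** suc (double r) * ℕtoℚ 4 ** suc r ≡ ℕtoℚ 2
½-4 zero = refl
½-4 (suc r) = trans (lemma (½ ** suc (double r)) (ℕtoℚ 4 ** suc r)) (½-4 r)
  where
  lemma : ∀ a b → ½ * (½ * a) * (ℕtoℚ 4 * b) ≡ a * b
  lemma = solve-∀ ℚ-ring

-- e₁, e₂, e₃ solve (1 - q) eᵢ(J) + q eᵢ(J + 1) = Jⁱ; bracket is the resulting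
-- closed form of the alternating sum of the models, up to a factor x^J (1 - q).
e₁ e₂ e₃ : ℚ → ℚ → ℚ
e₁ q J = J - q
e₂ q J = J * J - ℕtoℚ 2 * q * J - q * (1ℚ - q - q)
e₃ q J = J * J * J - ℕtoℚ 3 * q * (J * J) - ℕtoℚ 3 * q * (1ℚ - q - q) * J
       - q * ((1ℚ - q) * (1ℚ - q) - ℕtoℚ 4 * (1ℚ - q) * q + q * q)

bracket : ℚ → ℚ → ℚ → ℚ → ℚ
bracket q d h J = ℕtoℚ 3 * d * e₁ q J + 1ℚ - ℕtoℚ 3 * h * (d * d * d * e₃ q J - ℕtoℚ 2 * d * d * e₂ q J + d * e₁ q J)

-- The right side is `modelPair` at `s = J d` without its power of ½; the expansion
-- `s (s - 1)² = s³ - 2s² + s` explains the combination of `e₃`, `e₂`, `e₁`.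
bracket-step : ∀ q d h J → (1ℚ - q) * bracket q d h J + q * bracket q d h (1ℚ + J)
  ≡ ℕtoℚ 3 * (J * d) + 1ℚ - ℕtoℚ 3 * h * (J * d * (J * d - 1ℚ) * (J * d - 1ℚ))
bracket-step q d h J = lemma q d h J
  where
  lemma : ∀ q d h J →
      (1ℚ - q) * (ℕtoℚ 3 * d * (J - q) + 1ℚ - ℕtoℚ 3 * h * (d * d * d *
        (J * J * J - ℕtoℚ 3 * q * (J * J) - ℕtoℚ 3 * q * (1ℚ - q - q) * J - q * ((1ℚ - q) * (1ℚ - q) - ℕtoℚ 4 * (1ℚ - q) * q + q * q))
        - ℕtoℚ 2 * d * d * (J * J - ℕtoℚ 2 * q * J - q * (1ℚ - q - q)) + d * (J - q)))
    + q * (ℕtoℚ 3 * d * (1ℚ + J - q) + 1ℚ - ℕtoℚ 3 * h * (d * d * d *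
        ((1ℚ + J) * (1ℚ + J) * (1ℚ + J) - ℕtoℚ 3 * q * ((1ℚ + J) * (1ℚ + J)) - ℕtoℚ 3 * q * (1ℚ - q - q) * (1ℚ + J) - q * ((1ℚ - q) * (1ℚ - q) - ℕtoℚ 4 * (1ℚ - q) * q + q * q))
        - ℕtoℚ 2 * d * d * ((1ℚ + J) * (1ℚ + J) - ℕtoℚ 2 * q * (1ℚ + J) - q * (1ℚ - q - q)) + d * (1ℚ + J - q)))
    ≡ ℕtoℚ 3 * (J * d) + 1ℚ - ℕtoℚ 3 * h * (J * d * (J * d - 1ℚ) * (J * d - 1ℚ))
  lemma = solve-∀ ℚ-ring

-- At `J = 1`, `q = 2Z`, `d = 2R - 1` the closed form becomes the main term of the tail probability;
-- `4h` stands for `1/n`.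
bracket-one : ∀ Z R h → ℕtoℚ 2 * Z * bracket (ℕtoℚ 2 * Z) (R + R - 1ℚ) h 1ℚ
  ≡ A₀ Z (1ℚ - ℕtoℚ 2 * Z) R - B₁ Z (1ℚ - ℕtoℚ 2 * Z) R * (ℕtoℚ 4 * h)
bracket-one Z R h = lemma Z R h
  where
  lemma : ∀ Z R h →
    ℕtoℚ 2 * Z * (ℕtoℚ 3 * (R + R - 1ℚ) * (1ℚ - ℕtoℚ 2 * Z) + 1ℚ - ℕtoℚ 3 * h * ((R + R - 1ℚ) * (R + R - 1ℚ) * (R + R - 1ℚ) *
        (1ℚ * 1ℚ * 1ℚ - ℕtoℚ 3 * (ℕtoℚ 2 * Z) * (1ℚ * 1ℚ) - ℕtoℚ 3 * (ℕtoℚ 2 * Z) * (1ℚ - ℕtoℚ 2 * Z - ℕtoℚ 2 * Z) * 1ℚ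
          - ℕtoℚ 2 * Z * ((1ℚ - ℕtoℚ 2 * Z) * (1ℚ - ℕtoℚ 2 * Z) - ℕtoℚ 4 * (1ℚ - ℕtoℚ 2 * Z) * (ℕtoℚ 2 * Z) + ℕtoℚ 2 * Z * (ℕtoℚ 2 * Z)))
        - ℕtoℚ 2 * (R + R - 1ℚ) * (R + R - 1ℚ) * (1ℚ * 1ℚ - ℕtoℚ 2 * (ℕtoℚ 2 * Z) * 1ℚ - ℕtoℚ 2 * Z * (1ℚ - ℕtoℚ 2 * Z - ℕtoℚ 2 * Z))
        + (R + R - 1ℚ) * (1ℚ - ℕtoℚ 2 * Z)))
    ≡ ℕtoℚ 4 * (1ℚ - ℕtoℚ 2 * Z) * (ℕtoℚ 3 * R - 1ℚ) * Z + ℕtoℚ 4 * (Z * Z)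
      - (ℕtoℚ 6 * ((1ℚ - ℕtoℚ 2 * Z) * (1ℚ - ℕtoℚ 2 * Z) * (1ℚ - ℕtoℚ 2 * Z) * Z) * (ℕtoℚ 2 * (R * R * R) - ℕtoℚ 5 * (R * R) + ℕtoℚ 4 * R - 1ℚ)
        - ℕtoℚ 6 * ((1ℚ - ℕtoℚ 2 * Z) * (1ℚ - ℕtoℚ 2 * Z) * (Z * Z)) * (ℕtoℚ 16 * (R * R * R) - ℕtoℚ 24 * (R * R) + ℕtoℚ 10 * R - 1ℚ)
        + ℕtoℚ 24 * ((1ℚ - ℕtoℚ 2 * Z) * (Z * Z * Z)) * (ℕtoℚ 2 * R - 1ℚ) * (R * R)) * (ℕtoℚ 4 * h)
  lemma = solve-∀ ℚ-ring

-- A crude cubic bound for the place where the recursion is cut off. 91 is the value of the majorant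
-- at `J = D = 1`, and the slack has nonnegative coefficients in `J - 1` and `D - 1`.
bracket-bound : ∀ {q h} d j → 0ℚ ≤ℚ q → q ≤ℚ 1ℚ → 0ℚ ≤ℚ h → h ≤ℚ 1ℚ →
  let J = ℕtoℚ (suc j) ; D = ℕtoℚ (suc d) in bracket q D h J ≲ ℕtoℚ 91 * (J * D * (J * D) * (J * D))
bracket-bound {q} {h} d j 0≤q q≤1 0≤h h≤1 = ≲-weaken
  (≲-- (≲-+ (≲-* (≲-* (three) D≲) e₁≲) (≲-self 0≤1))
       (≲-* (≲-* three h≲) (≲-+ (≲-- (≲-* (≲-* (≲-* D≲ D≲) D≲) e₃≲) (≲-* (≲-* (≲-* two D≲) D≲) e₂≲)) (≲-* D≲ e₁≲))))
  (≤-by (bSlack (ℕtoℚ d) (ℕtoℚ j))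
    (0≤horner (0≤ℕtoℚ j)
      (0≤horner (0≤ℕtoℚ d) (0≤ℕtoℚ 0) (0≤ℕtoℚ 57) (0≤ℕtoℚ 99) (0≤ℕtoℚ 43))
      (0≤horner (0≤ℕtoℚ d) (0≤ℕtoℚ 198) (0≤ℕtoℚ 630) (0≤ℕtoℚ 660) (0≤ℕtoℚ 228))
      (0≤horner (0≤ℕtoℚ d) (0≤ℕtoℚ 249) (0≤ℕtoℚ 753) (0≤ℕtoℚ 759) (0≤ℕtoℚ 255))
      (0≤horner (0≤ℕtoℚ d) (0≤ℕtoℚ 88) (0≤ℕtoℚ 264) (0≤ℕtoℚ 264) (0≤ℕtoℚ 88)))
    slack-eq)
  where
  J D : ℚ
  J = ℕtoℚ (suc j)
  D = ℕtoℚ (suc d)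
  bSlack : ℚ → ℚ → ℚ
  bSlack d j = (ℕtoℚ 0 + d * (ℕtoℚ 57 + d * (ℕtoℚ 99 + d * ℕtoℚ 43))) + j * ((ℕtoℚ 198 + d * (ℕtoℚ 630 + d * (ℕtoℚ 660 + d * ℕtoℚ 228)))
          + j * ((ℕtoℚ 249 + d * (ℕtoℚ 753 + d * (ℕtoℚ 759 + d * ℕtoℚ 255)))
          + j * (ℕtoℚ 88 + d * (ℕtoℚ 264 + d * (ℕtoℚ 264 + d * ℕtoℚ 88)))))
  two : ℕtoℚ 2 ≲ ℕtoℚ 2
  two = ≲-self (0≤ℕtoℚ 2)
  three : ℕtoℚ 3 ≲ ℕtoℚ 3
  three = ≲-self (0≤ℕtoℚ 3)
  q≲ : q ≲ 1ℚ
  q≲ = ≲-nonneg 0≤q q≤1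
  h≲ : h ≲ 1ℚ
  h≲ = ≲-nonneg 0≤h h≤1
  J≲ : J ≲ J
  J≲ = ≲-self (0≤ℕtoℚ (suc j))
  D≲ : D ≲ D
  D≲ = ≲-self (0≤ℕtoℚ (suc d))
  x≲ : 1ℚ - q ≲ 1ℚ
  x≲ = ≲-nonneg (0≤-diff q≤1) (≤-by q 0≤q (lemma q))
    where
    lemma : ∀ q → 1ℚ - q + q ≡ 1ℚ
    lemma = solve-∀ ℚ-ring
  e₁≲ : e₁ q J ≲ J + 1ℚ
  e₁≲ = ≲-- J≲ q≲
  e₂≲ : e₂ q J ≲ J * J + ℕtoℚ 2 * 1ℚ * J + 1ℚ * (1ℚ + 1ℚ)
  e₂≲ = ≲-- (≲-- (≲-* J≲ J≲) (≲-* (≲-* two q≲) J≲)) (≲-* q≲ (≲-- x≲ q≲))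
  e₃≲ : e₃ q J ≲ J * J * J + ℕtoℚ 3 * 1ℚ * (J * J) + ℕtoℚ 3 * 1ℚ * (1ℚ + 1ℚ) * J + 1ℚ * (1ℚ * 1ℚ + ℕtoℚ 4 * 1ℚ * 1ℚ + 1ℚ * 1ℚ)
  e₃≲ = ≲-- (≲-- (≲-- (≲-* (≲-* J≲ J≲) J≲) (≲-* (≲-* three q≲) (≲-* J≲ J≲))) (≲-* (≲-* (≲-* three q≲) (≲-- x≲ q≲)) J≲))
    (≲-* q≲ (≲-+ (≲-- (≲-* x≲ x≲) (≲-* (≲-* (≲-self (0≤ℕtoℚ 4)) x≲) q≲)) (≲-* q≲ q≲)))
  slack-eq : ℕtoℚ 3 * D * (J + 1ℚ) + 1ℚ + ℕtoℚ 3 * 1ℚ * (D * D * D *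
      (J * J * J + ℕtoℚ 3 * 1ℚ * (J * J) + ℕtoℚ 3 * 1ℚ * (1ℚ + 1ℚ) * J + 1ℚ * (1ℚ * 1ℚ + ℕtoℚ 4 * 1ℚ * 1ℚ + 1ℚ * 1ℚ))
      + ℕtoℚ 2 * D * D * (J * J + ℕtoℚ 2 * 1ℚ * J + 1ℚ * (1ℚ + 1ℚ)) + D * (J + 1ℚ)) + bSlack (ℕtoℚ d) (ℕtoℚ j)
    ≡ ℕtoℚ 91 * (J * D * (J * D) * (J * D))
  slack-eq = subst₂ (λ J D → ℕtoℚ 3 * D * (J + 1ℚ) + 1ℚ + ℕtoℚ 3 * 1ℚ * (D * D * D *
      (J * J * J + ℕtoℚ 3 * 1ℚ * (J * J) + ℕtoℚ 3 * 1ℚ * (1ℚ + 1ℚ) * J + 1ℚ * (1ℚ * 1ℚ + ℕtoℚ 4 * 1ℚ * 1ℚ + 1ℚ * 1ℚ))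
      + ℕtoℚ 2 * D * D * (J * J + ℕtoℚ 2 * 1ℚ * J + 1ℚ * (1ℚ + 1ℚ)) + D * (J + 1ℚ)) + bSlack (ℕtoℚ d) (ℕtoℚ j)
    ≡ ℕtoℚ 91 * (J * D * (J * D) * (J * D))) (sym (ℕtoℚ-suc j)) (sym (ℕtoℚ-suc d)) (lemma (ℕtoℚ d) (ℕtoℚ j))
    where
    lemma : ∀ d j → ℕtoℚ 3 * (1ℚ + d) * (1ℚ + j + 1ℚ) + 1ℚ + ℕtoℚ 3 * 1ℚ * ((1ℚ + d) * (1ℚ + d) * (1ℚ + d) *
        ((1ℚ + j) * (1ℚ + j) * (1ℚ + j) + ℕtoℚ 3 * 1ℚ * ((1ℚ + j) * (1ℚ + j)) + ℕtoℚ 3 * 1ℚ * (1ℚ + 1ℚ) * (1ℚ + j) + 1ℚ * (1ℚ * 1ℚ + ℕtoℚ 4 * 1ℚ * 1ℚ + 1ℚ * 1ℚ))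
        + ℕtoℚ 2 * (1ℚ + d) * (1ℚ + d) * ((1ℚ + j) * (1ℚ + j) + ℕtoℚ 2 * 1ℚ * (1ℚ + j) + 1ℚ * (1ℚ + 1ℚ)) + (1ℚ + d) * (1ℚ + j + 1ℚ))
        + ((ℕtoℚ 0 + d * (ℕtoℚ 57 + d * (ℕtoℚ 99 + d * ℕtoℚ 43))) + j * ((ℕtoℚ 198 + d * (ℕtoℚ 630 + d * (ℕtoℚ 660 + d * ℕtoℚ 228)))
          + j * ((ℕtoℚ 249 + d * (ℕtoℚ 753 + d * (ℕtoℚ 759 + d * ℕtoℚ 255)))
          + j * (ℕtoℚ 88 + d * (ℕtoℚ 264 + d * (ℕtoℚ 264 + d * ℕtoℚ 88))))))
      ≡ ℕtoℚ 91 * ((1ℚ + j) * (1ℚ + d) * ((1ℚ + j) * (1ℚ + d)) * ((1ℚ + j) * (1ℚ + d)))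
    lemma = solve-∀ ℚ-ring

-- Error propagation and the tail probabilities

errorConstant : ℚ
errorConstant = ℕtoℚ 3 * (ℕtoℚ 91 * ℕtoℚ (40 ^ 5))

⅓ : ℚ
⅓ = invN 3

module Limit (ν r : ℕ) where

  open Row ν
  open Closed (suc r)

  d : ℕ
  d = suc (double r)

  abstract
    q : ℚ
    q = ℕtoℚ 2 * Z

    q-def : q ≡ ℕtoℚ 2 * Z
    q-def = refl

  0≤q : 0ℚ ≤ℚ q
  0≤q = ≤-resp refl (sym q-def) (0≤* (0≤ℕtoℚ 2) 0≤Z)

  X≡1-q : X ≡ 1ℚ - q
  X≡1-q = trans X≡1-2Z (cong (λ x → 1ℚ - x) (sym q-def))

  q≤1 : q ≤ℚ 1ℚ
  q≤1 = ≤-by X 0≤X (trans (cong (λ x → q + x) X≡1-q) (lemma q))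
    where
    lemma : ∀ q → q + (1ℚ - q) ≡ 1ℚ
    lemma = solve-∀ ℚ-ring

  x[1-q]≡q : ½ ** d * (1ℚ - q) ≡ q
  x[1-q]≡q = trans (cong (½ ** d *_) (trans (sym X≡1-q) X-def))
    (trans (sym (ℚP.*-assoc (½ ** d) (ℕtoℚ 4 ** suc r) Z)) (trans (cong (_* Z) (½-4 r)) (sym q-def)))

  b : ℕ → ℚ
  b j = bracket q (ℕtoℚ d) h (ℕtoℚ (suc j))

  -- The counterpart of `Ψ̂` for the models. Since `x (1 - q) = q` for `x = 2⁻ᵈ`, the step from `j`
  -- to `j + 1` brings in exactly the weight `q` that `bracket-step` expects.
  Φ : ℕ → ℚ
  Φ j = ½ ** (suc j ℕ.* d) * ((1ℚ - q) * b j)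

  Φ-step : ∀ j → Φ j + Φ (suc j) ≡ modelPair (suc j ℕ.* d)
  Φ-step j = begin
    p * ((1ℚ - q) * b j) + ½ ** (d ℕ.+ s) * ((1ℚ - q) * b (suc j))
      ≡⟨ cong (λ x → p * ((1ℚ - q) * b j) + x * ((1ℚ - q) * b (suc j))) (**-+ ½ d s) ⟩
    p * ((1ℚ - q) * b j) + ½ ** d * p * ((1ℚ - q) * b (suc j))
      ≡⟨ lemma₁ p (1ℚ - q) (½ ** d) (b j) (b (suc j)) ⟩
    p * ((1ℚ - q) * b j + ½ ** d * (1ℚ - q) * b (suc j))
      ≡⟨ cong₂ (λ x x′ → p * ((1ℚ - q) * b j + x * bracket q (ℕtoℚ d) h x′)) x[1-q]≡q (ℕtoℚ-suc (suc j)) ⟩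
    p * ((1ℚ - q) * b j + q * bracket q (ℕtoℚ d) h (1ℚ + ℕtoℚ (suc j)))
      ≡⟨ cong (p *_) (bracket-step q (ℕtoℚ d) h (ℕtoℚ (suc j))) ⟩
    p * (ℕtoℚ 3 * S + 1ℚ - ℕtoℚ 3 * h * (S * (S - 1ℚ) * (S - 1ℚ)))
      ≡⟨ cong (λ S → p * (ℕtoℚ 3 * S + 1ℚ - ℕtoℚ 3 * h * (S * (S - 1ℚ) * (S - 1ℚ)))) (ℕtoℚ-* (suc j) d) ⟨
    modelPair s ∎
    where
    open ≡-Reasoning
    s : ℕ
    s = suc j ℕ.* d
    S p : ℚ
    S = ℕtoℚ (suc j) * ℕtoℚ d
    p = ½ ** s
    lemma₁ : ∀ p x′ x b b′ → p * (x′ * b) + x * p * (x′ * b′) ≡ p * (x′ * b + x * x′ * b′)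
    lemma₁ = solve-∀ ℚ-ring

  Ψ̂ : ℕ → ℚ
  Ψ̂ j = ℕtoℚ (Ψ r m j) * invN c

  Ψ̂-step : ∀ j → Ψ̂ j + Ψ̂ (suc j) ≡ β (suc j ℕ.* d) + β (suc (suc j ℕ.* d))
  Ψ̂-step j = trans (sym (distrib (Ψ r m j) (Ψ r m (suc j)))) (trans (cong (λ x → ℕtoℚ x * invN c) (Ψ-step r m j))
    (distrib (ballot m (suc j ℕ.* d)) (ballot m (suc (suc j ℕ.* d)))))
    where
    distrib : ∀ a b → ℕtoℚ (a ℕ.+ b) * invN c ≡ ℕtoℚ a * invN c + ℕtoℚ b * invN c
    distrib a b = trans (cong (_* invN c) (ℕtoℚ-+ a b)) (ℚP.*-distribʳ-+ (invN c) (ℕtoℚ a) (ℕtoℚ b))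

  Δ : ℕ → ℚ
  Δ j = Ψ̂ j - Φ j

  Δ-step : ∀ j → (β (suc j ℕ.* d) + β (suc (suc j ℕ.* d)) - modelPair (suc j ℕ.* d)) - Δ (suc j) ≡ Δ j
  Δ-step j = trans (cong (λ x → x - Δ (suc j)) (cong₂ _-_ (sym (Ψ̂-step j)) (sym (Φ-step j))))
    (lemma (Ψ̂ j) (Ψ̂ (suc j)) (Φ j) (Φ (suc j)))
    where
    lemma : ∀ a a′ b b′ → (a + a′ - (b + b′)) - (a′ - b′) ≡ a - b
    lemma = solve-∀ ℚ-ring

  K₀ : ℚ
  K₀ = ℕtoℚ 91 * ℕtoℚ (40 ^ 5)

  0≤yy : 0ℚ ≤ℚ y * y
  0≤yy = 0≤* 0≤y 0≤y

  decay : ∀ s → ℕtoℚ 91 * (fifth (ℕtoℚ s) * ½ ** s) * (y * y) ≤ℚ K₀ * 4/7 ** s * (y * y)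
  decay s = *-monoʳ 0≤yy (ℚP.≤-trans (*-monoˡ (0≤ℕtoℚ 91) (fifth-decay s))
    (ℚP.≤-reflexive (sym (ℚP.*-assoc (ℕtoℚ 91) (ℕtoℚ (40 ^ 5)) (4/7 ** s)))))

  ε-bound : ∀ j → let s = suc j ℕ.* d in β s + β (suc s) - modelPair s ≲ K₀ * 4/7 ** s * (y * y)
  ε-bound j = ≲-weaken (pair-error (double r ℕ.+ j ℕ.* d)) (ℚP.≤-trans
    -- 34 is raised to 91 so that local errors and the cut-off share the constant `K₀`.
    (*-monoʳ 0≤yy (*-monoʳ (0≤* 0≤fifth (0≤** 0≤½ (suc j ℕ.* d))) (ℕtoℚ-mono {34} {91} (ℕP.m≤m+n 34 57))))
    (decay (suc j ℕ.* d)))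
    where
    S : ℚ
    S = ℕtoℚ (suc j ℕ.* d)
    0≤S : 0ℚ ≤ℚ S
    0≤S = 0≤ℕtoℚ (suc j ℕ.* d)
    0≤fifth : 0ℚ ≤ℚ fifth S
    0≤fifth = 0≤* (0≤* (0≤* (0≤* 0≤S 0≤S) 0≤S) 0≤S) 0≤S

  -- s ≥ n, so s³ ≤ s⁵ y².
  Φ-bound : ∀ j → n ≤ suc j → Φ j ≲ K₀ * 4/7 ** (suc j ℕ.* d) * (y * y)
  Φ-bound j le = ≲-weaken
    (≲-* (≲-self (0≤** 0≤½ s)) (≲-* (≲-nonneg (≤-resp refl X≡1-q 0≤X) (≤-resp X≡1-q refl X≤1)) (bracket-bound (double r) j 0≤q q≤1 0≤h h≤1)))
    (ℚP.≤-trans (≤-resp (cong (λ S → ½ ** s * (1ℚ * (ℕtoℚ 91 * (S * S * S)))) (ℕtoℚ-* (suc j) d)) refl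
       (≤-resp (lemma₁ (½ ** s) (ℕtoℚ s)) (lemma₂ (½ ** s) (ℕtoℚ s)) (*-monoˡ (0≤* (0≤* (0≤ℕtoℚ 91) (0≤** 0≤½ s)) (0≤* (0≤* 0≤S 0≤S) 0≤S)) large)))
     (decay s))
    where
    s : ℕ
    s = suc j ℕ.* d
    0≤S : 0ℚ ≤ℚ ℕtoℚ s
    0≤S = 0≤ℕtoℚ s
    large : 1ℚ ≤ℚ ℕtoℚ s * ℕtoℚ s * (ℕtoℚ 16 * h * h)
    large = square-large s (ℕP.≤-trans le (ℕP.m≤m*n (suc j) d))
    lemma₁ : ∀ p S → ℕtoℚ 91 * p * (S * S * S) * 1ℚ ≡ p * (1ℚ * (ℕtoℚ 91 * (S * S * S)))
    lemma₁ = solve-∀ ℚ-ring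
    lemma₂ : ∀ p S → ℕtoℚ 91 * p * (S * S * S) * (S * S * (ℕtoℚ 16 * h * h)) ≡ ℕtoℚ 91 * (fifth S * p) * (y * y)
    lemma₂ p S = trans (go p S h) (cong (λ y → ℕtoℚ 91 * (fifth S * p) * (y * y)) (sym y≡4h))
      where
      go : ∀ p S h → ℕtoℚ 91 * p * (S * S * S) * (S * S * (ℕtoℚ 16 * h * h)) ≡ ℕtoℚ 91 * (S * S * S * S * S * p) * (ℕtoℚ 4 * h * (ℕtoℚ 4 * h))
      go = solve-∀ ℚ-ring

  0≤K₀ : 0ℚ ≤ℚ K₀
  0≤K₀ = 0≤* (0≤ℕtoℚ 91) (0≤ℕtoℚ (40 ^ 5))

  -- Backward induction from `j` at least `n`, where `Ψ̂` vanishes and only `Φ` remains. The factor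
  -- 3 in `errorConstant` solves `K + 2/3 · 3K = 3K`, as one step gains `(4/7)ᵈ`, which is at most
  -- 2/3.
  Δ-bound : ∀ fuel j → n ≤ j ℕ.+ fuel → Δ j ≲ errorConstant * 4/7 ** (suc j ℕ.* d) * (y * y)
  Δ-bound zero j le = ≲-weaken
      (≲-resp (trans (lemma (Φ j)) (cong (_- Φ j) (sym vanish))) (≲-neg (Φ-bound j (ℕP.≤-trans le′ (ℕP.n≤1+n j)))))
      (*-monoʳ 0≤yy (*-monoʳ (0≤** 0≤4/7 (suc j ℕ.* d)) (≤-resp (ℚP.*-identityˡ K₀) refl (*-monoʳ 0≤K₀ (ℕtoℚ-mono {1} {3} (s≤s z≤n))))))
    where
    le′ : n ≤ j
    le′ = subst (n ≤_) (ℕP.+-identityʳ j) le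
    vanish : Ψ̂ j ≡ 0ℚ
    vanish = trans (cong (λ x → ℕtoℚ x * invN c) (Ψ-vanish r m j le′)) (ℚP.*-zeroˡ (invN c))
    lemma : ∀ a → - a ≡ 0ℚ - a
    lemma = solve-∀ ℚ-ring
  Δ-bound (suc fuel) j le = ≲-weaken
      (≲-resp (Δ-step j) (≲-- (ε-bound j) (Δ-bound fuel (suc j) (subst (n ≤_) (ℕP.+-suc j fuel) le))))
      (≤-resp (lemma₁ K₀ g (4/7 ** (d ℕ.+ s)) (y * y)) (lemma₂ K₀ g (y * y)) (*-monoʳ 0≤yy (ℚP.+-monoʳ-≤ (K₀ * g) (*-monoˡ (0≤* (0≤ℕtoℚ 3) 0≤K₀) next))))
    where
    s : ℕ
    s = suc j ℕ.* d
    g : ℚ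
    g = 4/7 ** s
    0≤g : 0ℚ ≤ℚ g
    0≤g = 0≤** 0≤4/7 s
    next : 4/7 ** (d ℕ.+ s) ≤ℚ ℕtoℚ 2 * ⅓ * g
    next = ≤-resp (sym (**-+ 4/7 d s)) refl (*-monoʳ 0≤g
      (≤-resp refl (ℚP.*-identityʳ (ℕtoℚ 2 * ⅓)) (*-mono 0≤4/7 (from-yes (4/7 ℚP.≤? ℕtoℚ 2 * ⅓)) (0≤** 0≤4/7 (double r)) (**-≤1 0≤4/7 (from-yes (4/7 ℚP.≤? 1ℚ)) (double r)))))
    lemma₁ : ∀ K g g′ y → (K * g + ℕtoℚ 3 * K * g′) * y ≡ K * g * y + ℕtoℚ 3 * K * g′ * y
    lemma₁ = solve-∀ ℚ-ring
    lemma₂ : ∀ K g y → (K * g + ℕtoℚ 3 * K * (ℕtoℚ 2 * ⅓ * g)) * y ≡ ℕtoℚ 3 * K * g * y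
    lemma₂ = solve-∀ ℚ-ring

  older-limit : ℕtoℚ (older r m) * invN c - (a0 (suc r) - b1 (suc r) * y) ≲ errorConstant * 4/7 ** d * (y * y)
  older-limit = ≲-resp (cong₂ _-_ (cong (λ x → ℕtoℚ x * invN c) (Ψ-zero r m)) Φ-zero)
    (subst (λ s → Δ 0 ≲ errorConstant * 4/7 ** s * (y * y)) (ℕP.+-identityʳ d) (Δ-bound n 0 ℕP.≤-refl))
    where
    open ≡-Reasoning
    d-eq : ℕtoℚ d ≡ R + R - 1ℚ
    d-eq = trans (ℕtoℚ-suc (double r)) (trans (cong (λ x → 1ℚ + x) (ℕtoℚ-double r))
      (trans (lemma (ℕtoℚ r)) (cong (λ x → x + x - 1ℚ) (sym (ℕtoℚ-suc r)))))
      where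
      lemma : ∀ r → 1ℚ + (r + r) ≡ (1ℚ + r) + (1ℚ + r) - 1ℚ
      lemma = solve-∀ ℚ-ring
    Φ-zero : Φ 0 ≡ a0 (suc r) - b1 (suc r) * y
    Φ-zero = begin
      ½ ** (d ℕ.+ 0) * ((1ℚ - q) * b 0)    ≡⟨ cong (λ s → ½ ** s * ((1ℚ - q) * b 0)) (ℕP.+-identityʳ d) ⟩
      ½ ** d * ((1ℚ - q) * b 0)            ≡⟨ ℚP.*-assoc (½ ** d) (1ℚ - q) (b 0) ⟨
      ½ ** d * (1ℚ - q) * b 0              ≡⟨ cong (_* b 0) x[1-q]≡q ⟩
      q * bracket q (ℕtoℚ d) h 1ℚ          ≡⟨ cong₂ (λ q d → q * bracket q d h 1ℚ) q-def d-eq ⟩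
      ℕtoℚ 2 * Z * bracket (ℕtoℚ 2 * Z) (R + R - 1ℚ) h 1ℚ ≡⟨ bracket-one Z R h ⟩
      A₀ Z (1ℚ - ℕtoℚ 2 * Z) R - B₁ Z (1ℚ - ℕtoℚ 2 * Z) R * (ℕtoℚ 4 * h)
        ≡⟨ cong₂ (λ X y → A₀ Z X R - B₁ Z X R * y) (sym X≡1-2Z) (sym y≡4h) ⟩
      A₀ Z X R - B₁ Z X R * y              ≡⟨ cong₂ (λ a b → a - b * y) a0-closed b1-closed ⟨
      a0 (suc r) - b1 (suc r) * y ∎

0≤⅓ : 0ℚ ≤ℚ ⅓
0≤⅓ = 0≤invN 3

-- Raising `r` by one raises the exponent by two, and `(4/7)²` is below 1/3.
4/7-⅓ : ∀ r → 4/7 ** suc (double r) ≤ℚ ℕtoℚ 2 * ⅓ ** suc r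
4/7-⅓ zero = from-yes (4/7 * 1ℚ ℚP.≤? ℕtoℚ 2 * (⅓ * 1ℚ))
4/7-⅓ (suc r) = ≤-resp (ℚP.*-assoc 4/7 4/7 (4/7 ** suc (double r))) (lemma ⅓ (⅓ ** suc r))
  (*-mono (from-yes (0ℚ ℚP.≤? 4/7 * 4/7)) (from-yes (4/7 * 4/7 ℚP.≤? ⅓)) (0≤** 0≤4/7 (suc (double r))) (4/7-⅓ r))
  where
  lemma : ∀ a b → a * (ℕtoℚ 2 * b) ≡ ℕtoℚ 2 * (a * b)
  lemma = solve-∀ ℚ-ring

C₁ : ℚ
C₁ = errorConstant * ℕtoℚ 2

0≤errorConstant : 0ℚ ≤ℚ errorConstant
0≤errorConstant = 0≤* (0≤ℕtoℚ 3) (0≤* (0≤ℕtoℚ 91) (0≤ℕtoℚ (40 ^ 5)))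

0≤C₁ : 0ℚ ≤ℚ C₁
0≤C₁ = 0≤* 0≤errorConstant (0≤ℕtoℚ 2)

-- The probability that the age is at least k, for trees of size ν + 4 and k ≥ 1.
tailProb : ℕ → ℕ → ℚ
tailProb ν k = ℕtoℚ (older (ℕ.pred k) (3 ℕ.+ ν)) * invN (ballot (3 ℕ.+ ν) 1)

error : ℕ → ℕ → ℚ
error ν k = tailProb ν k - (a0 k - b1 k * invN (4 ℕ.+ ν))

error-bound : ∀ ν r → error ν (suc r) ≲ C₁ * ⅓ ** suc r * (invN (4 ℕ.+ ν) * invN (4 ℕ.+ ν))
error-bound ν r = ≲-weaken (Limit.older-limit ν r)
  (*-monoʳ (0≤* (0≤invN (4 ℕ.+ ν)) (0≤invN (4 ℕ.+ ν)))
    (≤-resp refl (sym (ℚP.*-assoc errorConstant (ℕtoℚ 2) (⅓ ** suc r))) (*-monoˡ 0≤errorConstant (4/7-⅓ r))))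

-- The distribution of the age

-- The two fractions are one expression at `k` and at `k + 1`, matching the probability as a
-- difference of two tails.
mainTerm0-a0 : ∀ k → mainTerm0 k ≡ a0 k - a0 (suc k)
mainTerm0-a0 k = cong₂ (λ u v → frac u (q4 k ^ 2) - frac v (q4 (suc k) ^ 2)) (lemma₁ (pow (+ 4) k) (+ k)) (lemma₂ (pow (+ 4) (suc k)) (+ k))
  where
  lemma₁ : ∀ p k → + 4 ℤ.* (p ℤ.* (+ 3 ℤ.* k ℤ.- + 1) ℤ.+ + 1) ≡ + 4 ℤ.* p ℤ.* (+ 3 ℤ.* k ℤ.- + 1) ℤ.+ + 4
  lemma₁ = ℤSolver.solve-∀
  lemma₂ : ∀ p k → + 4 ℤ.* (p ℤ.* (+ 3 ℤ.* k ℤ.+ + 2) ℤ.+ + 1) ≡ + 4 ℤ.* p ℤ.* (+ 3 ℤ.* (+ 1 ℤ.+ k) ℤ.- + 1) ℤ.+ + 4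
  lemma₂ = ℤSolver.solve-∀

mainTerm1-b1 : ∀ k → mainTerm1 k ≡ b1 k - b1 (suc k)
mainTerm1-b1 k = cong₂ (λ u v → frac u (q4 k ^ 4) - frac v (q4 (suc k) ^ 4)) (lemma₁ (pow (+ 64) k) (pow (+ 16) k) (pow (+ 4) k) (+ k))
    (lemma₂ (pow (+ 64) (suc k)) (pow (+ 16) (suc k)) (pow (+ 4) (suc k)) (+ k))
  where
  lemma₁ : ∀ a b c k →
    + 6 ℤ.* a ℤ.* (+ 2 ℤ.* (k ℤ.* (k ℤ.* (k ℤ.* + 1))) ℤ.- + 5 ℤ.* (k ℤ.* (k ℤ.* + 1)) ℤ.+ + 4 ℤ.* k ℤ.- + 1)
      ℤ.- + 6 ℤ.* b ℤ.* (+ 16 ℤ.* (k ℤ.* (k ℤ.* (k ℤ.* + 1))) ℤ.- + 24 ℤ.* (k ℤ.* (k ℤ.* + 1)) ℤ.+ + 10 ℤ.* k ℤ.- + 1)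
      ℤ.+ + 24 ℤ.* c ℤ.* (+ 2 ℤ.* (k ℤ.* (k ℤ.* (k ℤ.* + 1))) ℤ.- k ℤ.* (k ℤ.* + 1))
    ≡ + 6 ℤ.* a ℤ.* (+ 2 ℤ.* (k ℤ.* (k ℤ.* (k ℤ.* + 1))) ℤ.- + 5 ℤ.* (k ℤ.* (k ℤ.* + 1)) ℤ.+ + 4 ℤ.* k ℤ.- + 1)
      ℤ.- + 6 ℤ.* b ℤ.* (+ 16 ℤ.* (k ℤ.* (k ℤ.* (k ℤ.* + 1))) ℤ.- + 24 ℤ.* (k ℤ.* (k ℤ.* + 1)) ℤ.+ + 10 ℤ.* k ℤ.- + 1)
      ℤ.+ + 24 ℤ.* c ℤ.* (+ 2 ℤ.* k ℤ.- + 1) ℤ.* (k ℤ.* (k ℤ.* + 1))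
  lemma₁ = ℤSolver.solve-∀
  lemma₂ : ∀ a b c k →
    + 6 ℤ.* a ℤ.* (+ 2 ℤ.* (k ℤ.* (k ℤ.* (k ℤ.* + 1))) ℤ.+ k ℤ.* (k ℤ.* + 1))
      ℤ.- + 6 ℤ.* b ℤ.* (+ 16 ℤ.* (k ℤ.* (k ℤ.* (k ℤ.* + 1))) ℤ.+ + 24 ℤ.* (k ℤ.* (k ℤ.* + 1)) ℤ.+ + 10 ℤ.* k ℤ.+ + 1)
      ℤ.+ + 24 ℤ.* c ℤ.* (+ 2 ℤ.* (k ℤ.* (k ℤ.* (k ℤ.* + 1))) ℤ.+ + 5 ℤ.* (k ℤ.* (k ℤ.* + 1)) ℤ.+ + 4 ℤ.* k ℤ.+ + 1)
    ≡ + 6 ℤ.* a ℤ.* (+ 2 ℤ.* ((+ 1 ℤ.+ k) ℤ.* ((+ 1 ℤ.+ k) ℤ.* ((+ 1 ℤ.+ k) ℤ.* + 1))) ℤ.- + 5 ℤ.* ((+ 1 ℤ.+ k) ℤ.* ((+ 1 ℤ.+ k) ℤ.* + 1)) ℤ.+ + 4 ℤ.* (+ 1 ℤ.+ k) ℤ.- + 1)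
      ℤ.- + 6 ℤ.* b ℤ.* (+ 16 ℤ.* ((+ 1 ℤ.+ k) ℤ.* ((+ 1 ℤ.+ k) ℤ.* ((+ 1 ℤ.+ k) ℤ.* + 1))) ℤ.- + 24 ℤ.* ((+ 1 ℤ.+ k) ℤ.* ((+ 1 ℤ.+ k) ℤ.* + 1)) ℤ.+ + 10 ℤ.* (+ 1 ℤ.+ k) ℤ.- + 1)
      ℤ.+ + 24 ℤ.* c ℤ.* (+ 2 ℤ.* (+ 1 ℤ.+ k) ℤ.- + 1) ℤ.* ((+ 1 ℤ.+ k) ℤ.* ((+ 1 ℤ.+ k) ℤ.* + 1))
  lemma₂ = ℤSolver.solve-∀

probD-tailProb : ∀ ν r → probD (4 ℕ.+ ν) (suc r) ≡ tailProb ν (suc r) - tailProb ν (2 ℕ.+ r)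
probD-tailProb ν r = begin
  probD (4 ℕ.+ ν) (suc r)                                  ≡⟨ ÷ℕ-invN (ℕtoℚ len) (numCS (4 ℕ.+ ν)) ⟩
  ℕtoℚ len * invN (numCS (4 ℕ.+ ν))                        ≡⟨ cong (λ x → ℕtoℚ len * invN x) (numCS-ballot (2 ℕ.+ ν)) ⟩
  ℕtoℚ len * invN (ballot m 1)                             ≡⟨ lemma (ℕtoℚ (older (suc r) m)) (ℕtoℚ len) (invN (ballot m 1)) ⟩
  (ℕtoℚ (older (suc r) m) + ℕtoℚ len) * invN (ballot m 1) - tailProb ν (2 ℕ.+ r)
    ≡⟨ cong (λ x → x * invN (ballot m 1) - tailProb ν (2 ℕ.+ r)) (trans (sym (ℕtoℚ-+ (older (suc r) m) len)) (cong ℕtoℚ (sym (older-hasAge r m)))) ⟩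
  tailProb ν (suc r) - tailProb ν (2 ℕ.+ r) ∎
  where
  open ≡-Reasoning
  m len : ℕ
  m = 3 ℕ.+ ν
  len = length (filterᵇ (λ t → hasAge (suc r) t) (csTrees (4 ℕ.+ ν)))
  lemma : ∀ a b c → b * c ≡ (a + b) * c - a * c
  lemma = solve-∀ ℚ-ring

C-prob : ℚ
C-prob = ℕtoℚ 2 * C₁

prob-asymptotics : ∀ n → 4 ≤ n → ∀ r → 1 ≤ r →
  ∣ probD n r - (mainTerm0 r - mainTerm1 r * invN n) ∣ ≤ℚ C-prob * ℕtoℚ (r ^ 5) * invN (3 ^ r) * invN n * invN n
prob-asymptotics (suc (suc (suc (suc ν)))) (s≤s (s≤s (s≤s (s≤s z≤n)))) (suc r) (s≤s z≤n) = bounded (≲-resp eq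
  (≲-weaken (≲-- (error-bound ν r) (error-bound ν (suc r))) le))
  where
  y g : ℚ
  y = invN (4 ℕ.+ ν)
  g = ⅓ ** suc r
  0≤yy : 0ℚ ≤ℚ y * y
  0≤yy = 0≤* (0≤invN (4 ℕ.+ ν)) (0≤invN (4 ℕ.+ ν))
  0≤g : 0ℚ ≤ℚ g
  0≤g = 0≤** 0≤⅓ (suc r)
  eq : error ν (suc r) - error ν (2 ℕ.+ r) ≡ probD (4 ℕ.+ ν) (suc r) - (mainTerm0 (suc r) - mainTerm1 (suc r) * y)
  eq = trans (lemma (tailProb ν (suc r)) (a0 (suc r)) (b1 (suc r)) (tailProb ν (2 ℕ.+ r)) (a0 (2 ℕ.+ r)) (b1 (2 ℕ.+ r)) y)
    (cong₂ _-_ (sym (probD-tailProb ν r)) (cong₂ (λ a b → a - b * y) (sym (mainTerm0-a0 (suc r))) (sym (mainTerm1-b1 (suc r)))))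
    where
    lemma : ∀ t a b t′ a′ b′ y → (t - (a - b * y)) - (t′ - (a′ - b′ * y)) ≡ (t - t′) - ((a - a′) - (b - b′) * y)
    lemma = solve-∀ ℚ-ring
  le : C₁ * g * (y * y) + C₁ * (⅓ * g) * (y * y) ≤ℚ C-prob * ℕtoℚ (suc r ^ 5) * invN (3 ^ suc r) * y * y
  le = ℚP.≤-trans (ℚP.+-monoʳ-≤ (C₁ * g * (y * y)) (*-monoʳ 0≤yy (*-monoˡ 0≤C₁ (≤-resp refl (ℚP.*-identityˡ g) (*-monoʳ 0≤g (invN≤1 3))))))
    (≤-resp (lemma₁ C₁ g y) (trans (cong (λ x → ℕtoℚ 2 * C₁ * x * (ℕtoℚ (suc r ^ 5) * (y * y))) (sym (invN-^ 2 (suc r)))) (lemma₂ (ℕtoℚ 2 * C₁) (invN (3 ^ suc r)) (ℕtoℚ (suc r ^ 5)) y))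
      (*-monoˡ (0≤* (0≤* (0≤ℕtoℚ 2) 0≤C₁) 0≤g) (*-monoʳ 0≤yy (ℕtoℚ-mono {1} {suc r ^ 5} (^-positive r 5)))))
    where
    lemma₁ : ∀ C g y → ℕtoℚ 2 * C * g * (1ℚ * (y * y)) ≡ C * g * (y * y) + C * g * (y * y)
    lemma₁ = solve-∀ ℚ-ring
    lemma₂ : ∀ C g f y → C * g * (f * (y * y)) ≡ C * f * g * y * y
    lemma₂ = solve-∀ ℚ-ring

-- Partial sums

sumTo-cong : ∀ K {f g : ℕ → ℚ} → (∀ k → f (suc k) ≡ g (suc k)) → sumTo K f ≡ sumTo K g
sumTo-cong zero p = refl
sumTo-cong (suc K) p = cong₂ _+_ (sumTo-cong K p) (p K)

sumTo-* : ∀ K (f : ℕ → ℚ) c → sumTo K (λ k → f k * c) ≡ sumTo K f * c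
sumTo-* zero f c = sym (ℚP.*-zeroˡ c)
sumTo-* (suc K) f c = trans (cong (_+ f (suc K) * c) (sumTo-* K f c)) (sym (ℚP.*-distribʳ-+ c (sumTo K f) (f (suc K))))

sumTo-linear : ∀ K (t a b : ℕ → ℚ) y → sumTo K (λ k → t k - (a k - b k * y)) ≡ sumTo K t - (sumTo K a - sumTo K b * y)
sumTo-linear zero t a b y = lemma y
  where
  lemma : ∀ y → 0ℚ ≡ 0ℚ - (0ℚ - 0ℚ * y)
  lemma = solve-∀ ℚ-ring
sumTo-linear (suc K) t a b y = trans (cong (_+ (t (suc K) - (a (suc K) - b (suc K) * y))) (sumTo-linear K t a b y))
  (lemma (sumTo K t) (sumTo K a) (sumTo K b) (t (suc K)) (a (suc K)) (b (suc K)) y)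
  where
  lemma : ∀ t a b t′ a′ b′ y → t - (a - b * y) + (t′ - (a′ - b′ * y)) ≡ (t + t′) - ((a + a′) - (b + b′) * y)
  lemma = solve-∀ ℚ-ring

Σ<-snoc : ∀ K h → Σ< (suc K) h ≡ Σ< K h ℕ.+ h K
Σ<-snoc zero h = ℕP.+-identityʳ (h 0)
Σ<-snoc (suc K) h = trans (cong (h 0 ℕ.+_) (Σ<-snoc K (h ∘ suc))) (sym (ℕP.+-assoc (h 0) (Σ< K (h ∘ suc)) (h (suc K))))

ℕtoℚ-Σ< : ∀ K h → ℕtoℚ (Σ< K h) ≡ sumTo K (λ k → ℕtoℚ (h (ℕ.pred k)))
ℕtoℚ-Σ< zero h = refl
ℕtoℚ-Σ< (suc K) h = trans (cong ℕtoℚ (Σ<-snoc K h)) (trans (ℕtoℚ-+ (Σ< K h) (h K)) (cong (_+ ℕtoℚ (h K)) (ℕtoℚ-Σ< K h)))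

-- The subtracted `½ ** (j + K)` is kept because its change from `j` to `j + 1` is exactly the bound
-- on the next term, so the induction closes.
sumTo-tail : ∀ {f} C → (∀ k → f (suc k) ≲ C * ½ ** suc k) → ∀ K j → sumTo (j ℕ.+ K) f - sumTo K f ≲ C * (½ ** K - ½ ** (j ℕ.+ K))
sumTo-tail {f} C p K zero = ≲-resp (sym (ℚP.+-inverseʳ (sumTo K f))) (≲-nonneg ℚP.≤-refl (ℚP.≤-reflexive (lemma C (½ ** K))))
  where
  lemma : ∀ C g → 0ℚ ≡ C * (g - g)
  lemma = solve-∀ ℚ-ring
sumTo-tail {f} C p K (suc j) = ≲-resp (lemma₁ (sumTo (j ℕ.+ K) f) (sumTo K f) (f (suc (j ℕ.+ K))))
  (≲-weaken (≲-+ (sumTo-tail C p K j) (p (j ℕ.+ K))) (ℚP.≤-reflexive (lemma₂ C (½ ** K) (½ ** (j ℕ.+ K)))))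
  where
  lemma₁ : ∀ a b c → a - b + c ≡ a + c - b
  lemma₁ = solve-∀ ℚ-ring
  lemma₂ : ∀ C g h → C * (g - h) + C * (½ * h) ≡ C * (g - ½ * h)
  lemma₂ = solve-∀ ℚ-ring

sumTo-tail′ : ∀ {f C} → 0ℚ ≤ℚ C → (∀ k → f (suc k) ≲ C * ½ ** suc k) → ∀ K₀ K → K₀ ≤ K → sumTo K f - sumTo K₀ f ≲ C * ½ ** K₀
sumTo-tail′ {f} {C} 0≤C p K₀ K le = ≲-weaken
  (subst (λ K → sumTo K f - sumTo K₀ f ≲ C * (½ ** K₀ - ½ ** K)) (ℕP.m∸n+n≡m le) (sumTo-tail C p K₀ (K ℕ.∸ K₀)))
  (*-monoˡ 0≤C (≤-by (½ ** K) (0≤** 0≤½ K) (lemma (½ ** K₀) (½ ** K))))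
  where
  lemma : ∀ a b → a - b + b ≡ a
  lemma = solve-∀ ℚ-ring

sumTo-bound : ∀ {f C} → 0ℚ ≤ℚ C → (∀ k → f (suc k) ≲ C * ½ ** suc k) → ∀ K → sumTo K f ≲ C
sumTo-bound {f} {C} 0≤C p K = ≲-weaken (≲-resp (lemma (sumTo K f)) (sumTo-tail′ 0≤C p 0 K z≤n)) (ℚP.≤-reflexive (ℚP.*-identityʳ C))
  where
  lemma : ∀ a → a - 0ℚ ≡ a
  lemma = solve-∀ ℚ-ring

-- Geometric decay of the terms

¼ : ℚ
¼ = ½ * ½

0≤¼ : 0ℚ ≤ℚ ¼
0≤¼ = 0≤* 0≤½ 0≤½

-- 1350 is `3 · 450`: 450 is the value of the majorant of `b1` at index 1 up to its power of ¼ and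
-- also serves `a0`, and 3 covers the weight `2r - 1`. The factor `40⁵` comes from `fifth-decay`.
C-sum : ℚ
C-sum = ℕtoℚ 1350 * ℕtoℚ (40 ^ 5)

0≤C-sum : 0ℚ ≤ℚ C-sum
0≤C-sum = 0≤* (0≤ℕtoℚ 1350) (0≤ℕtoℚ (40 ^ 5))

module TermBounds (j : ℕ) where

  open Closed (suc j)

  G S : ℚ
  G = ¼ ** suc j
  S = ℕtoℚ j

  0≤G : 0ℚ ≤ℚ G
  0≤G = 0≤** 0≤¼ (suc j)

  0≤R : 0ℚ ≤ℚ R
  0≤R = 0≤ℕtoℚ (suc j)

  1≤R : 1ℚ ≤ℚ R
  1≤R = ℕtoℚ-mono {1} {suc j} (s≤s z≤n)

  Z≲G : Z ≲ G
  Z≲G = ≲-nonneg 0≤Z (≤-resp (trans (cong (G *_) X-def) (trans (sym (ℚP.*-assoc G (ℕtoℚ 4 ** suc j) Z))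
      (trans (cong (_* Z) (trans (sym (**-* ¼ (ℕtoℚ 4) (suc j))) (1** (suc j)))) (ℚP.*-identityˡ Z)))) (ℚP.*-identityʳ G) (*-monoˡ 0≤G X≤1))

  Z≲1 : Z ≲ 1ℚ
  Z≲1 = ≲-weaken Z≲G (**-≤1 0≤¼ (from-yes (¼ ℚP.≤? 1ℚ)) (suc j))

  X≲1 : X ≲ 1ℚ
  X≲1 = ≲-nonneg 0≤X X≤1

  const : ∀ c → ℕtoℚ c ≲ ℕtoℚ c
  const c = ≲-self (0≤ℕtoℚ c)

  one : 1ℚ ≲ 1ℚ
  one = ≲-self 0≤1

  R≲ : R ≲ R
  R≲ = ≲-self 0≤R

  a0-cubic : a0 (suc j) ≲ ℕtoℚ 450 * (R * R * R) * G
  a0-cubic = ≲-resp (sym a0-closed) (≲-weaken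
    (≲-+ (≲-* (≲-* (≲-* (const 4) X≲1) (≲-- (≲-* (const 3) R≲) one)) Z≲G) (≲-* (const 4) (≲-* Z≲1 Z≲G)))
    (≤-by ((ℕtoℚ 430 + S * (ℕtoℚ 1338 + S * (ℕtoℚ 1350 + S * ℕtoℚ 450))) * G)
      (0≤* (0≤horner (0≤ℕtoℚ j) (0≤ℕtoℚ 430) (0≤ℕtoℚ 1338) (0≤ℕtoℚ 1350) (0≤ℕtoℚ 450)) 0≤G)
      (subst (λ R → ℕtoℚ 4 * 1ℚ * (ℕtoℚ 3 * R + 1ℚ) * G + ℕtoℚ 4 * (1ℚ * G) + (ℕtoℚ 430 + S * (ℕtoℚ 1338 + S * (ℕtoℚ 1350 + S * ℕtoℚ 450))) * G
          ≡ ℕtoℚ 450 * (R * R * R) * G) (sym (ℕtoℚ-suc j)) (lemma S G))))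
    where
    lemma : ∀ S G → ℕtoℚ 4 * 1ℚ * (ℕtoℚ 3 * (1ℚ + S) + 1ℚ) * G + ℕtoℚ 4 * (1ℚ * G) + (ℕtoℚ 430 + S * (ℕtoℚ 1338 + S * (ℕtoℚ 1350 + S * ℕtoℚ 450))) * G
      ≡ ℕtoℚ 450 * ((1ℚ + S) * (1ℚ + S) * (1ℚ + S)) * G
    lemma = solve-∀ ℚ-ring

  b1-cubic : b1 (suc j) ≲ ℕtoℚ 450 * (R * R * R) * G
  b1-cubic = ≲-resp (sym b1-closed) (≲-weaken
    (≲-+ (≲-- (≲-* (≲-* (const 6) (≲-* (≲-* (≲-* X≲1 X≲1) X≲1) Z≲G)) (cubic 2 5 4))
              (≲-* (≲-* (const 6) (≲-* (≲-* X≲1 X≲1) (≲-* Z≲1 Z≲G))) (cubic 16 24 10)))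
         (≲-* (≲-* (≲-* (const 24) (≲-* X≲1 (≲-* (≲-* Z≲1 Z≲1) Z≲G))) (≲-- (≲-* (const 2) R≲) one)) (≲-* R≲ R≲)))
    (≤-by ((ℕtoℚ 0 + S * (ℕtoℚ 402 + S * (ℕtoℚ 684 + S * ℕtoℚ 294))) * G)
      (0≤* (0≤horner (0≤ℕtoℚ j) (0≤ℕtoℚ 0) (0≤ℕtoℚ 402) (0≤ℕtoℚ 684) (0≤ℕtoℚ 294)) 0≤G)
      (subst (λ R → majorant R + (ℕtoℚ 0 + S * (ℕtoℚ 402 + S * (ℕtoℚ 684 + S * ℕtoℚ 294))) * G
          ≡ ℕtoℚ 450 * (R * R * R) * G) (sym (ℕtoℚ-suc j)) (lemma S G))))
    where
    cubic : ∀ a b c → ℕtoℚ a * (R * R * R) - ℕtoℚ b * (R * R) + ℕtoℚ c * R - 1ℚ ≲ ℕtoℚ a * (R * R * R) + ℕtoℚ b * (R * R) + ℕtoℚ c * R + 1ℚ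
    cubic a b c = ≲-- (≲-+ (≲-- (≲-* (const a) (≲-* (≲-* R≲ R≲) R≲)) (≲-* (const b) (≲-* R≲ R≲))) (≲-* (const c) R≲)) one
    majorant : ℚ → ℚ
    majorant R = ℕtoℚ 6 * (1ℚ * 1ℚ * 1ℚ * G) * (ℕtoℚ 2 * (R * R * R) + ℕtoℚ 5 * (R * R) + ℕtoℚ 4 * R + 1ℚ)
      + ℕtoℚ 6 * (1ℚ * 1ℚ * (1ℚ * G)) * (ℕtoℚ 16 * (R * R * R) + ℕtoℚ 24 * (R * R) + ℕtoℚ 10 * R + 1ℚ)
      + ℕtoℚ 24 * (1ℚ * (1ℚ * 1ℚ * G)) * (ℕtoℚ 2 * R + 1ℚ) * (R * R)
    lemma : ∀ S G → ℕtoℚ 6 * (1ℚ * 1ℚ * 1ℚ * G) * (ℕtoℚ 2 * ((1ℚ + S) * (1ℚ + S) * (1ℚ + S)) + ℕtoℚ 5 * ((1ℚ + S) * (1ℚ + S)) + ℕtoℚ 4 * (1ℚ + S) + 1ℚ)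
        + ℕtoℚ 6 * (1ℚ * 1ℚ * (1ℚ * G)) * (ℕtoℚ 16 * ((1ℚ + S) * (1ℚ + S) * (1ℚ + S)) + ℕtoℚ 24 * ((1ℚ + S) * (1ℚ + S)) + ℕtoℚ 10 * (1ℚ + S) + 1ℚ)
        + ℕtoℚ 24 * (1ℚ * (1ℚ * 1ℚ * G)) * (ℕtoℚ 2 * (1ℚ + S) + 1ℚ) * ((1ℚ + S) * (1ℚ + S))
        + (ℕtoℚ 0 + S * (ℕtoℚ 402 + S * (ℕtoℚ 684 + S * ℕtoℚ 294))) * G
      ≡ ℕtoℚ 450 * ((1ℚ + S) * (1ℚ + S) * (1ℚ + S)) * G
    lemma = solve-∀ ℚ-ring

  -- `4⁻ᵏ` is split as `2⁻ᵏ · 2⁻ᵏ`: one factor absorbs the polynomial, raised from degree 4 to 5 to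
  -- fit `fifth-decay`; the other is the remaining rate.
  decay : ℕtoℚ 1350 * (R * R * R * R) * G ≤ℚ C-sum * ½ ** suc j
  decay = ≤-resp (trans (lemma₁ R (½ ** suc j)) (cong (ℕtoℚ 1350 * (R * R * R * R) *_) (sym (**-* ½ ½ (suc j))))) (lemma₂ (ℕtoℚ (40 ^ 5)) (½ ** suc j))
    (ℚP.≤-trans (*-monoˡ (0≤* (0≤ℕtoℚ 1350) 0≤half) (*-monoʳ 0≤half (*-monoˡ 0≤R⁴ 1≤R)))
      (*-monoˡ (0≤* (0≤ℕtoℚ 1350) 0≤half) (ℚP.≤-trans (fifth-decay (suc j))
        (*-monoˡ (0≤ℕtoℚ (40 ^ 5)) (**-≤1 0≤4/7 (from-yes (4/7 ℚP.≤? 1ℚ)) (suc j))))))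
    where
    0≤half : 0ℚ ≤ℚ ½ ** suc j
    0≤half = 0≤** 0≤½ (suc j)
    0≤R⁴ : 0ℚ ≤ℚ R * R * R * R
    0≤R⁴ = 0≤* (0≤* (0≤* 0≤R 0≤R) 0≤R) 0≤R
    lemma₁ : ∀ R g → ℕtoℚ 1350 * g * (R * R * R * R * 1ℚ * g) ≡ ℕtoℚ 1350 * (R * R * R * R) * (g * g)
    lemma₁ = solve-∀ ℚ-ring
    lemma₂ : ∀ c g → ℕtoℚ 1350 * g * (c * 1ℚ) ≡ ℕtoℚ 1350 * c * g
    lemma₂ = solve-∀ ℚ-ring

  plain : ∀ {f} → f ≲ ℕtoℚ 450 * (R * R * R) * G → f ≲ C-sum * ½ ** suc j
  plain p = ≲-weaken p (ℚP.≤-trans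
    (*-monoʳ 0≤G (*-mono (0≤ℕtoℚ 450) (ℕtoℚ-mono {450} {1350} (ℕP.m≤m+n 450 900)) (0≤* (0≤* 0≤R 0≤R) 0≤R)
      (≤-resp (ℚP.*-identityʳ (R * R * R)) refl (*-monoˡ (0≤* (0≤* 0≤R 0≤R) 0≤R) 1≤R))))
    decay)

  twoRm1-eq : twoRm1 (suc j) ≡ ℕtoℚ 2 * R - 1ℚ
  twoRm1-eq = trans (ℤtoℚ-- (+ 2 ℤ.* + suc j) (+ 1)) (cong (_- 1ℚ) (ℤtoℚ-* (+ 2) (+ suc j)))

  twoRm1-bound : twoRm1 (suc j) ≲ ℕtoℚ 3 * R
  twoRm1-bound = ≲-resp (sym twoRm1-eq) (≲-weaken (≲-- (≲-* (const 2) R≲) one)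
    (≤-resp refl (lemma R) (ℚP.+-monoʳ-≤ (ℕtoℚ 2 * R) 1≤R)))
    where
    lemma : ∀ R → ℕtoℚ 2 * R + R ≡ ℕtoℚ 3 * R
    lemma = solve-∀ ℚ-ring

  weighted : ∀ {f} → f ≲ ℕtoℚ 450 * (R * R * R) * G → twoRm1 (suc j) * f ≲ C-sum * ½ ** suc j
  weighted p = ≲-weaken (≲-* twoRm1-bound p) (ℚP.≤-trans (ℚP.≤-reflexive (lemma R G)) decay)
    where
    lemma : ∀ R G → ℕtoℚ 3 * R * (ℕtoℚ 450 * (R * R * R) * G) ≡ ℕtoℚ 1350 * (R * R * R * R) * G
    lemma = solve-∀ ℚ-ring

a0-decay : ∀ j → a0 (suc j) ≲ C-sum * ½ ** suc j
a0-decay j = TermBounds.plain j (TermBounds.a0-cubic j)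

b1-decay : ∀ j → b1 (suc j) ≲ C-sum * ½ ** suc j
b1-decay j = TermBounds.plain j (TermBounds.b1-cubic j)

wa0-decay : ∀ j → twoRm1 (suc j) * a0 (suc j) ≲ C-sum * ½ ** suc j
wa0-decay j = TermBounds.weighted j (TermBounds.a0-cubic j)

wb1-decay : ∀ j → twoRm1 (suc j) * b1 (suc j) ≲ C-sum * ½ ** suc j
wb1-decay j = TermBounds.weighted j (TermBounds.b1-cubic j)

-- Moments

sumℚ-∑ : {A : Set} (xs : List A) (w : A → ℕ) → sumℚ (map (λ x → ℕtoℚ (w x)) xs) ≡ ℕtoℚ (∑ xs w)
sumℚ-∑ [] w = refl
sumℚ-∑ (x ∷ xs) w = trans (cong (λ s → ℕtoℚ (w x) + s) (sumℚ-∑ xs w)) (sym (ℕtoℚ-+ (w x) (∑ xs w)))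

moment : ∀ ν K (w : Tree → ℕ) (g : ℕ → ℕ) → ∑ (csTrees (4 ℕ.+ ν)) w ≡ Σ< K (λ r → g r ℕ.* older r (3 ℕ.+ ν)) →
  sumℚ (map (λ t → ℕtoℚ (w t)) (csTrees (4 ℕ.+ ν))) ÷ℕ numCS (4 ℕ.+ ν) ≡ sumTo K (λ k → ℕtoℚ (g (ℕ.pred k)) * tailProb ν k)
moment ν K w g eq = begin
  sumℚ (map (λ t → ℕtoℚ (w t)) ts) ÷ℕ numCS (4 ℕ.+ ν)             ≡⟨ ÷ℕ-invN _ (numCS (4 ℕ.+ ν)) ⟩
  sumℚ (map (λ t → ℕtoℚ (w t)) ts) * invN (numCS (4 ℕ.+ ν))       ≡⟨ cong₂ (λ a b → a * invN b) (trans (sumℚ-∑ ts w) (cong ℕtoℚ eq)) (numCS-ballot (2 ℕ.+ ν)) ⟩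
  ℕtoℚ (Σ< K (λ r → g r ℕ.* older r m)) * c                       ≡⟨ cong (_* c) (ℕtoℚ-Σ< K (λ r → g r ℕ.* older r m)) ⟩
  sumTo K (λ k → ℕtoℚ (g (ℕ.pred k) ℕ.* older (ℕ.pred k) m)) * c  ≡⟨ sumTo-* K (λ k → ℕtoℚ (g (ℕ.pred k) ℕ.* older (ℕ.pred k) m)) c ⟨
  sumTo K (λ k → ℕtoℚ (g (ℕ.pred k) ℕ.* older (ℕ.pred k) m) * c)
    ≡⟨ sumTo-cong K (λ k → trans (cong (_* c) (ℕtoℚ-* (g k) (older k m))) (ℚP.*-assoc (ℕtoℚ (g k)) (ℕtoℚ (older k m)) c)) ⟩
  sumTo K (λ k → ℕtoℚ (g (ℕ.pred k)) * tailProb ν k) ∎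
  where
  open ≡-Reasoning
  m : ℕ
  m = 3 ℕ.+ ν
  ts : List Tree
  ts = csTrees (4 ℕ.+ ν)
  c : ℚ
  c = invN (ballot m 1)

-- For `K` above all ages the expectation is a sum of `K` tail probabilities, so subtracting the
-- partial sums term by term leaves exactly the errors.
expD-error : ∀ ν K → maxAge (3 ℕ.+ ν) ≤ K →
  expD (4 ℕ.+ ν) - (s0 K + s1 K * invN (4 ℕ.+ ν)) ≡ sumTo K (error ν)
expD-error ν K le = sym (trans (sumTo-linear K (tailProb ν) a0 b1 y) (trans
    (cong (λ x → x - (sumTo K a0 - sumTo K b1 * y)) (trans (sumTo-cong K (λ k → sym (ℚP.*-identityˡ (tailProb ν (suc k))))) (sym
      (moment ν K age (λ _ → 1) (trans (∑-age (3 ℕ.+ ν) K le) (Σ<-cong K (λ r _ → sym (ℕP.+-identityʳ (older r (3 ℕ.+ ν))))))))))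
    (lemma (expD (4 ℕ.+ ν)) (sumTo K a0) (sumTo K b1) y)))
  where
  y : ℚ
  y = invN (4 ℕ.+ ν)
  lemma : ∀ e a b y → e - (a - b * y) ≡ e - (a + - b * y)
  lemma = solve-∀ ℚ-ring

exp2D-error : ∀ ν K → maxAge (3 ℕ.+ ν) ≤ K →
  exp2D (4 ℕ.+ ν) - (sumTo K (λ k → twoRm1 k * a0 k) - sumTo K (λ k → twoRm1 k * b1 k) * invN (4 ℕ.+ ν))
    ≡ sumTo K (λ k → twoRm1 k * error ν k)
exp2D-error ν K le = sym (trans (sumTo-cong K (λ k → lemma (twoRm1 (suc k)) (tailProb ν (suc k)) (a0 (suc k)) (b1 (suc k)) y))
    (trans (sumTo-linear K (λ k → twoRm1 k * tailProb ν k) (λ k → twoRm1 k * a0 k) (λ k → twoRm1 k * b1 k) y)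
      (cong (λ x → x - (sumTo K (λ k → twoRm1 k * a0 k) - sumTo K (λ k → twoRm1 k * b1 k) * y))
        (trans (sumTo-cong K (λ k → cong (_* tailProb ν (suc k)) (weight k)))
          (sym (moment ν K (λ t → age t ℕ.* age t) (λ r → suc (2 ℕ.* r)) (∑-age² (3 ℕ.+ ν) K le)))))))
  where
  y : ℚ
  y = invN (4 ℕ.+ ν)
  lemma : ∀ w t a b y → w * (t - (a - b * y)) ≡ w * t - (w * a - w * b * y)
  lemma = solve-∀ ℚ-ring
  weight : ∀ k → twoRm1 (suc k) ≡ ℕtoℚ (suc (2 ℕ.* k))
  weight k = trans (TermBounds.twoRm1-eq k) (trans (cong (λ x → ℕtoℚ 2 * x - 1ℚ) (ℕtoℚ-suc k))
    (trans (lemma₁ (ℕtoℚ k)) (sym (trans (ℕtoℚ-suc (2 ℕ.* k)) (cong (λ x → 1ℚ + x) (ℕtoℚ-* 2 k))))))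
    where
    lemma₁ : ∀ k → ℕtoℚ 2 * (1ℚ + k) - 1ℚ ≡ 1ℚ + ℕtoℚ 2 * k
    lemma₁ = solve-∀ ℚ-ring

-- Linear weights cost a factor 3/2 in the rate of decay.
linear-decay : ∀ s → ℕtoℚ s * ⅓ ** s ≤ℚ ℕtoℚ 2 * ½ ** s
linear-decay s = ℚP.≤-trans (*-monoʳ {ℕtoℚ s} (0≤** 0≤⅓ s) (ℚP.≤-trans (≤-by {ℕtoℚ s} (ℕtoℚ 2) (0≤ℕtoℚ 2) (ℚP.+-comm (ℕtoℚ s) (ℕtoℚ 2))) (bernoulli 1 s)))
  (ℚP.≤-reflexive (trans (ℚP.*-assoc (ℕtoℚ 2) ((1ℚ + invN 2) ** s) (⅓ ** s)) (cong (ℕtoℚ 2 *_) (sym (**-* (1ℚ + invN 2) ⅓ s)))))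

lim-intro : ∀ {s δ} K₀ → (∀ K → K₀ ≤ K → s K ≲ δ) → LimAbsLe s δ
lim-intro K₀ p ε 0<ε = K₀ , λ K le → ℚP.≤-trans (bounded (p K le)) (≤-by ε (ℚP.<⇒≤ 0<ε) refl)

module Moments (ν : ℕ) where

  n : ℕ
  n = 4 ℕ.+ ν

  abstract
    y : ℚ
    y = invN n

    y-def : y ≡ invN n
    y-def = refl

    0≤y : 0ℚ ≤ℚ y
    0≤y = 0≤invN n

    y≤1 : y ≤ℚ 1ℚ
    y≤1 = invN≤1 n

  0≤yy : 0ℚ ≤ℚ y * y
  0≤yy = 0≤* 0≤y 0≤y

  C₂ : ℚ
  C₂ = ℕtoℚ 6 * C₁

  error-decay : ∀ k → error ν (suc k) ≲ C₁ * (y * y) * ½ ** suc k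
  error-decay k = ≲-weaken (subst (λ y → error ν (suc k) ≲ C₁ * ⅓ ** suc k * (y * y)) (sym y-def) (error-bound ν k))
    (≤-resp refl (lemma C₁ (½ ** suc k) (y * y)) (*-monoʳ 0≤yy (*-monoˡ 0≤C₁ (**-mono 0≤⅓ (from-yes (⅓ ℚP.≤? ½)) (suc k)))))
    where
    lemma : ∀ C g y → C * g * y ≡ C * y * g
    lemma = solve-∀ ℚ-ring

  weighted-error-decay : ∀ k → twoRm1 (suc k) * error ν (suc k) ≲ C₂ * (y * y) * ½ ** suc k
  weighted-error-decay k = ≲-weaken (≲-* (TermBounds.twoRm1-bound k) (subst (λ y → error ν (suc k) ≲ C₁ * ⅓ ** suc k * (y * y)) (sym y-def) (error-bound ν k)))
    (≤-resp (lemma₁ C₁ (y * y) (ℕtoℚ (suc k)) (⅓ ** suc k)) (lemma₂ C₁ (y * y) (½ ** suc k))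
      (*-monoˡ (0≤* (0≤* (0≤ℕtoℚ 3) 0≤C₁) 0≤yy) (linear-decay (suc k))))
    where
    lemma₁ : ∀ C y s g → ℕtoℚ 3 * C * y * (s * g) ≡ ℕtoℚ 3 * s * (C * g * y)
    lemma₁ = solve-∀ ℚ-ring
    lemma₂ : ∀ C y g → ℕtoℚ 3 * C * y * (ℕtoℚ 2 * g) ≡ ℕtoℚ 6 * C * y * g
    lemma₂ = solve-∀ ℚ-ring

  e₁-bound : ∀ K → sumTo K (error ν) ≲ C₁ * (y * y)
  e₁-bound = sumTo-bound (0≤* 0≤C₁ 0≤yy) error-decay

  e₂-bound : ∀ K → sumTo K (λ k → twoRm1 k * error ν k) ≲ C₂ * (y * y)
  e₂-bound = sumTo-bound (0≤* (0≤* (0≤ℕtoℚ 6) 0≤C₁) 0≤yy) weighted-error-decay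

  expectation : LimAbsLe (λ K → expD n - (s0 K + s1 K * invN n)) (C₁ * invN n * invN n)
  expectation = lim-intro (maxAge (3 ℕ.+ ν)) (λ K le → ≲-resp (sym (expD-error ν K le))
    (≲-weaken (e₁-bound K) (ℚP.≤-reflexive (trans (cong (λ y → C₁ * (y * y)) y-def) (sym (ℚP.*-assoc C₁ (invN n) (invN n)))))))

C-var : ℚ
C-var = ℕtoℚ 6 * C₁ + (C-sum * C-sum + C₁ * C₁ + ℕtoℚ 2 * C₁ * (C-sum + C-sum))

module Variance (ν K : ℕ) (le : maxAge (3 ℕ.+ ν) ≤ K) where

  open Moments ν

  -- Opaque names keep the sums from being unfolded when the terms below are compared.
  abstract
    E E² A B P Q e e′ : ℚ
    E = expD n
    E² = exp2D n
    A = s0 K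
    B = s1 K
    P = sumTo K (λ k → twoRm1 k * a0 k)
    Q = sumTo K (λ k → twoRm1 k * b1 k)
    e = sumTo K (error ν)
    e′ = sumTo K (λ k → twoRm1 k * error ν k)

    E-eq : E - (A + B * y) ≡ e
    E-eq = trans (cong (λ y → E - (A + B * y)) y-def) (expD-error ν K le)

    E²-eq : E² - (P - Q * y) ≡ e′
    E²-eq = trans (cong (λ y → E² - (P - Q * y)) y-def) (exp2D-error ν K le)

    e≲ : e ≲ C₁ * (y * y)
    e≲ = e₁-bound K

    e′≲ : e′ ≲ C₂ * (y * y)
    e′≲ = e₂-bound K

    A≲ : A ≲ C-sum
    A≲ = sumTo-bound 0≤C-sum a0-decay K

    B≲ : B ≲ C-sum
    B≲ = ≲-neg (sumTo-bound 0≤C-sum b1-decay K)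

    unfold-goal : ∀ {δ} → (E² - E * E) - ((P - A * A) + (- Q - ℕtoℚ 2 * A * B) * y) ≲ δ → varD n - (s2 K + s3 K * invN n) ≲ δ
    unfold-goal {δ} p = subst (λ y → (E² - E * E) - ((P - A * A) + (- Q - ℕtoℚ 2 * A * B) * y) ≲ δ) y-def p

  -- With `E = A + B y + e` and `E² = P - Q y + e′` the orders 0 and 1 in `y` cancel, and all that
  -- is left is of order `y²`.
  identity : e′ - (B * B * (y * y) + e * e + ℕtoℚ 2 * e * (A + B * y)) ≡ (E² - E * E) - ((P - A * A) + (- Q - ℕtoℚ 2 * A * B) * y)
  identity = trans (cong₂ (λ e e′ → e′ - (B * B * (y * y) + e * e + ℕtoℚ 2 * e * (A + B * y))) (sym E-eq) (sym E²-eq)) (lemma E E² A B P Q y)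
    where
    lemma : ∀ E E² A B P Q y → (E² - (P - Q * y)) - (B * B * (y * y) + (E - (A + B * y)) * (E - (A + B * y)) + ℕtoℚ 2 * (E - (A + B * y)) * (A + B * y))
      ≡ (E² - E * E) - ((P - A * A) + (- Q - ℕtoℚ 2 * A * B) * y)
    lemma = solve-∀ ℚ-ring

  yy≤1 : y * y ≤ℚ 1ℚ
  yy≤1 = *-mono 0≤y y≤1 0≤y y≤1

  error² : e′ - (B * B * (y * y) + e * e + ℕtoℚ 2 * e * (A + B * y)) ≲ C-var * (y * y)
  error² = ≲-weaken
    (≲-- e′≲ (≲-+ (≲-+ (≲-* (≲-* B≲ B≲) (≲-self 0≤yy)) (≲-* e≲ (≲-weaken e≲ (*-monoˡ 0≤C₁ yy≤1))))
      (≲-* (≲-* (≲-self (0≤ℕtoℚ 2)) e≲) (≲-+ A≲ (≲-* B≲ (≲-nonneg 0≤y y≤1))))))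
    (ℚP.≤-reflexive (lemma C₁ C-sum (y * y)))
    where
    lemma : ∀ C S y → ℕtoℚ 6 * C * y + (S * S * y + C * y * (C * 1ℚ) + ℕtoℚ 2 * (C * y) * (S + S * 1ℚ))
      ≡ (ℕtoℚ 6 * C + (S * S + C * C + ℕtoℚ 2 * C * (S + S))) * y
    lemma = solve-∀ ℚ-ring

  variance-bound : varD n - (s2 K + s3 K * invN n) ≲ C-var * invN n * invN n
  variance-bound = unfold-goal (≲-resp identity (≲-weaken error²
    (ℚP.≤-reflexive (trans (cong (λ y → C-var * (y * y)) y-def) (sym (ℚP.*-assoc C-var (invN n) (invN n)))))))

expectation-asymptotics : ∀ n → 4 ≤ n → LimAbsLe (λ K → expD n - (s0 K + s1 K * invN n)) (C₁ * invN n * invN n)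
expectation-asymptotics (suc (suc (suc (suc ν)))) (s≤s (s≤s (s≤s (s≤s z≤n)))) = Moments.expectation ν

variance-asymptotics : ∀ n → 4 ≤ n → LimAbsLe (λ K → varD n - (s2 K + s3 K * invN n)) (C-var * invN n * invN n)
variance-asymptotics (suc (suc (suc (suc ν)))) (s≤s (s≤s (s≤s (s≤s z≤n)))) =
  lim-intro (maxAge (3 ℕ.+ ν)) (λ K le → Variance.variance-bound ν K le)

-- Fixed-point arithmetic with 30 decimals

abstract
  ι : ℚ
  ι = invN (10 ^ 30)

  0≤ι : 0ℚ ≤ℚ ι
  0≤ι = 0≤invN (10 ^ 30)

  ι-inverse : ℕtoℚ (10 ^ 30) * ι ≡ 1ℚ
  ι-inverse = invN-inverse′ (^-positive 9 30)

  ι-20 : invN (10 ^ 20) ≡ ℕtoℚ (10 ^ 10) * ι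
  ι-20 = inverse-unique (ℕtoℚ (10 ^ 20)) (invN-inverse′ (^-positive 9 20))
    (trans (sym (ℚP.*-assoc (ℕtoℚ (10 ^ 20)) (ℕtoℚ (10 ^ 10)) ι)) (trans (cong (_* ι) (sym (ℕtoℚ-* (10 ^ 20) (10 ^ 10)))) (invN-inverse′ (^-positive 9 30))))

floor : ℤ → ℕ → ℤ
floor z zero = + 0
floor z (suc d) = (z ℤ.* + (10 ^ 30)) /ℕ suc d

floor-error : ∀ z d → 0 < d → frac z d - ℤtoℚ (floor z d) * ι ≲ ι
floor-error z (suc d) _ = ≲-resp eq (≲-nonneg (0≤* (0≤* (0≤ℕtoℚ rem) (0≤invN (suc d))) 0≤ι)
    (≤-resp refl (ℚP.*-identityˡ ι) (*-monoʳ 0≤ι (≤-resp refl (invN-inverse d) (*-monoʳ (0≤invN (suc d)) (ℕtoℚ-mono (ℕP.<⇒≤ (n%ℕd<d a (suc d)))))))))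
  where
  open ≡-Reasoning
  a : ℤ
  a = z ℤ.* + (10 ^ 30)
  rem : ℕ
  rem = a %ℕ suc d
  t J D N : ℚ
  t = ℤtoℚ (floor z (suc d))
  J = invN (suc d)
  D = ℕtoℚ (suc d)
  N = ℕtoℚ (10 ^ 30)
  split : ℤtoℚ z * N ≡ ℕtoℚ rem + t * D
  split = trans (sym (ℤtoℚ-* z (+ (10 ^ 30)))) (trans (cong ℤtoℚ (a≡a%ℕn+[a/ℕn]*n a (suc d)))
    (trans (ℤtoℚ-+ (+ rem) (floor z (suc d) ℤ.* + suc d)) (cong (λ x → ℕtoℚ rem + x) (ℤtoℚ-* (floor z (suc d)) (+ suc d)))))
  eq : ℕtoℚ rem * J * ι ≡ frac z (suc d) - t * ι
  eq = begin
    ℕtoℚ rem * J * ι                              ≡⟨ lemma₁ (ℕtoℚ rem) t D J ι ⟩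
    (ℕtoℚ rem + t * D) * (J * ι) - t * ι * (D * J) ≡⟨ cong₂ (λ x w → x * (J * ι) - t * ι * w) (sym split) (invN-inverse d) ⟩
    ℤtoℚ z * N * (J * ι) - t * ι * 1ℚ             ≡⟨ lemma₂ (ℤtoℚ z) N J ι t ⟩
    ℤtoℚ z * J * (N * ι) - t * ι                  ≡⟨ cong (λ x → ℤtoℚ z * J * x - t * ι) ι-inverse ⟩
    ℤtoℚ z * J * 1ℚ - t * ι                       ≡⟨ cong (λ x → x - t * ι) (trans (ℚP.*-identityʳ (ℤtoℚ z * J)) (sym (÷ℕ-invN (ℤtoℚ z) (suc d)))) ⟩
    frac z (suc d) - t * ι ∎
    where
    lemma₁ : ∀ r t D J ι → r * J * ι ≡ (r + t * D) * (J * ι) - t * ι * (D * J)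
    lemma₁ = solve-∀ ℚ-ring
    lemma₂ : ∀ z N J ι t → z * N * (J * ι) - t * ι * 1ℚ ≡ z * J * (N * ι) - t * ι
    lemma₂ = solve-∀ ℚ-ring

sumFloor : ℕ → (ℕ → ℤ) → (ℕ → ℕ) → ℤ
sumFloor zero z d = + 0
sumFloor (suc K) z d = sumFloor K z d ℤ.+ floor (z (suc K)) (d (suc K))

sumFloor-error : ∀ K z d → (∀ k → 0 < d k) → sumTo K (λ k → frac (z k) (d k)) - ℤtoℚ (sumFloor K z d) * ι ≲ ℕtoℚ K * ι
sumFloor-error zero z d pos = ≲-resp (lemma ι) (≲-nonneg ℚP.≤-refl (ℚP.≤-reflexive (sym (ℚP.*-zeroˡ ι))))
  where
  lemma : ∀ a → 0ℚ ≡ 0ℚ - 0ℚ * a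
  lemma = solve-∀ ℚ-ring
sumFloor-error (suc K) z d pos = ≲-resp
    (trans (lemma₁ (sumTo K (λ k → frac (z k) (d k))) (ℤtoℚ (sumFloor K z d)) ι (frac (z (suc K)) (d (suc K))) (ℤtoℚ (floor (z (suc K)) (d (suc K)))))
      (cong (λ x → sumTo K (λ k → frac (z k) (d k)) + frac (z (suc K)) (d (suc K)) - x * ι) (sym (ℤtoℚ-+ (sumFloor K z d) (floor (z (suc K)) (d (suc K)))))))
    (≲-weaken (≲-+ (sumFloor-error K z d pos) (floor-error (z (suc K)) (d (suc K)) (pos (suc K))))
      (ℚP.≤-reflexive (trans (lemma₂ (ℕtoℚ K) ι) (cong (_* ι) (sym (ℕtoℚ-suc K))))))
  where
  lemma₁ : ∀ s f ι a b → s - f * ι + (a - b * ι) ≡ s + a - (f + b) * ι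
  lemma₁ = solve-∀ ℚ-ring
  lemma₂ : ∀ K ι → K * ι + ι ≡ (1ℚ + K) * ι
  lemma₂ = solve-∀ ℚ-ring

-- Reduces a comparison of rationals to an inequality between natural numbers, which is decided by
-- computation.
geometric-≤ : ∀ A k N c a {ι} → A ≡ ℕtoℚ a → ℕtoℚ N * ι ≡ 1ℚ → 0ℚ ≤ℚ ι → a ℕ.* N ≤ c ℕ.* 2 ^ k → A * ½ ** k ≤ℚ ℕtoℚ c * ι
geometric-≤ A k N c a {ι} A-eq inv 0≤ι le = ≤-resp left right (*-monoʳ (0≤* (0≤** 0≤½ k) 0≤ι) (ℕtoℚ-mono le))
  where
  left : ℕtoℚ (a ℕ.* N) * (½ ** k * ι) ≡ A * ½ ** k
  left = trans (cong (_* (½ ** k * ι)) (trans (ℕtoℚ-* a N) (cong (_* ℕtoℚ N) (sym A-eq)))) (trans (lemma A (ℕtoℚ N) (½ ** k) ι)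
    (trans (cong (A * ½ ** k *_) inv) (ℚP.*-identityʳ (A * ½ ** k))))
    where
    lemma : ∀ a b c d → a * b * (c * d) ≡ a * c * (b * d)
    lemma = solve-∀ ℚ-ring
  right : ℕtoℚ (c ℕ.* 2 ^ k) * (½ ** k * ι) ≡ ℕtoℚ c * ι
  right = trans (cong (_* (½ ** k * ι)) (trans (ℕtoℚ-* c (2 ^ k)) (cong (ℕtoℚ c *_) (ℕtoℚ-^ 2 k))))
    (trans (lemma (ℕtoℚ c) (ℕtoℚ 2 ** k) (½ ** k) ι) (trans (cong (λ x → ℕtoℚ c * x * ι) (trans (sym (**-* (ℕtoℚ 2) ½ k)) (1** k)))
      (cong (_* ι) (ℚP.*-identityʳ (ℕtoℚ c)))))
    where
    lemma : ∀ a b c d → a * b * (c * d) ≡ a * (b * c) * d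
    lemma = solve-∀ ℚ-ring

-- 872 is `1000 - 128`: the tail and 128 rounding errors together make 1000 units of `10⁻³⁰`.
tail-small : C-sum * ½ ** 128 ≤ℚ ℕtoℚ 872 * ι
tail-small = geometric-≤ C-sum 128 (10 ^ 30) 872 (1350 ℕ.* 40 ^ 5) (sym (ℕtoℚ-* 1350 (40 ^ 5))) ι-inverse 0≤ι
  (ℕP.≤ᵇ⇒≤ (1350 ℕ.* 40 ^ 5 ℕ.* 10 ^ 30) (872 ℕ.* 2 ^ 128) _)

partial-sums : ∀ {f} K₀ c z d S → (∀ k → 0 < d k) → (∀ k → f k ≡ frac (z k) (d k)) → (∀ j → f (suc j) ≲ C-sum * ½ ** suc j) →
  C-sum * ½ ** K₀ ≤ℚ ℕtoℚ c * ι → sumFloor K₀ z d ≡ S → ∀ K → K₀ ≤ K → sumTo K f - ℤtoℚ S * ι ≲ ℕtoℚ (c ℕ.+ K₀) * ι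
partial-sums {f} K₀ c z d S pos eq decays small S-eq K le = ≲-resp (lemma (sumTo K f) (sumTo K₀ f) (ℤtoℚ S * ι))
  (≲-weaken (≲-+ (≲-weaken (sumTo-tail′ 0≤C-sum decays K₀ K le) small)
      (≲-resp (cong₂ (λ x S → x - ℤtoℚ S * ι) (sym (sumTo-cong K₀ {f} {λ k → frac (z k) (d k)} (λ k → eq (suc k)))) S-eq) (sumFloor-error K₀ z d pos)))
    (ℚP.≤-reflexive (trans (sym (ℚP.*-distribʳ-+ ι (ℕtoℚ c) (ℕtoℚ K₀))) (cong (_* ι) (sym (ℕtoℚ-+ c K₀))))))
  where
  lemma : ∀ a b c → a - b + (b - c) ≡ a - c
  lemma = solve-∀ ℚ-ring

-- Decimal digits of the four constants

numa0 numb1 : ℕ → ℤ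
numa0 r = pow (+ 4) (suc r) ℤ.* (+ 3 ℤ.* i r ℤ.- + 1) ℤ.+ + 4
numb1 r = + 6 ℤ.* pow (+ 64) r ℤ.* (+ 2 ℤ.* pow (i r) 3 ℤ.- + 5 ℤ.* pow (i r) 2 ℤ.+ + 4 ℤ.* i r ℤ.- + 1)
   ℤ.- + 6 ℤ.* pow (+ 16) r ℤ.* (+ 16 ℤ.* pow (i r) 3 ℤ.- + 24 ℤ.* pow (i r) 2 ℤ.+ + 10 ℤ.* i r ℤ.- + 1)
   ℤ.+ + 24 ℤ.* pow (+ 4) r ℤ.* (+ 2 ℤ.* i r ℤ.- + 1) ℤ.* pow (i r) 2

weighted-frac : ∀ r z d → twoRm1 r * frac z d ≡ frac ((+ 2 ℤ.* i r ℤ.- + 1) ℤ.* z) d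
weighted-frac r z d = trans (cong (twoRm1 r *_) (÷ℕ-invN (ℤtoℚ z) d)) (trans (sym (ℚP.*-assoc (twoRm1 r) (ℤtoℚ z) (invN d)))
  (trans (cong (_* invN d) (sym (ℤtoℚ-* (+ 2 ℤ.* i r ℤ.- + 1) z))) (sym (÷ℕ-invN (ℤtoℚ ((+ 2 ℤ.* i r ℤ.- + 1) ℤ.* z)) d))))

q4^-positive : ∀ e k → 0 < q4 k ^ e
q4^-positive e k = ℕP.≤-trans (^-positive 1 e) (ℕP.^-monoˡ-≤ e (ℕP.m≤n+m 2 (4 ^ k)))

-- Sums of 128 terms, each rounded down to 30 decimals, in units of `10⁻³⁰`; the equations below
-- hold by evaluation.
S₀ S₁ S₂ S₃ : ℤ
S₀ = + 2718253642867952852664836192791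
S₁ = + 4222097151015884082382187347734
S₂ = + 8307358909108644144012274405504
S₃ = + 32115637242666291846166289809171

sum-a0 : sumFloor 128 numa0 (λ k → q4 k ^ 2) ≡ S₀
sum-a0 = refl

sum-b1 : sumFloor 128 numb1 (λ k → q4 k ^ 4) ≡ S₁
sum-b1 = refl

sum-wa0 : sumFloor 128 (λ k → (+ 2 ℤ.* i k ℤ.- + 1) ℤ.* numa0 k) (λ k → q4 k ^ 2) ≡ S₂
sum-wa0 = refl

sum-wb1 : sumFloor 128 (λ k → (+ 2 ℤ.* i k ℤ.- + 1) ℤ.* numb1 k) (λ k → q4 k ^ 4) ≡ S₃
sum-wb1 = refl

near-a0 : ∀ K → 128 ≤ K → sumTo K a0 - ℤtoℚ S₀ * ι ≲ ℕtoℚ 1000 * ι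
near-a0 = partial-sums 128 872 numa0 (λ k → q4 k ^ 2) S₀ (q4^-positive 2) (λ k → refl) a0-decay tail-small sum-a0

near-b1 : ∀ K → 128 ≤ K → sumTo K b1 - ℤtoℚ S₁ * ι ≲ ℕtoℚ 1000 * ι
near-b1 = partial-sums 128 872 numb1 (λ k → q4 k ^ 4) S₁ (q4^-positive 4) (λ k → refl) b1-decay tail-small sum-b1

near-wa0 : ∀ K → 128 ≤ K → sumTo K (λ k → twoRm1 k * a0 k) - ℤtoℚ S₂ * ι ≲ ℕtoℚ 1000 * ι
near-wa0 = partial-sums 128 872 (λ k → (+ 2 ℤ.* i k ℤ.- + 1) ℤ.* numa0 k) (λ k → q4 k ^ 2) S₂ (q4^-positive 2)
  (λ k → weighted-frac k (numa0 k) (q4 k ^ 2)) wa0-decay tail-small sum-wa0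

near-wb1 : ∀ K → 128 ≤ K → sumTo K (λ k → twoRm1 k * b1 k) - ℤtoℚ S₃ * ι ≲ ℕtoℚ 1000 * ι
near-wb1 = partial-sums 128 872 (λ k → (+ 2 ℤ.* i k ℤ.- + 1) ℤ.* numb1 k) (λ k → q4 k ^ 4) S₃ (q4^-positive 4)
  (λ k → weighted-frac k (numb1 k) (q4 k ^ 4)) wb1-decay tail-small sum-wb1

ℤtoℚ-≲ : ∀ z → ℤtoℚ z ≲ ℕtoℚ ℤ.∣ z ∣
ℤtoℚ-≲ (+ n) = ≲-self (0≤ℕtoℚ n)
ℤtoℚ-≲ -[1+ n ] = ≲-neg (≲-self (0≤ℕtoℚ (suc n)))

-- Ten spare decimals leave room: the error `e` and the distance from `S` to the stated digits
-- together stay within one unit of `10⁻²⁰`.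
near-dec20 : ∀ {s} e S D → s - ℤtoℚ S * ι ≲ ℕtoℚ e * ι → e ℕ.+ ℤ.∣ S ℤ.- D ℤ.* + (10 ^ 10) ∣ ≤ 10 ^ 10 → s - dec20 D ≲ tenM20
near-dec20 {s} e S D p le = ≲-resp eq (≲-weaken (≲-+ p (≲-* (ℤtoℚ-≲ (S ℤ.- D ℤ.* + (10 ^ 10))) (≲-self 0≤ι))) final)
  where
  t : ℕ
  t = ℤ.∣ S ℤ.- D ℤ.* + (10 ^ 10) ∣
  final : ℕtoℚ e * ι + ℕtoℚ t * ι ≤ℚ tenM20
  final = ≤-resp (trans (cong (_* ι) (ℕtoℚ-+ e t)) (ℚP.*-distribʳ-+ ι (ℕtoℚ e) (ℕtoℚ t))) (sym ι-20) (*-monoʳ 0≤ι (ℕtoℚ-mono le))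
  lemma : ∀ s S ι D T → s - S * ι + (S - D * T) * ι ≡ s - D * (T * ι)
  lemma = solve-∀ ℚ-ring
  eq : s - ℤtoℚ S * ι + ℤtoℚ (S ℤ.- D ℤ.* + (10 ^ 10)) * ι ≡ s - dec20 D
  eq = trans (cong (λ x → s - ℤtoℚ S * ι + x * ι) (trans (ℤtoℚ-- S (D ℤ.* + (10 ^ 10))) (cong (λ x → ℤtoℚ S - x) (ℤtoℚ-* D (+ (10 ^ 10))))))
    (trans (lemma s (ℤtoℚ S) ι (ℤtoℚ D) (ℕtoℚ (10 ^ 10)))
      (cong (λ x → s - x) (trans (cong (ℤtoℚ D *_) (sym ι-20)) (sym (÷ℕ-invN (ℤtoℚ D) (10 ^ 20))))))

scaled-≤ : ∀ a c → a ≤ c ℕ.* 10 ^ 30 → ℕtoℚ a * ι ≤ℚ ℕtoℚ c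
scaled-≤ a c le = ≤-resp refl (trans (cong (_* ι) (ℕtoℚ-* c (10 ^ 30))) (trans (ℚP.*-assoc (ℕtoℚ c) (ℕtoℚ (10 ^ 30)) ι)
  (trans (cong (ℕtoℚ c *_) ι-inverse) (ℚP.*-identityʳ (ℕtoℚ c))))) (*-monoʳ 0≤ι (ℕtoℚ-mono le))

-- A product of two approximations has 60 decimals; replacing it by one with 30 costs at most one
-- unit.
rounding : ∀ z → ℤ.∣ z ∣ ≤ 10 ^ 30 → ℤtoℚ z * ι * ι ≲ ι
rounding z le = ≲-weaken (≲-* (≲-* (ℤtoℚ-≲ z) (≲-self 0≤ι)) (≲-self 0≤ι))
  (≤-resp refl (ℚP.*-identityˡ ι) (*-monoʳ 0≤ι (scaled-≤ ℤ.∣ z ∣ 1 (ℕP.≤-trans le (ℕP.≤-reflexive (sym (ℕP.*-identityˡ (10 ^ 30))))))))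

-- P - A² = p - a (a + 2 s ι) + (q N - s²) ι² with p = P - q ι, a = A - s ι and N ι = 1.
near-variance : ∀ {P A} e q s T → P - ℕtoℚ q * ι ≲ ℕtoℚ e * ι → A - ℕtoℚ s * ι ≲ ℕtoℚ e * ι →
  e ℕ.+ 2 ℕ.* s ≤ 6 ℕ.* 10 ^ 30 → ℤ.∣ + q ℤ.* + (10 ^ 30) ℤ.- + s ℤ.* + s ℤ.- T ℤ.* + (10 ^ 30) ∣ ≤ 10 ^ 30 →
  (P - A * A) - ℤtoℚ T * ι ≲ ℕtoℚ (7 ℕ.* e ℕ.+ 1) * ι
near-variance {P} {A} e q s T p a le₁ le₂ = ≲-resp eq (≲-weaken
    (≲-+ (≲-- p (≲-* a (≲-weaken (≲-+ a (≲-self (0≤* (0≤* (0≤ℕtoℚ 2) (0≤ℕtoℚ s)) 0≤ι))) small))) (rounding ζ le₂))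
    (ℚP.≤-reflexive (trans (lemma₂ (ℕtoℚ e) ι) (cong (_* ι) (sym (trans (ℕtoℚ-+ (7 ℕ.* e) 1) (cong (_+ 1ℚ) (ℕtoℚ-* 7 e))))))))
  where
  N : ℚ
  N = ℕtoℚ (10 ^ 30)
  ζ : ℤ
  ζ = + q ℤ.* + (10 ^ 30) ℤ.- + s ℤ.* + s ℤ.- T ℤ.* + (10 ^ 30)
  ζ-eq : ℤtoℚ ζ ≡ ℕtoℚ q * N - ℕtoℚ s * ℕtoℚ s - ℤtoℚ T * N
  ζ-eq = trans (ℤtoℚ-- (+ q ℤ.* + (10 ^ 30) ℤ.- + s ℤ.* + s) (T ℤ.* + (10 ^ 30)))
    (cong₂ _-_ (trans (ℤtoℚ-- (+ q ℤ.* + (10 ^ 30)) (+ s ℤ.* + s)) (cong₂ _-_ (ℤtoℚ-* (+ q) (+ (10 ^ 30))) (ℤtoℚ-* (+ s) (+ s)))) (ℤtoℚ-* T (+ (10 ^ 30))))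
  small : ℕtoℚ e * ι + ℕtoℚ 2 * ℕtoℚ s * ι ≤ℚ ℕtoℚ 6
  small = ≤-resp (trans (cong (_* ι) (trans (ℕtoℚ-+ e (2 ℕ.* s)) (cong (λ x → ℕtoℚ e + x) (ℕtoℚ-* 2 s)))) (ℚP.*-distribʳ-+ ι (ℕtoℚ e) (ℕtoℚ 2 * ℕtoℚ s))) refl (scaled-≤ (e ℕ.+ 2 ℕ.* s) 6 le₁)
  lemma₁ : ∀ P A q s T N ι → P - q * ι - (A - s * ι) * (A - s * ι + ℕtoℚ 2 * s * ι) + (q * N - s * s - T * N) * ι * ι
    ≡ P - A * A - T * ι * (N * ι) + q * ι * (N * ι - 1ℚ)
  lemma₁ = solve-∀ ℚ-ring
  lemma₂ : ∀ e ι → e * ι + e * ι * ℕtoℚ 6 + ι ≡ (ℕtoℚ 7 * e + 1ℚ) * ι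
  lemma₂ = solve-∀ ℚ-ring
  lemma₃ : ∀ P A T q ι → P - A * A - T * ι * 1ℚ + q * ι * (1ℚ - 1ℚ) ≡ P - A * A - T * ι
  lemma₃ = solve-∀ ℚ-ring
  eq : P - ℕtoℚ q * ι - (A - ℕtoℚ s * ι) * (A - ℕtoℚ s * ι + ℕtoℚ 2 * ℕtoℚ s * ι) + ℤtoℚ ζ * ι * ι ≡ P - A * A - ℤtoℚ T * ι
  eq = trans (cong (λ x → P - ℕtoℚ q * ι - (A - ℕtoℚ s * ι) * (A - ℕtoℚ s * ι + ℕtoℚ 2 * ℕtoℚ s * ι) + x * ι * ι) ζ-eq)
    (trans (lemma₁ P A (ℕtoℚ q) (ℕtoℚ s) (ℤtoℚ T) N ι)
      (trans (cong (λ x → P - A * A - ℤtoℚ T * ι * x + ℕtoℚ q * ι * (x - 1ℚ)) ι-inverse) (lemma₃ P A (ℤtoℚ T) (ℕtoℚ q) ι)))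

-- The same for - Q + 2 A B, with B = b + t ι.
near-covariance : ∀ {Q A B} e q s t T → Q - ℕtoℚ q * ι ≲ ℕtoℚ e * ι → A - ℕtoℚ s * ι ≲ ℕtoℚ e * ι → B - ℕtoℚ t * ι ≲ ℕtoℚ e * ι →
  e ℕ.+ t ≤ 5 ℕ.* 10 ^ 30 → s ≤ 3 ℕ.* 10 ^ 30 →
  ℤ.∣ ℤ.- (+ q ℤ.* + (10 ^ 30)) ℤ.+ + 2 ℤ.* + s ℤ.* + t ℤ.- T ℤ.* + (10 ^ 30) ∣ ≤ 10 ^ 30 →
  (- Q - ℕtoℚ 2 * A * - B) - ℤtoℚ T * ι ≲ ℕtoℚ (17 ℕ.* e ℕ.+ 1) * ι
near-covariance {Q} {A} {B} e q s t T κ a b le₁ le₂ le₃ = ≲-resp eq (≲-weaken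
    (≲-+ (≲-+ (≲-+ (≲-neg κ) (≲-* (≲-* (≲-self (0≤ℕtoℚ 2)) a) (≲-weaken (≲-+ b (≲-self (0≤* (0≤ℕtoℚ t) 0≤ι))) small)))
              (≲-* (≲-* (≲-self (0≤ℕtoℚ 2)) (≲-nonneg (0≤* (0≤ℕtoℚ s) 0≤ι) (scaled-≤ s 3 le₂))) b))
         (rounding ζ le₃))
    -- 17 is `1 + 2 · 5 + 2 · 3`, from the bounds 5 on `b + t ι` and 3 on `s ι`; the last unit is
    -- the rounding.
    (ℚP.≤-reflexive (trans (lemma₂ (ℕtoℚ e) ι) (cong (_* ι) (sym (trans (ℕtoℚ-+ (17 ℕ.* e) 1) (cong (_+ 1ℚ) (ℕtoℚ-* 17 e))))))))
  where
  N : ℚ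
  N = ℕtoℚ (10 ^ 30)
  ζ : ℤ
  ζ = ℤ.- (+ q ℤ.* + (10 ^ 30)) ℤ.+ + 2 ℤ.* + s ℤ.* + t ℤ.- T ℤ.* + (10 ^ 30)
  ζ-eq : ℤtoℚ ζ ≡ - (ℕtoℚ q * N) + ℕtoℚ 2 * ℕtoℚ s * ℕtoℚ t - ℤtoℚ T * N
  ζ-eq = trans (ℤtoℚ-- (ℤ.- (+ q ℤ.* + (10 ^ 30)) ℤ.+ + 2 ℤ.* + s ℤ.* + t) (T ℤ.* + (10 ^ 30)))
    (cong₂ _-_ (trans (ℤtoℚ-+ (ℤ.- (+ q ℤ.* + (10 ^ 30))) (+ 2 ℤ.* + s ℤ.* + t))
      (cong₂ _+_ (trans (ℤtoℚ-neg (+ q ℤ.* + (10 ^ 30))) (cong -_ (ℤtoℚ-* (+ q) (+ (10 ^ 30)))))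
        (trans (ℤtoℚ-* (+ 2 ℤ.* + s) (+ t)) (cong (_* ℕtoℚ t) (ℤtoℚ-* (+ 2) (+ s)))))) (ℤtoℚ-* T (+ (10 ^ 30))))
  small : ℕtoℚ e * ι + ℕtoℚ t * ι ≤ℚ ℕtoℚ 5
  small = ≤-resp (trans (cong (_* ι) (ℕtoℚ-+ e t)) (ℚP.*-distribʳ-+ ι (ℕtoℚ e) (ℕtoℚ t))) refl (scaled-≤ (e ℕ.+ t) 5 le₁)
  lemma₁ : ∀ Q A B q s t T N ι → - (Q - q * ι) + ℕtoℚ 2 * (A - s * ι) * (B - t * ι + t * ι) + ℕtoℚ 2 * (s * ι) * (B - t * ι)
      + (- (q * N) + ℕtoℚ 2 * s * t - T * N) * ι * ι
    ≡ - Q - ℕtoℚ 2 * A * - B - T * ι * (N * ι) - q * ι * (N * ι - 1ℚ)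
  lemma₁ = solve-∀ ℚ-ring
  lemma₂ : ∀ e ι → e * ι + ℕtoℚ 2 * (e * ι) * ℕtoℚ 5 + ℕtoℚ 2 * ℕtoℚ 3 * (e * ι) + ι ≡ (ℕtoℚ 17 * e + 1ℚ) * ι
  lemma₂ = solve-∀ ℚ-ring
  lemma₃ : ∀ X T q ι → X - T * ι * 1ℚ - q * ι * (1ℚ - 1ℚ) ≡ X - T * ι
  lemma₃ = solve-∀ ℚ-ring
  eq : - (Q - ℕtoℚ q * ι) + ℕtoℚ 2 * (A - ℕtoℚ s * ι) * (B - ℕtoℚ t * ι + ℕtoℚ t * ι) + ℕtoℚ 2 * (ℕtoℚ s * ι) * (B - ℕtoℚ t * ι) + ℤtoℚ ζ * ι * ι
    ≡ - Q - ℕtoℚ 2 * A * - B - ℤtoℚ T * ι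
  eq = trans (cong (λ x → - (Q - ℕtoℚ q * ι) + ℕtoℚ 2 * (A - ℕtoℚ s * ι) * (B - ℕtoℚ t * ι + ℕtoℚ t * ι) + ℕtoℚ 2 * (ℕtoℚ s * ι) * (B - ℕtoℚ t * ι) + x * ι * ι) ζ-eq)
    (trans (lemma₁ Q A B (ℕtoℚ q) (ℕtoℚ s) (ℕtoℚ t) (ℤtoℚ T) N ι)
      (trans (cong (λ x → - Q - ℕtoℚ 2 * A * - B - ℤtoℚ T * ι * x - ℕtoℚ q * ι * (x - 1ℚ)) ι-inverse) (lemma₃ (- Q - ℕtoℚ 2 * A * - B) (ℤtoℚ T) (ℕtoℚ q) ι)))

c0-digits : LimAbsLe (λ K → s0 K - dec20 (+ 271825364286795285266)) tenM20
c0-digits = lim-intro 128 (λ K le → near-dec20 {s0 K} 1000 S₀ (+ 271825364286795285266) (near-a0 K le) (ℕP.≤ᵇ⇒≤ _ _ _))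

c1-digits : LimAbsLe (λ K → s1 K - dec20 (-[1+ 422209715101588408237 ])) tenM20
c1-digits = lim-intro 128 (λ K le → near-dec20 {s1 K} 1000 (ℤ.- S₁) (-[1+ 422209715101588408237 ])
    (≲-resp (trans (lemma (sumTo K b1) (ℤtoℚ S₁) ι) (cong (λ x → - sumTo K b1 - x * ι) (sym (ℤtoℚ-neg S₁)))) (≲-neg (near-b1 K le))) (ℕP.≤ᵇ⇒≤ _ _ _))
  where
  lemma : ∀ b S ι → - (b - S * ι) ≡ - b - - S * ι
  lemma = solve-∀ ℚ-ring

c2-digits : LimAbsLe (λ K → s2 K - dec20 (+ 91845604214374797357)) tenM20
c2-digits = lim-intro 128 (λ K le → near-dec20 {s2 K} 7001 T₂ (+ 91845604214374797357)
    (near-variance {sumTo K (λ k → twoRm1 k * a0 k)} {s0 K} 1000 ℤ.∣ S₂ ∣ ℤ.∣ S₀ ∣ T₂ (near-wa0 K le) (near-a0 K le) (ℕP.≤ᵇ⇒≤ _ _ _) (ℕP.≤ᵇ⇒≤ _ _ _)) (ℕP.≤ᵇ⇒≤ _ _ _))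
  where
  -- `S₂ - S₀²` rounded to 30 decimals; `near-variance` has it checked to within one unit.
  T₂ : ℤ
  T₂ = + 918456042143747973577971478279

c3-digits : LimAbsLe (λ K → s3 K - dec20 (-[1+ 916217532008362749968 ])) tenM20
c3-digits = lim-intro 128 (λ K le → near-dec20 {s3 K} 17001 T₃ (-[1+ 916217532008362749968 ])
    (near-covariance {sumTo K (λ k → twoRm1 k * b1 k)} {s0 K} {sumTo K b1} 1000 ℤ.∣ S₃ ∣ ℤ.∣ S₀ ∣ ℤ.∣ S₁ ∣ T₃ (near-wb1 K le) (near-a0 K le) (near-b1 K le)
      (ℕP.≤ᵇ⇒≤ _ _ _) (ℕP.≤ᵇ⇒≤ _ _ _) (ℕP.≤ᵇ⇒≤ _ _ _)) (ℕP.≤ᵇ⇒≤ _ _ _))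
  where
  -- `- S₃ + 2 S₀ S₁` rounded to 30 decimals; the sign of the product is positive because `s1` is
  -- minus the sum of `b1`.
  T₃ : ℤ
  T₃ = ℤ.- + 9162175320083627499691243657203

mainTheorem8 : (∃ λ (C : ℚ) → ∃ λ (N : ℕ) → (n : ℕ) → N ≤ n → 2 ≤ n → (r : ℕ) → 1 ≤ r →
    ∣ probD n r - (mainTerm0 r - mainTerm1 r * invN n) ∣
    ≤ℚ C * ℕtoℚ (r ^ 5) * invN (3 ^ r) * invN n * invN n)
    × LimAbsLe (λ K → s0 K - dec20 (+ 271825364286795285266)) tenM20
    × LimAbsLe (λ K → s1 K - dec20 (-[1+ 422209715101588408237 ])) tenM20
    × LimAbsLe (λ K → s2 K - dec20 (+ 91845604214374797357)) tenM20
    × LimAbsLe (λ K → s3 K - dec20 (-[1+ 916217532008362749968 ])) tenM20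
    × (∃ λ (C : ℚ) → ∃ λ (N : ℕ) → (n : ℕ) → N ≤ n → 2 ≤ n →
    LimAbsLe (λ K → expD n - (s0 K + s1 K * invN n)) (C * invN n * invN n))
    × (∃ λ (C : ℚ) → ∃ λ (N : ℕ) → (n : ℕ) → N ≤ n → 2 ≤ n →
    LimAbsLe (λ K → varD n - (s2 K + s3 K * invN n)) (C * invN n * invN n))
mainTheorem8 =
    (C-prob , 4 , λ n 4≤n _ → prob-asymptotics n 4≤n)
  , c0-digits
  , c1-digits
  , c2-digits
  , c3-digits
  , (C₁ , 4 , λ n 4≤n _ → expectation-asymptotics n 4≤n)
  , (C-var , 4 , λ n 4≤n _ → variance-asymptotics n 4≤n)
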